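{- Let $K_{3,25}'$ denote the $1$-subdivision of the complete bipartite graph $K_{3,25}$. Then $\mathrm{ex}(n,K_{3,25}')=\Theta(n^{4/3})$; that is, there are constants $c,C>0$ such that $c\,n^{4/3}\le \mathrm{ex}(n,K_{3,25}')\le C\,n^{4/3}$ for all sufficiently large $n$.
   Context: For a graph $H$, the Turán number $\mathrm{ex}(n,H)$ is the maximum number of edges in an $n$-vertex (simple) graph that contains no subgraph isomorphic to $H$. The $1$-subdivision $H'$ of a graph $H$ is the graph obtained from $H$ by replacing each edge of $H$ by a path of length $2$, where the new middle vertices are distinct for distinct edges and are not vertices of $H$ (i.e. the edges are replaced by internally disjoint paths of length $2$). -}

module Defs where

open import Data.Nat using (ℕ; zero; suc; _+_; _*_; _^_; _≤_; _<_; _<ᵇ_)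
open import Data.Bool using (Bool; true; false; _∧_; if_then_else_)
open import Data.Fin using (Fin; toℕ)
open import Data.List using (List; map; allFin)
open import Data.Nat.ListAction using (sum)
open import Data.Sum using (_⊎_; inj₁; inj₂)
open import Data.Product using (_×_; _,_; Σ)
open import Data.Empty using (⊥)
open import Relation.Binary.PropositionalEquality using (_≡_)
open import Function.Definitions using (Injective)

record SimpleGraph (n : ℕ) : Set where
  field
    adj     : Fin n → Fin n → Bool
    symm    : ∀ i j → adj i j ≡ adj j i
    irrefl  : ∀ i → adj i i ≡ false
open SimpleGraph public

numEdges : ∀ {n} → SimpleGraph n → ℕ
numEdges {n} G =
  sum (map (λ i → sum (map (λ j →
        if (toℕ i <ᵇ toℕ j) ∧ adj G i j then 1 else 0) (allFin n))) (allFin n))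

record PatternGraph : Set₁ where
  field
    Vert  : Set
    Edge  : Set
    end₁  : Edge → Vert
    end₂  : Edge → Vert
open PatternGraph public

PAdj : (H : PatternGraph) → Vert H → Vert H → Set
PAdj H u v = Σ (Edge H) λ e → ((end₁ H e ≡ u) × (end₂ H e ≡ v)) ⊎ ((end₁ H e ≡ v) × (end₂ H e ≡ u))

-- The 1-subdivision: each edge e is replaced by a path end₁ e — m_e — end₂ e
-- through a new middle vertex m_e (distinct for distinct edges).
subdivision : PatternGraph → PatternGraph
subdivision H = record
  { Vert = Vert H ⊎ Edge H
  ; Edge = Edge H ⊎ Edge H
  ; end₁ = λ { (inj₁ e) → inj₁ (end₁ H e) ; (inj₂ e) → inj₂ e }
  ; end₂ = λ { (inj₁ e) → inj₂ e ; (inj₂ e) → inj₁ (end₂ H e) }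
  }

K : ℕ → ℕ → PatternGraph
K s t = record
  { Vert = Fin s ⊎ Fin t
  ; Edge = Fin s × Fin t
  ; end₁ = λ { (i , j) → inj₁ i }
  ; end₂ = λ { (i , j) → inj₂ j }
  }

Contains : ∀ {n} → SimpleGraph n → PatternGraph → Set
Contains {n} G H =
  Σ (Vert H → Fin n) λ f →
    Injective _≡_ _≡_ f × (∀ u v → PAdj H u v → adj G (f u) (f v) ≡ true)

HFree : ∀ {n} → SimpleGraph n → PatternGraph → Set
HFree G H = Contains G H → ⊥

IsEx : ℕ → PatternGraph → ℕ → Set
IsEx n H m =
  (Σ (SimpleGraph n) λ G → HFree G H × (numEdges G ≡ m))
  × ((G : SimpleGraph n) → HFree G H → numEdges G ≤ m)

{-# OPTIONS --safe #-}

-- Upper bound.  Take a set S of vertices minimal with more than C |S|^{4/3} edges.  By minimality few edges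
-- touch vertices of degree far above the average, so these can be deleted, and the maximum degree Δ becomes
-- comparable to the average degree.  Call a pair of vertices light if its codegree is bounded.  A large clique
-- of heavy pairs would allow a greedy embedding of K'_{3,25}, so Turán's theorem makes a positive proportion of
-- all cherries light, and convexity gives at least a constant times n Δ⁶ systems of three light cherries zyᵢxᵢ
-- with a common end z.  If (x₁,x₂,x₃) admits no 25 disjoint systems, then some 99 vertices meet all its systems.
-- In particular it has O(Δ) of them; applied to (u,x₂,x₃), where u and z range over the vertices linked to both
-- x₂ and x₃, this bounds the light pairs (u,z) and hence, by Turán's theorem again, shows that on average a
-- vertex y₁ has only O(1) neighbours z linked to x₂ and x₃.  Discarding the few systems with more, every triple
-- (x₁,x₂,x₃) carries O(1) systems, so n Δ⁶ = O(n³).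
--
-- Lower bound.  Over F_p let D = {1,…,m} with 4m < p, and join (a,b,c) to (u,v,w) in D × F_p² when
-- b + w = a u² and c + v = a² u.  A vertex (s,t,r) at distance two from (aᵢ,bᵢ,cᵢ) satisfies
-- (bᵢ - t)(aᵢ - s)(aᵢ + s)² = (cᵢ - r)².  For three given vertices, eliminating t and r leaves an equation
-- F(s) = 0 of degree at most 12, and every s carries at most two solutions.  So 25 solutions force F = 0, and
-- the values of F at s = ±aᵢ show that the three vertices have a common neighbour; in that case s is unique.
-- Suitable primes p exist between 4^j and 4^{j+1} + 1 because lcm(1,…,2m+1) ≥ 4^m, whereas without primes
-- between k and n the number lcm(1,…,n) divides the product of the primes up to k, which is at most 4^k, times
-- at most √n prime powers not exceeding n.
module Submission where

-- Cubes and fourth powers replace the exponent 4/3, so densities are compared as `n ^ 4` against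
-- `m ^ 3` without roots. The obstacle in the upper bound is that a hitting set of 99 vertices is
-- not yet a bound: one middle vertex may lie in about Δ systems of the same triple. The threshold
-- `M` separates such vertices. The constant of the surviving systems grows with `M`, so the density
-- constant `B` has to be chosen after `M`. The numbers are 99 = 3 + 24 * 4, the vertices in use
-- when the last of 25 systems is placed, and 25 = 2 * 13 - 1: with at most two solutions above each
-- abscissa, 25 solutions have 13 abscissae, more than the degree bound 12. First coordinates lie in
-- an interval shorter than p / 4, so that sums of two or four of them never vanish modulo p. This
-- excludes opposite abscissae and one exceptional position in the count above a fixed abscissa.

open import Defs
open import Data.Product using (Σ; _×_; _,_; proj₁; proj₂)
open import Data.Sum using (_⊎_; inj₁; inj₂; [_,_]′)
open import Data.Empty using (⊥; ⊥-elim)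
open import Relation.Nullary using (¬_; Dec; yes; no; does)
open import Relation.Binary.PropositionalEquality using (_≡_; _≢_; refl; sym; trans; cong; cong₂; subst; subst₂; module ≡-Reasoning)
open import Function using (_∘_)

-- Arithmetic modulo a prime, carried out on integers.

module IntegersModulo where

  open import Data.Nat as ℕ using (ℕ; zero; suc; s≤s)
  import Data.Nat.Divisibility as ℕᵈ
  open import Data.Nat.Primality using (Prime; euclidsLemma)
  open import Data.Integer as ℤ using (ℤ; +_; -[1+_]; -_; _+_; _-_; 0ℤ; 1ℤ; ∣_∣)
  import Data.Integer.Properties as ℤₚ
  open import Data.Integer.Divisibility.Signed using (_∣_; _∣?_; divides; ∣ᵤ⇒∣; ∣⇒∣ᵤ; ∣m∣n⇒∣m+n; ∣n⇒∣m*n)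
  open import Algebra.Bundles using (CommutativeRing)
  open import Tactic.RingSolver using (solve-∀)
  open import Tactic.RingSolver.Core.AlmostCommutativeRing using (AlmostCommutativeRing; fromCommutativeRing)
  open import Data.List using ([]; _∷_; length)
  open import Data.List.Relation.Unary.All using (All; []; _∷_)
  open import Data.List.Relation.Unary.AllPairs using (AllPairs; []; _∷_)
  open import Data.Maybe using (just; nothing)
  open import Level using (0ℓ)

  infixl 7 _*_

  -- Integer multiplication, except that it does not unfold when its first argument
  -- is neutral; this keeps the terms in the proofs below small.
  _*_ : ℤ → ℤ → ℤ
  (+ n)    * y = (+ n) ℤ.* y
  -[1+ n ] * y = -[1+ n ] ℤ.* y

  *≡ : ∀ x y → x * y ≡ x ℤ.* y
  *≡ (+ n)    y = refl
  *≡ -[1+ n ] y = refl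

  ℤ-commutativeRing : CommutativeRing 0ℓ 0ℓ
  ℤ-commutativeRing = record
    { Carrier = ℤ ; _≈_ = _≡_ ; _+_ = _+_ ; _*_ = _*_ ; -_ = -_ ; 0# = 0ℤ ; 1# = 1ℤ
    ; isCommutativeRing = record
      { isRing = record
        { +-isAbelianGroup = ℤₚ.+-0-isAbelianGroup
        ; *-cong = cong₂ _*_
        ; *-assoc = λ x y z → trans (trans (*≡ (x * y) z) (cong (ℤ._* z) (*≡ x y)))
            (trans (ℤₚ.*-assoc x y z) (sym (trans (*≡ x (y * z)) (cong (x ℤ.*_) (*≡ y z)))))
        ; *-identity = ℤₚ.*-identityˡ , λ x → trans (*≡ x 1ℤ) (ℤₚ.*-identityʳ x)
        ; distrib =
            (λ x y z → trans (*≡ x (y + z)) (trans (ℤₚ.*-distribˡ-+ x y z) (sym (cong₂ _+_ (*≡ x y) (*≡ x z))))) ,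
            (λ x y z → trans (*≡ (y + z) x) (trans (ℤₚ.*-distribʳ-+ x y z) (sym (cong₂ _+_ (*≡ y x) (*≡ z x)))))
        }
      ; *-comm = λ x y → trans (*≡ x y) (trans (ℤₚ.*-comm x y) (sym (*≡ y x)))
      }
    }

  ℤ-ring : AlmostCommutativeRing 0ℓ 0ℓ
  ℤ-ring = fromCommutativeRing ℤ-commutativeRing λ { (+ 0) → just refl ; _ → nothing }

  -- Horner form as a property of a function. `d` is only an upper bound for the degree, so an
  -- elimination polynomial can be certified without expanding its coefficients.
  Poly : ℕ → (ℤ → ℤ) → Set
  Poly zero    f = Σ ℤ λ c → ∀ x → f x ≡ c
  Poly (suc d) f = Σ ℤ λ c → Σ (ℤ → ℤ) λ g → Poly d g × (∀ x → f x ≡ c + x * g x)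

  poly-≗ : ∀ d {f g} → (∀ x → f x ≡ g x) → Poly d g → Poly d f
  poly-≗ zero    e (c , h)         = c , λ x → trans (e x) (h x)
  poly-≗ (suc d) e (c , g , pg , h) = c , g , pg , λ x → trans (e x) (h x)

  poly-const : ∀ d c → Poly d (λ _ → c)
  poly-const zero    c = c , λ _ → refl
  poly-const (suc d) c = c , (λ _ → 0ℤ) , poly-const d 0ℤ ,
    λ x → sym (trans (cong (_+_ c) (trans (*≡ x 0ℤ) (ℤₚ.*-zeroʳ x))) (ℤₚ.+-identityʳ c))

  poly-+ : ∀ d {f g} → Poly d f → Poly d g → Poly d (λ x → f x + g x)
  poly-+ zero    (c , p) (c′ , p′) = c + c′ , λ x → cong₂ _+_ (p x) (p′ x)
  poly-+ (suc d) (c , g , pg , p) (c′ , g′ , pg′ , p′) =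
    c + c′ , _ , poly-+ d pg pg′ , λ x → trans (cong₂ _+_ (p x) (p′ x)) (horner c c′ x (g x) (g′ x))
    where
    horner : ∀ c c′ x g g′ → (c + x * g) + (c′ + x * g′) ≡ (c + c′) + x * (g + g′)
    horner = solve-∀ ℤ-ring

  poly-k* : ∀ d k {f} → Poly d f → Poly d (λ x → k * f x)
  poly-k* zero    k (c , p)          = k * c , λ x → cong (k *_) (p x)
  poly-k* (suc d) k (c , g , pg , p) =
    k * c , _ , poly-k* d k pg , λ x → trans (cong (k *_) (p x)) (horner k c x (g x))
    where
    horner : ∀ k c x g → k * (c + x * g) ≡ k * c + x * (k * g)
    horner = solve-∀ ℤ-ring

  poly-shift : ∀ d {f} → Poly d f → Poly (suc d) (λ x → x * f x)
  poly-shift d {f} pf = 0ℤ , f , pf , λ x → sym (ℤₚ.+-identityˡ (x * f x))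

  poly-weaken : ∀ e d {f} → Poly d f → Poly (e ℕ.+ d) f
  poly-weaken zero    d p = p
  poly-weaken (suc e) d p = up (e ℕ.+ d) (poly-weaken e d p)
    where
    up : ∀ d {f} → Poly d f → Poly (suc d) f
    up zero    (c , p)          = poly-≗ 1 p (poly-const 1 c)
    up (suc d) (c , g , pg , p) = c , g , up d pg , p

  poly-* : ∀ d e {f g} → Poly d f → Poly e g → Poly (d ℕ.+ e) (λ x → f x * g x)
  poly-* zero    e {g = g} (c , p) pg = poly-≗ e (λ x → cong (_* g x) (p x)) (poly-k* e c pg)
  poly-* (suc d) e {g = g} (c , h , ph , p) pg =
    poly-≗ (suc d ℕ.+ e) (λ x → trans (cong (_* g x) (p x)) (expand c x (h x) (g x)))
      (poly-+ (suc d ℕ.+ e) (poly-weaken (suc d) e (poly-k* e c pg)) (poly-shift (d ℕ.+ e) (poly-* d e ph pg)))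
    where
    expand : ∀ c x h g → (c + x * h) * g ≡ c * g + x * (h * g)
    expand = solve-∀ ℤ-ring

  poly-x : Poly 1 (λ x → x)
  poly-x = 0ℤ , (λ _ → 1ℤ) , (1ℤ , λ _ → refl) ,
    λ x → sym (trans (ℤₚ.+-identityˡ _) (trans (*≡ x 1ℤ) (ℤₚ.*-identityʳ x)))

  poly-neg : ∀ d {f} → Poly d f → Poly d (λ x → - f x)
  poly-neg d {f} pf = poly-≗ d (λ x → sym (ℤₚ.-1*i≡-i (f x))) (poly-k* d (- 1ℤ) pf)

  poly-− : ∀ d {f g} → Poly d f → Poly d g → Poly d (λ x → f x - g x)
  poly-− d pf pg = poly-+ d pf (poly-neg d pg)

  -- Synthetic division: if `g x ≡ g r + (x - r) * q x`, then `c + x * g x` differs from its value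
  -- at `r` by `(x - r) * (g x + r * q x)`.
  poly-factor : ∀ d {f} → Poly (suc d) f → ∀ r →
    Σ (ℤ → ℤ) λ q → Poly d q × (∀ x → f x ≡ f r + (x - r) * q x)
  poly-factor zero {f} (c , g , (c′ , h) , p) r = g , (c′ , h) , λ x →
    trans (p x) (trans (trans (cong (λ y → c + x * y) (h x)) (arith c x r c′))
      (sym (cong₂ (λ y z → y + (x - r) * z) (trans (p r) (cong (λ y → c + r * y) (h r))) (h x))))
    where
    arith : ∀ c x r k → c + x * k ≡ (c + r * k) + (x - r) * k
    arith = solve-∀ ℤ-ring
  poly-factor (suc d) {f} (c , g , pg , p) r with poly-factor d pg r
  ... | q , pq , e = (λ x → g x + r * q x) ,
        poly-+ (suc d) pg (poly-weaken 1 d (poly-k* d r pq)) , λ x →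
        trans (p x) (trans (trans (cong (λ y → c + x * y) (e x)) (arith c x r (g r) (q x)))
          (sym (cong₂ (λ y z → y + (x - r) * (z + r * q x)) (p r) (e x))))
    where
    arith : ∀ c x r k q → c + x * (k + (x - r) * q) ≡ (c + r * k) + (x - r) * ((k + (x - r) * q) + r * q)
    arith = solve-∀ ℤ-ring

  module Modulo (p : ℕ) (isPrime : Prime p) where

    -- Divisibility of integers instead of equality in a quotient field: every deduction becomes an
    -- exact integer identity, which the ring solver checks.
    Z N : ℤ → Set
    Z x = (+ p) ∣ x
    N x = ¬ Z x

    Z? : ∀ x → Dec (Z x)
    Z? x = (+ p) ∣? x

    Z0 : ∀ {x} → x ≡ 0ℤ → Z x
    Z0 e = divides 0ℤ e

    Z-* : ∀ {x} k → Z x → Z (k * x)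
    Z-* {x} k zx = subst Z (sym (*≡ k x)) (∣n⇒∣m*n k zx)

    -- A new congruence is certified by explicit coefficients over known ones. Most proofs below
    -- consist in finding these coefficients.
    lin₁ : ∀ {x t} k → Z x → t ≡ k * x → Z t
    lin₁ k zx refl = Z-* k zx

    lin₂ : ∀ {x y t} k l → Z x → Z y → t ≡ k * x + l * y → Z t
    lin₂ k l zx zy refl = ∣m∣n⇒∣m+n (Z-* k zx) (Z-* l zy)

    lin₃ : ∀ {x y z t} k l m → Z x → Z y → Z z → t ≡ k * x + l * y + m * z → Z t
    lin₃ k l m zx zy zz refl = ∣m∣n⇒∣m+n (∣m∣n⇒∣m+n (Z-* k zx) (Z-* l zy)) (Z-* m zz)

    Z-split : ∀ x y → Z (x * y) → Z x ⊎ Z y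
    Z-split x y zxy with euclidsLemma ∣ x ∣ ∣ y ∣ isPrime
                           (subst (p ℕᵈ.∣_) (ℤₚ.abs-* x y) (∣⇒∣ᵤ (subst Z (*≡ x y) zxy)))
    ... | inj₁ h = inj₁ (∣ᵤ⇒∣ h)
    ... | inj₂ h = inj₂ (∣ᵤ⇒∣ h)

    cancel : ∀ {x} y → N x → Z (x * y) → Z y
    cancel {x} y nx z = [ (λ zx → ⊥-elim (nx zx)) , (λ zy → zy) ]′ (Z-split x y z)

    Z-sq : ∀ x → Z (x * x) → Z x
    Z-sq x z = [ (λ h → h) , (λ h → h) ]′ (Z-split x x z)

    N-* : ∀ {x y} → N x → N y → N (x * y)
    N-* {x} {y} nx ny z = ny (cancel y nx z)

    -- Lagrange's bound on roots: after splitting off `x - r`, primality cancels the differences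
    -- from `r`, so the other roots pass to the quotient. The conclusion at every `x` allows
    -- evaluation at points that are not among the given roots.
    vanish : ∀ d {f} → Poly d f → ∀ rs → d ℕ.< length rs →
             All (Z ∘ f) rs → AllPairs (λ r r′ → N (r - r′)) rs → ∀ x → Z (f x)
    vanish d pf [] () zs ap x
    vanish zero {f} (c , p) (r ∷ rs) _ (z ∷ _) _ x = subst Z (trans (p r) (sym (p x))) z
    vanish (suc d) {f} pf (r ∷ rs) (s≤s lt) (z ∷ zs) (a ∷ ap) x with poly-factor d pf r
    ... | q , pq , e = lin₂ 1ℤ (x - r) z (vanish d pq rs lt (roots rs zs a) ap x)
                         (trans (e x) (cong (_+ (x - r) * q x) (sym (ℤₚ.*-identityˡ (f r)))))
      where
      quot : ∀ u v w → w ≡ u + v → v ≡ 1ℤ * w + (- 1ℤ) * u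
      quot u v w refl = arith u v
        where
        arith : ∀ u v → v ≡ 1ℤ * (u + v) + (- 1ℤ) * u
        arith = solve-∀ ℤ-ring
      neg : ∀ r r′ → r - r′ ≡ (- 1ℤ) * (r′ - r)
      neg = solve-∀ ℤ-ring
      roots : ∀ ss → All (Z ∘ f) ss → All (λ r′ → N (r - r′)) ss → All (Z ∘ q) ss
      roots [] [] [] = []
      roots (s ∷ ss) (h ∷ hs) (n ∷ ns) =
        cancel (q s) (λ k → n (lin₁ (- 1ℤ) k (neg r s)))
          (lin₂ 1ℤ (- 1ℤ) h z (quot (f r) ((s - r) * q s) (f s) (e s))) ∷ roots ss hs ns

-- Common second neighbours of three vertices of the algebraic graph.

module CommonNeighbours where

  open IntegersModulo
  open import Data.Nat as ℕ using (ℕ; zero; suc; s≤s; z≤n)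
  import Data.Nat.Properties as ℕₚ
  open import Data.Nat.Primality using (Prime)
  open import Data.Integer using (ℤ; +_; -_; _+_; _-_; 0ℤ; 1ℤ)
  import Data.Integer.Properties as ℤₚ
  open import Tactic.RingSolver using (solve-∀)
  open import Data.List using (List; []; _∷_; length; map; filter)
  import Data.List.Properties as Listₚ
  open import Data.List.Relation.Unary.All as All using (All; []; _∷_)
  import Data.List.Relation.Unary.All.Properties as Allₚ
  open import Data.List.Relation.Unary.AllPairs using (AllPairs; []; _∷_)
  import Data.List.Relation.Unary.AllPairs.Properties as AllPairsₚ
  open import Relation.Nullary.Decidable using (¬?)

  record Point : Set where
    constructor pt
    field a b c : ℤ
  open Point

  -- The coefficient of `b - t` after the middle vertex of a path from `(a , b , c)` to
  -- `(s , t , r)` is eliminated.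
  cubic : ℤ → ℤ → ℤ
  cubic a s = (a - s) * ((a + s) * (a + s))

  poly-cubic : ∀ a → Poly 3 (cubic a)
  poly-cubic a = poly-* 1 2 (poly-− 1 (poly-const 1 a) poly-x) (poly-* 1 1 p p)
    where p = poly-+ 1 (poly-const 1 a) poly-x

  module Elimination (x₁ x₂ x₃ : Point) where

    β₂ = b x₂ - b x₁
    β₃ = b x₃ - b x₁
    γ₂ = c x₂ - c x₁
    γ₃ = c x₃ - c x₁

    -- Let R be the last coordinate of a solution minus that of `x₁`. Eliminating t leaves Aᵢ R² +
    -- D₁ (2 γᵢ R + Kᵢ) = 0 for i = 2, 3. Two combinations of these give ρ + 2 δ R = 0 and δ R² = D₁
    -- ω, hence ρ² = 4 δ² R² = 4 δ D₁ ω, which is F = 0.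
    D₁ D₂ D₃ A₂ A₃ K₂ K₃ ρ δ ω F : ℤ → ℤ
    D₁ = cubic (a x₁)
    D₂ = cubic (a x₂)
    D₃ = cubic (a x₃)
    A₂ s = D₂ s - D₁ s
    A₃ s = D₃ s - D₁ s
    K₂ s = β₂ * D₂ s - γ₂ * γ₂
    K₃ s = β₃ * D₃ s - γ₃ * γ₃
    ρ s = A₂ s * K₃ s - A₃ s * K₂ s
    δ s = γ₃ * A₂ s - γ₂ * A₃ s
    ω s = γ₂ * K₃ s - γ₃ * K₂ s
    F s = ρ s * ρ s - δ s * (D₁ s * ((+ 4) * ω s))

    poly-F : Poly 12 F
    poly-F = poly-− 12 (poly-* 6 6 pρ pρ) (poly-weaken 3 9 (poly-* 3 6 pδ (poly-* 3 3 pD₁ (poly-k* 3 (+ 4) pω))))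
      where
      pD₁ = poly-cubic (a x₁)
      pA₂ = poly-− 3 (poly-cubic (a x₂)) pD₁
      pA₃ = poly-− 3 (poly-cubic (a x₃)) pD₁
      pK₂ = poly-− 3 (poly-k* 3 β₂ (poly-cubic (a x₂))) (poly-const 3 (γ₂ * γ₂))
      pK₃ = poly-− 3 (poly-k* 3 β₃ (poly-cubic (a x₃))) (poly-const 3 (γ₃ * γ₃))
      pρ = poly-− 6 (poly-* 3 3 pA₂ pK₃) (poly-* 3 3 pA₃ pK₂)
      pδ = poly-− 3 (poly-k* 3 γ₃ pA₂) (poly-k* 3 γ₂ pA₃)
      pω = poly-− 3 (poly-k* 3 γ₂ pK₃) (poly-k* 3 γ₃ pK₂)

  cubic-self : ∀ a → cubic a a ≡ 0ℤ
  cubic-self = identity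
    where
    identity : ∀ a → (a - a) * ((a + a) * (a + a)) ≡ 0ℤ
    identity = solve-∀ ℤ-ring

  cubic-neg : ∀ a → cubic a (- a) ≡ 0ℤ
  cubic-neg = identity
    where
    identity : ∀ a → (a - - a) * ((a + - a) * (a + - a)) ≡ 0ℤ
    identity = solve-∀ ℤ-ring

  -- `D-sum₂` keeps `a + s` and `a + a` nonzero modulo `p` and forbids opposite abscissae. `D-sum₄`
  -- enters only the count of solutions above one abscissa.
  module Geometry (p : ℕ) (isPrime : Prime p) (D : ℤ → Set)
    (D-inj : ∀ {x y} → D x → D y → Modulo.Z p isPrime (x - y) → x ≡ y)
    (D-sum₂ : ∀ {x y} → D x → D y → Modulo.N p isPrime (x + y))
    (D-sum₄ : ∀ {x y z w} → D x → D y → D z → D w → Modulo.N p isPrime (x + y + z + w)) where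

    open Modulo p isPrime

    D-apart : ∀ {x y} → D x → D y → x ≢ y → N (x - y)
    D-apart dx dy ne z = ne (D-inj dx dy z)

    record Apart (x y : Point) : Set where
      constructor mkApart
      field apart : ¬ (Z (a x - a y) × Z (b x - b y) × Z (c x - c y))
    open Apart

    -- The middle vertex of a path of length two from x to z has first coordinate u.
    record Link (x z : Point) (u : ℤ) : Set where
      constructor link
      field
        on-b : Z (b x - b z - (a x - a z) * (u * u))
        on-c : Z (c x - c z - (a x * a x - a z * a z) * u)
    open Link

    -- If the first coordinates agreed, both link equations would force the other two coordinates to
    -- agree.
    link-a : ∀ {x z u} → Link x z u → Apart x z → N (a x - a z)
    link-a {pt a b c} {pt s t r} {u} (link l₁ l₂) (mkApart ap) h = ap (h , lin₂ 1ℤ (u * u) l₁ h (id₁ b t a s u) , lin₂ 1ℤ ((a + s) * u) l₂ h (id₂ c r a s u))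
      where
      id₁ : ∀ b t a s u → b - t ≡ 1ℤ * (b - t - (a - s) * (u * u)) + (u * u) * (a - s)
      id₁ = solve-∀ ℤ-ring
      id₂ : ∀ c r a s u → c - r ≡ 1ℤ * (c - r - (a * a - s * s) * u) + ((a + s) * u) * (a - s)
      id₂ = solve-∀ ℤ-ring

    -- This eliminates u: multiplying (a - s) u² by (a - s)(a + s)² gives the square of (a² - s²) u.
    link-square : ∀ {x z u} → Link x z u → Z ((b x - b z) * cubic (a x) (a z) - (c x - c z) * (c x - c z))
    link-square {pt a b c} {pt s t r} {u} (link l₁ l₂) = lin₂ (cubic a s) (- (c - r + (a * a - s * s) * u)) l₁ l₂ (identity a b c s t r u)
      where
      identity : ∀ a b c s t r u → (b - t) * ((a - s) * ((a + s) * (a + s))) - (c - r) * (c - r)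
        ≡ ((a - s) * ((a + s) * (a + s))) * (b - t - (a - s) * (u * u)) + (- (c - r + (a * a - s * s) * u)) * (c - r - (a * a - s * s) * u)
      identity = solve-∀ ℤ-ring

    record Solution (x₁ x₂ x₃ z : Point) : Set where
      constructor solution
      field
        {u₁ u₂ u₃} : ℤ
        link₁ : Link x₁ z u₁
        link₂ : Link x₂ z u₂
        link₃ : Link x₃ z u₃
        u₁≉u₂ : N (u₁ - u₂)
        u₁≉u₃ : N (u₁ - u₃)
        u₂≉u₃ : N (u₂ - u₃)
        in-D  : D (a z)
        apart₁ : Apart x₁ z
        apart₂ : Apart x₂ z
        apart₃ : Apart x₃ z
    open Solution

    N-swap : ∀ x y → N (x - y) → N (y - x)
    N-swap x y n z = n (lin₁ (- 1ℤ) z (identity x y))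
      where
      identity : ∀ x y → x - y ≡ (- 1ℤ) * (y - x)
      identity = solve-∀ ℤ-ring

    swap₁₂ : ∀ {x₁ x₂ x₃ z} → Solution x₁ x₂ x₃ z → Solution x₂ x₁ x₃ z
    swap₁₂ (solution {u₁} {u₂} {u₃} l₁ l₂ l₃ n₁₂ n₁₃ n₂₃ d p₁ p₂ p₃) = solution l₂ l₁ l₃ (N-swap u₁ u₂ n₁₂) n₂₃ n₁₃ d p₂ p₁ p₃

    swap₂₃ : ∀ {x₁ x₂ x₃ z} → Solution x₁ x₂ x₃ z → Solution x₁ x₃ x₂ z
    swap₂₃ (solution {u₁} {u₂} {u₃} l₁ l₂ l₃ n₁₂ n₁₃ n₂₃ d p₁ p₂ p₃) = solution l₁ l₃ l₂ n₁₃ n₁₂ (N-swap u₂ u₃ n₂₃) d p₁ p₃ p₂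

    N-cubic : ∀ {x z u} → D (a x) → D (a z) → Link x z u → Apart x z → N (cubic (a x) (a z))
    N-cubic dx dz l ap = N-* (link-a l ap) (N-* (D-sum₂ dx dz) (D-sum₂ dx dz))

    -- Eliminating the second coordinate of z between two of the three squared links.
    eliminate : ∀ {x y z u v} → Link x z u → Link y z v →
      Z ((cubic (a y) (a z) - cubic (a x) (a z)) * ((c z - c x) * (c z - c x))
         + cubic (a x) (a z) * (((c y - c x) + (c y - c x)) * (c z - c x)
                                + ((b y - b x) * cubic (a y) (a z) - (c y - c x) * (c y - c x))))
    eliminate {pt a b c} {pt a′ b′ c′} {pt s t r} l l′ =
      lin₂ (- cubic a′ s) (cubic a s) (link-square l) (link-square l′) (identity b c b′ c′ t r (cubic a s) (cubic a′ s))
      where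
      identity : ∀ b c b′ c′ t r d d′ →
        (d′ - d) * ((r - c) * (r - c)) + d * (((c′ - c) + (c′ - c)) * (r - c) + ((b′ - b) * d′ - (c′ - c) * (c′ - c)))
        ≡ (- d′) * ((b - t) * d - (c - r) * (c - r)) + d * ((b′ - t) * d′ - (c′ - r) * (c′ - r))
      identity = solve-∀ ℤ-ring

    module Base (x₁ x₂ x₃ : Point) (d₁ : D (a x₁)) where
      open Elimination x₁ x₂ x₃

      F-root : ∀ {z} → Solution x₁ x₂ x₃ z → Z (F (a z))
      F-root {z} S = lin₂ (ρ s - (R + R) * δ s) ((+ 4) * δ s) h₁ h₂
                       (id₃ (ρ s) (δ s) (ω s) (D₁ s) R)
        where
        s = a z
        R = c z - c x₁
        nD₁ = N-cubic d₁ (in-D S) (link₁ S) (apart₁ S)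
        e₂ = eliminate (link₁ S) (link₂ S)
        e₃ = eliminate (link₁ S) (link₃ S)
        id₁ : ∀ A₂ A₃ γ₂ γ₃ K₂ K₃ D R →
          D * ((A₂ * K₃ - A₃ * K₂) + (R + R) * (γ₃ * A₂ - γ₂ * A₃)) ≡
          (- A₃) * (A₂ * (R * R) + D * ((γ₂ + γ₂) * R + K₂)) + A₂ * (A₃ * (R * R) + D * ((γ₃ + γ₃) * R + K₃))
        id₁ = solve-∀ ℤ-ring
        h₁ : Z (ρ s + (R + R) * δ s)
        h₁ = cancel _ nD₁ (lin₂ (- A₃ s) (A₂ s) e₂ e₃ (id₁ (A₂ s) (A₃ s) γ₂ γ₃ (K₂ s) (K₃ s) (D₁ s) R))
        id₂ : ∀ A₂ A₃ γ₂ γ₃ K₂ K₃ D R →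
          (γ₃ * A₂ - γ₂ * A₃) * (R * R) - D * (γ₂ * K₃ - γ₃ * K₂) ≡
          γ₃ * (A₂ * (R * R) + D * ((γ₂ + γ₂) * R + K₂)) + (- γ₂) * (A₃ * (R * R) + D * ((γ₃ + γ₃) * R + K₃))
        id₂ = solve-∀ ℤ-ring
        h₂ : Z (δ s * (R * R) - D₁ s * ω s)
        h₂ = lin₂ γ₃ (- γ₂) e₂ e₃ (id₂ (A₂ s) (A₃ s) γ₂ γ₃ (K₂ s) (K₃ s) (D₁ s) R)
        id₃ : ∀ ρ δ ω D R → ρ * ρ - δ * (D * ((+ 4) * ω)) ≡
          (ρ - (R + R) * δ) * (ρ + (R + R) * δ) + ((+ 4) * δ) * (δ * (R * R) - D * ω)
        id₃ = solve-∀ ℤ-ring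

      -- Where `D₁` vanishes, `F` reduces to the square of `ρ`, while `A₂` and `A₃` reduce to `D₂`
      -- and `D₃`. This happens at s = ± a₁.
      ρ-root : ∀ s → D₁ s ≡ 0ℤ → Z (F s) → Z (D₂ s * K₃ s - D₃ s * K₂ s)
      ρ-root s e zF = lin₂ 1ℤ (K₃ s - K₂ s) zρ (Z0 e) (id₂ (D₁ s) (D₂ s) (D₃ s) (K₂ s) (K₃ s))
        where
        id₁ : ∀ ρ D δ ω → ρ * ρ ≡ 1ℤ * (ρ * ρ - δ * (D * ω)) + (δ * ω) * D
        id₁ = solve-∀ ℤ-ring
        zρ : Z (ρ s)
        zρ = Z-sq _ (lin₂ 1ℤ (δ s * ((+ 4) * ω s)) zF (Z0 e) (id₁ (ρ s) (D₁ s) (δ s) ((+ 4) * ω s)))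
        id₂ : ∀ D₁ D₂ D₃ K₂ K₃ → D₂ * K₃ - D₃ * K₂ ≡
          1ℤ * ((D₂ - D₁) * K₃ - (D₃ - D₁) * K₂) + (K₃ - K₂) * D₁
        id₂ = solve-∀ ℤ-ring

    Abscissae-apart : List Point → Set
    Abscissae-apart = AllPairs (λ z z′ → N (a z - a z′))

    -- More than 12 abscissae, to exceed the degree bound of `F`.
    Many : Point → Point → Point → Set
    Many x₁ x₂ x₃ = Σ (List Point) λ zs → 12 ℕ.< length zs × All (Solution x₁ x₂ x₃) zs × Abscissae-apart zs

    vanish-at : ∀ {d f x₁ x₂ x₃} → Poly d f → d ℕ.≤ 12 → (∀ {z} → Solution x₁ x₂ x₃ z → Z (f (a z))) →
                Many x₁ x₂ x₃ → ∀ s → Z (f s)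
    vanish-at {d} pf d≤12 root (zs , len , sols , ap) =
      vanish d pf (map a zs) (subst (d ℕ.<_) (sym (Listₚ.length-map a zs)) (ℕₚ.≤-<-trans d≤12 len))
        (Allₚ.map⁺ (All.map root sols)) (AllPairsₚ.map⁺ ap)

    many₁₂ : ∀ {x₁ x₂ x₃} → Many x₁ x₂ x₃ → Many x₂ x₁ x₃
    many₁₂ (zs , len , sols , ap) = zs , len , All.map swap₁₂ sols , ap

    many₂₃ : ∀ {x₁ x₂ x₃} → Many x₁ x₂ x₃ → Many x₁ x₃ x₂
    many₂₃ (zs , len , sols , ap) = zs , len , All.map swap₂₃ sols , ap

    -- The value of `ρ` at a zero of `D₁`.
    resultant : (d₂ d₃ β₂ β₃ γ₂ γ₃ : ℤ) → ℤ
    resultant d₂ d₃ β₂ β₃ γ₂ γ₃ = d₂ * (β₃ * d₃ - γ₃ * γ₃) - d₃ * (β₂ * d₂ - γ₂ * γ₂)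

    resultant-expand : ∀ d₂ d₃ β₂ β₃ γ₂ γ₃ →
      resultant d₂ d₃ β₂ β₃ γ₂ γ₃ ≡ d₂ * d₃ * (β₃ - β₂) - d₂ * (γ₃ * γ₃) + d₃ * (γ₂ * γ₂)
    resultant-expand = identity
      where
      identity : ∀ d₂ d₃ β₂ β₃ γ₂ γ₃ → d₂ * (β₃ * d₃ - γ₃ * γ₃) - d₃ * (β₂ * d₂ - γ₂ * γ₂) ≡
        d₂ * d₃ * (β₃ - β₂) - d₂ * (γ₃ * γ₃) + d₃ * (γ₂ * γ₂)
      identity = solve-∀ ℤ-ring

    many-resultant : ∀ {x₁ x₂ x₃} → D (a x₁) → Many x₁ x₂ x₃ → ∀ s → cubic (a x₁) s ≡ 0ℤ →
      Z (resultant (cubic (a x₂) s) (cubic (a x₃) s) (b x₂ - b x₁) (b x₃ - b x₁) (c x₂ - c x₁) (c x₃ - c x₁))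
    many-resultant {x₁} {x₂} {x₃} d₁ M s e =
      Base.ρ-root x₁ x₂ x₃ d₁ s e
        (vanish-at (Elimination.poly-F x₁ x₂ x₃) ℕₚ.≤-refl (Base.F-root x₁ x₂ x₃ d₁) M s)

    cubic-flip : ∀ a s → cubic a (- s) ≡ (a + s) * ((a - s) * (a - s))
    cubic-flip = identity
      where
      identity : ∀ a s → (a - - s) * ((a + - s) * (a + - s)) ≡ (a + s) * ((a - s) * (a - s))
      identity = solve-∀ ℤ-ring

    sq-diff : Point → Point → ℤ
    sq-diff x y = (a x - a y) * (a x + a y)

    -- The values of F at s = ±a₁ eliminate b and leave an equation between squares.
    slopes-agree-up-to-sign : ∀ {x₁ x₂ x₃} → D (a x₁) → Many x₁ x₂ x₃ →
      Z (sq-diff x₂ x₁ * (c x₃ - c x₁) - sq-diff x₃ x₁ * (c x₂ - c x₁)) ⊎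
      Z (sq-diff x₂ x₁ * (c x₃ - c x₁) + sq-diff x₃ x₁ * (c x₂ - c x₁))
    slopes-agree-up-to-sign {x₁} {x₂} {x₃} d₁ M = Z-split _ _ (cancel _ (D-sum₂ d₁ d₁) product)
      where
      p₂ = a x₂ - a x₁
      p₃ = a x₃ - a x₁
      q₂ = a x₂ + a x₁
      q₃ = a x₃ + a x₁
      β₂ = b x₂ - b x₁
      β₃ = b x₃ - b x₁
      γ₂ = c x₂ - c x₁
      γ₃ = c x₃ - c x₁
      plus : Z (resultant (p₂ * (q₂ * q₂)) (p₃ * (q₃ * q₃)) β₂ β₃ γ₂ γ₃)
      plus = many-resultant d₁ M (a x₁) (cubic-self (a x₁))
      minus : Z (resultant (q₂ * (p₂ * p₂)) (q₃ * (p₃ * p₃)) β₂ β₃ γ₂ γ₃)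
      minus = subst Z (cong₂ (λ d d′ → resultant d d′ β₂ β₃ γ₂ γ₃) (cubic-flip (a x₂) (a x₁)) (cubic-flip (a x₃) (a x₁)))
                (many-resultant d₁ M (- a x₁) (cubic-neg (a x₁)))
      -- The multipliers give `B` the same coefficient (p₂ p₃ q₂ q₃)² in both relations, so it
      -- cancels. What remains carries the factor qᵢ - pᵢ = 2 a₁, which is nonzero by `D-sum₂`.
      combine : ∀ p₂ p₃ q₂ q₃ B G₂ G₃ →
        (q₃ - p₃) * ((p₂ * q₂) * (p₂ * q₂) * G₃) - (q₂ - p₂) * ((p₃ * q₃) * (p₃ * q₃) * G₂) ≡
        (p₂ * p₃) * ((p₂ * (q₂ * q₂)) * (p₃ * (q₃ * q₃)) * B - (p₂ * (q₂ * q₂)) * G₃ + (p₃ * (q₃ * q₃)) * G₂)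
        + (- (q₂ * q₃)) * ((q₂ * (p₂ * p₂)) * (q₃ * (p₃ * p₃)) * B - (q₂ * (p₂ * p₂)) * G₃ + (q₃ * (p₃ * p₃)) * G₂)
      combine = solve-∀ ℤ-ring
      factor : ∀ k m₂ m₃ γ₂ γ₃ → k * ((m₂ * γ₃ - m₃ * γ₂) * (m₂ * γ₃ + m₃ * γ₂)) ≡
        k * (m₂ * m₂ * (γ₃ * γ₃)) - k * (m₃ * m₃ * (γ₂ * γ₂))
      factor = solve-∀ ℤ-ring
      twice : ∀ x y → y + y ≡ (x + y) - (x - y)
      twice = solve-∀ ℤ-ring
      product : Z ((a x₁ + a x₁) * ((p₂ * q₂ * γ₃ - p₃ * q₃ * γ₂) * (p₂ * q₂ * γ₃ + p₃ * q₃ * γ₂)))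
      product = lin₂ (p₂ * p₃) (- (q₂ * q₃))
        (subst Z (resultant-expand (p₂ * (q₂ * q₂)) (p₃ * (q₃ * q₃)) β₂ β₃ γ₂ γ₃) plus)
        (subst Z (resultant-expand (q₂ * (p₂ * p₂)) (q₃ * (p₃ * p₃)) β₂ β₃ γ₂ γ₃) minus)
        (trans (factor (a x₁ + a x₁) (p₂ * q₂) (p₃ * q₃) γ₂ γ₃)
          (trans (cong₂ (λ k l → k * (p₂ * q₂ * (p₂ * q₂) * (γ₃ * γ₃)) - l * (p₃ * q₃ * (p₃ * q₃) * (γ₂ * γ₂)))
                   (twice (a x₃) (a x₁)) (twice (a x₂) (a x₁)))
            (combine p₂ p₃ q₂ q₃ (β₃ - β₂) (γ₂ * γ₂) (γ₃ * γ₃))))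

    N-sq-diff : ∀ {x y} → D (a x) → D (a y) → a x ≢ a y → N (sq-diff x y)
    N-sq-diff dx dy ne = N-* (D-apart dx dy ne) (D-sum₂ dx dy)

    Z-half : ∀ {x} → D x → ∀ y → Z (y + y) → Z y
    Z-half {x} dx y z = cancel y (D-sum₂ dx dx) (lin₁ x z (identity x y))
      where
      identity : ∀ x y → (x + x) * y ≡ x * (y + y)
      identity = solve-∀ ℤ-ring

    -- The sign is decided by comparing two base points. If the relations based at `x₁` and at `x₂`
    -- both had the wrong sign, their sum would give c₂ = c₁, and then the two signs at `x₁` mean
    -- the same. The result says that the points (aᵢ² , cᵢ) are collinear.
    collinear : ∀ {x₁ x₂ x₃} → D (a x₁) → D (a x₂) → a x₂ ≢ a x₁ → Many x₁ x₂ x₃ →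
      Z (sq-diff x₂ x₁ * (c x₃ - c x₁) - sq-diff x₃ x₁ * (c x₂ - c x₁))
    collinear {x₁} {x₂} {x₃} d₁ d₂ ne M =
      [ (λ h → h) , (λ m₁ → [ other-plus , both-minus m₁ ]′ (slopes-agree-up-to-sign d₂ (many₁₂ M))) ]′
        (slopes-agree-up-to-sign d₁ M)
      where
      goal = sq-diff x₂ x₁ * (c x₃ - c x₁) - sq-diff x₃ x₁ * (c x₂ - c x₁)
      identity : ∀ a₁ a₂ a₃ c₁ c₂ c₃ →
        ((a₂ - a₁) * (a₂ + a₁)) * (c₃ - c₁) - ((a₃ - a₁) * (a₃ + a₁)) * (c₂ - c₁) ≡
        (- 1ℤ) * (((a₁ - a₂) * (a₁ + a₂)) * (c₃ - c₂) - ((a₃ - a₂) * (a₃ + a₂)) * (c₁ - c₂))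
      identity = solve-∀ ℤ-ring
      other-plus : Z (sq-diff x₁ x₂ * (c x₃ - c x₂) - sq-diff x₃ x₂ * (c x₁ - c x₂)) → Z goal
      other-plus h = lin₁ (- 1ℤ) h (identity (a x₁) (a x₂) (a x₃) (c x₁) (c x₂) (c x₃))
      id₁ : ∀ a₁ a₂ a₃ c₁ c₂ c₃ →
        ((a₂ - a₁) * (a₂ + a₁)) * (c₂ - c₁) + ((a₂ - a₁) * (a₂ + a₁)) * (c₂ - c₁) ≡
        1ℤ * (((a₂ - a₁) * (a₂ + a₁)) * (c₃ - c₁) + ((a₃ - a₁) * (a₃ + a₁)) * (c₂ - c₁)) +
        1ℤ * (((a₁ - a₂) * (a₁ + a₂)) * (c₃ - c₂) + ((a₃ - a₂) * (a₃ + a₂)) * (c₁ - c₂))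
      id₁ = solve-∀ ℤ-ring
      id₂ : ∀ P Q X Y → P * Y - Q * X ≡ 1ℤ * (P * Y + Q * X) + (- (Q + Q)) * X
      id₂ = solve-∀ ℤ-ring
      both-minus : Z (sq-diff x₂ x₁ * (c x₃ - c x₁) + sq-diff x₃ x₁ * (c x₂ - c x₁)) →
        Z (sq-diff x₁ x₂ * (c x₃ - c x₂) + sq-diff x₃ x₂ * (c x₁ - c x₂)) → Z goal
      both-minus m₁ m₂ = lin₂ 1ℤ (- (sq-diff x₃ x₁ + sq-diff x₃ x₁)) m₁ zX (id₂ (sq-diff x₂ x₁) (sq-diff x₃ x₁) (c x₂ - c x₁) (c x₃ - c x₁))
        where
        zX : Z (c x₂ - c x₁)
        zX = cancel (c x₂ - c x₁) (N-sq-diff {x₂} {x₁} d₂ d₁ ne)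
               (Z-half d₁ (sq-diff x₂ x₁ * (c x₂ - c x₁)) (lin₂ 1ℤ 1ℤ m₁ m₂ (id₁ (a x₁) (a x₂) (a x₃) (c x₁) (c x₂) (c x₃))))

    -- X / P plays the role of the common slope, i.e. of the first coordinate of the centre of a star.
    star-b : ∀ {x₁ x₂ x₃} P X → D (a x₁) → D (a x₂) → D (a x₃) → a x₂ ≢ a x₁ → a x₃ ≢ a x₁ → Many x₁ x₂ x₃ →
      Z (P * (c x₂ - c x₁) - X * sq-diff x₂ x₁) → Z (P * (c x₃ - c x₁) - X * sq-diff x₃ x₁) →
      Z (P * P * (b x₃ - b x₂) - X * X * (a x₃ - a x₂))
    star-b {x₁} {x₂} {x₃} P X d₁ d₂ d₃ ne₂ ne₃ M h₂ h₃ =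
      cancel _ (N-* (N-* (D-apart d₂ d₁ ne₂) (N-* (D-sum₂ d₂ d₁) (D-sum₂ d₂ d₁)))
                    (N-* (D-apart d₃ d₁ ne₃) (N-* (D-sum₂ d₃ d₁) (D-sum₂ d₃ d₁))))
        (lin₃ (P * P) (d₂′ * (P * γ₃ + X * m₃)) (- (d₃′ * (P * γ₂ + X * m₂)))
           (subst Z (resultant-expand d₂′ d₃′ (b x₂ - b x₁) (b x₃ - b x₁) γ₂ γ₃) (many-resultant d₁ M (a x₁) (cubic-self (a x₁)))) h₃ h₂
           (trans (cong₂ (λ u v → d₂′ * d₃′ * (P * P * u - X * X * v))
                     (telescope (b x₁) (b x₂) (b x₃)) (telescope (a x₁) (a x₂) (a x₃)))
             (trans (distribute (P * P) (X * X) (d₂′ * d₃′) ((b x₃ - b x₁) - (b x₂ - b x₁)) (p₃ - p₂))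
               (trans (cong (λ v → d₂′ * d₃′ * (P * P * ((b x₃ - b x₁) - (b x₂ - b x₁))) - X * X * v) (monomials p₂ p₃ q₂ q₃))
                 (identity P X d₂′ d₃′ ((b x₃ - b x₁) - (b x₂ - b x₁)) γ₂ γ₃ m₂ m₃)))))
      where
      p₂ = a x₂ - a x₁
      p₃ = a x₃ - a x₁
      q₂ = a x₂ + a x₁
      q₃ = a x₃ + a x₁
      γ₂ = c x₂ - c x₁
      γ₃ = c x₃ - c x₁
      d₂′ = p₂ * (q₂ * q₂)
      d₃′ = p₃ * (q₃ * q₃)
      m₂ = p₂ * q₂
      m₃ = p₃ * q₃
      telescope : ∀ x y z → z - y ≡ (z - x) - (y - x)
      telescope = solve-∀ ℤ-ring
      distribute : ∀ P X d B p → d * (P * B - X * p) ≡ d * (P * B) - X * (d * p)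
      distribute = solve-∀ ℤ-ring
      monomials : ∀ p₂ p₃ q₂ q₃ → (p₂ * (q₂ * q₂)) * (p₃ * (q₃ * q₃)) * (p₃ - p₂) ≡
        (p₂ * (q₂ * q₂)) * ((p₃ * q₃) * (p₃ * q₃)) - (p₃ * (q₃ * q₃)) * ((p₂ * q₂) * (p₂ * q₂))
      monomials = solve-∀ ℤ-ring
      identity : ∀ P X d₂ d₃ B g₂ g₃ m₂ m₃ → d₂ * d₃ * (P * P * B) - X * X * (d₂ * (m₃ * m₃) - d₃ * (m₂ * m₂)) ≡
        P * P * (d₂ * d₃ * B - d₂ * (g₃ * g₃) + d₃ * (g₂ * g₂)) + d₂ * (P * g₃ + X * m₃) * (P * g₃ - X * m₃)
        + (- (d₃ * (P * g₂ + X * m₂))) * (P * g₂ - X * m₂)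
      identity = solve-∀ ℤ-ring

    -- Cleared of denominators, these are the link equations with the common value X / P for all
    -- pairs: the three points have a common neighbour with that first coordinate.
    record Star (x₁ x₂ x₃ : Point) : Set where
      field
        P X : ℤ
        P≉0 : N P
        c₂₁ : Z (P * (c x₂ - c x₁) - X * sq-diff x₂ x₁)
        c₃₁ : Z (P * (c x₃ - c x₁) - X * sq-diff x₃ x₁)
        b₂₁ : Z (P * P * (b x₂ - b x₁) - X * X * (a x₂ - a x₁))
        b₃₁ : Z (P * P * (b x₃ - b x₁) - X * X * (a x₃ - a x₁))

    many⇒star : ∀ {x₁ x₂ x₃} → D (a x₁) → D (a x₂) → D (a x₃) →
      a x₂ ≢ a x₁ → a x₃ ≢ a x₁ → a x₃ ≢ a x₂ → Many x₁ x₂ x₃ → Star x₁ x₂ x₃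
    many⇒star {x₁@(pt a₁ b₁ c₁)} {x₂@(pt a₂ b₂ c₂)} {x₃@(pt a₃ b₃ c₃)} d₁ d₂ d₃ n₂₁ n₃₁ n₃₂ M = record
      { P = P ; X = X ; P≉0 = N-sq-diff {x₂} {x₁} d₂ d₁ n₂₁
      ; c₂₁ = c₂₁ ; c₃₁ = c₃₁
      -- `star-b` compares the two points other than its base, so the base is `x₃` here and `x₂` in
      -- the next field.
      ; b₂₁ = star-b P X d₃ d₁ d₂ (n₃₁ ∘ sym) (n₃₂ ∘ sym) (many₁₂ (many₂₃ M))
                (lin₁ (- 1ℤ) c₃₁ (flip P X a₁ a₃ c₁ c₃)) (lin₂ 1ℤ (- 1ℤ) c₂₁ c₃₁ (chain P X a₁ a₂ a₃ c₁ c₂ c₃))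
      ; b₃₁ = star-b P X d₂ d₁ d₃ (n₂₁ ∘ sym) n₃₂ (many₁₂ M)
                (lin₁ (- 1ℤ) c₂₁ (flip P X a₁ a₂ c₁ c₂)) (lin₂ 1ℤ (- 1ℤ) c₃₁ c₂₁ (chain P X a₁ a₃ a₂ c₁ c₃ c₂))
      }
      where
      P = sq-diff x₂ x₁
      X = c₂ - c₁
      trivial : ∀ P X → P * X - X * P ≡ 0ℤ
      trivial = solve-∀ ℤ-ring
      comm : ∀ P X Q Y → P * Y - X * Q ≡ 1ℤ * (P * Y - Q * X)
      comm = solve-∀ ℤ-ring
      flip : ∀ P X a a′ c c′ → P * (c - c′) - X * ((a - a′) * (a + a′)) ≡ (- 1ℤ) * (P * (c′ - c) - X * ((a′ - a) * (a′ + a)))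
      flip = solve-∀ ℤ-ring
      chain : ∀ P X a₁ a₂ a₃ c₁ c₂ c₃ → P * (c₂ - c₃) - X * ((a₂ - a₃) * (a₂ + a₃)) ≡
        1ℤ * (P * (c₂ - c₁) - X * ((a₂ - a₁) * (a₂ + a₁))) + (- 1ℤ) * (P * (c₃ - c₁) - X * ((a₃ - a₁) * (a₃ + a₁)))
      chain = solve-∀ ℤ-ring
      c₂₁ = Z0 (trivial P X)
      c₃₁ = lin₁ 1ℤ (collinear d₁ d₂ n₂₁ M) (comm P X (sq-diff x₃ x₁) (c₃ - c₁))

    -- With e and g independent of i, the star relations turn each link into
    -- (aᵢ² - s²)(P uᵢ - X) = g and (aᵢ - s)(P uᵢ - X)(P uᵢ + X) = e.
    module StarSolution {x₁ x₂ x₃ z : Point} (T : Star x₁ x₂ x₃) (S : Solution x₁ x₂ x₃ z) where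
      open Star T
      e = P * P * (b x₁ - b z) - X * X * (a x₁ - a z)
      g = P * (c x₁ - c z) - X * sq-diff x₁ z

      g-link : ∀ {x u} → Link x z u → Z (P * (c x - c x₁) - X * sq-diff x x₁) →
        Z (sq-diff x z * (P * u - X) - g)
      g-link {pt aᵢ bᵢ cᵢ} {u} l h = lin₂ (- P) 1ℤ (on-c l) h (identity P X aᵢ (a x₁) (a z) cᵢ (c x₁) (c z) u)
        where
        identity : ∀ P X a a₁ s c c₁ r u →
          ((a - s) * (a + s)) * (P * u - X) - (P * (c₁ - r) - X * ((a₁ - s) * (a₁ + s))) ≡
          (- P) * (c - r - (a * a - s * s) * u) + 1ℤ * (P * (c - c₁) - X * ((a - a₁) * (a + a₁)))
        identity = solve-∀ ℤ-ring

      e-link : ∀ {x u} → Link x z u → Z (P * P * (b x - b x₁) - X * X * (a x - a x₁)) →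
        Z ((a x - a z) * ((P * u - X) * (P * u + X)) - e)
      e-link {pt aᵢ bᵢ cᵢ} {u} l h = lin₂ (- (P * P)) 1ℤ (on-b l) h (identity P X aᵢ (a x₁) (a z) bᵢ (b x₁) (b z) u)
        where
        identity : ∀ P X a a₁ s b b₁ t u →
          (a - s) * ((P * u - X) * (P * u + X)) - (P * P * (b₁ - t) - X * X * (a₁ - s)) ≡
          (- (P * P)) * (b - t - (a - s) * (u * u)) + 1ℤ * (P * P * (b - b₁) - X * X * (a - a₁))
        identity = solve-∀ ℤ-ring

      -- With w = P u - X, m = a - s and k = a + s the links read m k w = g and m w (w + 2 X) = e.
      -- Multiplying the second by m k² and inserting the first eliminates w. Hence a₁, a₂, a₃ are
      -- roots of one cubic polynomial with coefficients depending on `z`.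
      cubic-relation : ∀ {x u} → Link x z u →
        Z (P * (c x - c x₁) - X * sq-diff x x₁) → Z (P * P * (b x - b x₁) - X * X * (a x - a x₁)) →
        Z (e * cubic (a x) (a z) - (X + X) * g * sq-diff x z - g * g)
      cubic-relation {x} {u} l hc hb =
        lin₂ (- ((a x - a z) * ((a x + a z) * (a x + a z)))) (sq-diff x z * (P * u - X) + g + (X + X) * sq-diff x z)
          (e-link l hb) (g-link l hc) (identity P X e g (a x - a z) (a x + a z) u)
        where
        identity : ∀ P X e g m k u →
          e * (m * (k * k)) - (X + X) * g * (m * k) - g * g ≡
          (- (m * (k * k))) * (m * ((P * u - X) * (P * u + X)) - e)
          + ((m * k) * (P * u - X) + g + (X + X) * (m * k)) * ((m * k) * (P * u - X) - g)
        identity = solve-∀ ℤ-ring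

      c₁₁ : Z (P * (c x₁ - c x₁) - X * sq-diff x₁ x₁)
      c₁₁ = Z0 (identity P X (a x₁) (c x₁))
        where
        identity : ∀ P X a c → P * (c - c) - X * ((a - a) * (a + a)) ≡ 0ℤ
        identity = solve-∀ ℤ-ring

      b₁₁ : Z (P * P * (b x₁ - b x₁) - X * X * (a x₁ - a x₁))
      b₁₁ = Z0 (identity P X (a x₁) (b x₁))
        where
        identity : ∀ P X a b → P * P * (b - b) - X * X * (a - a) ≡ 0ℤ
        identity = solve-∀ ℤ-ring

      R₁ = cubic-relation (link₁ S) c₁₁ b₁₁
      R₂ = cubic-relation (link₂ S) c₂₁ b₂₁
      R₃ = cubic-relation (link₃ S) c₃₁ b₃₁

      -- The divided difference of `cubic` in its first argument.
      chord : ℤ → ℤ → ℤ → ℤ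
      chord x y s = x * x + x * y + y * y + s * (x + y) - s * s

      divide : ∀ {x y s} k → N (x - y) → Z (e * cubic x s - k * ((x - s) * (x + s)) - g * g) →
        Z (e * cubic y s - k * ((y - s) * (y + s)) - g * g) → Z (e * chord x y s - k * (x + y))
      divide {x} {y} {s} k n h h′ = cancel _ n (lin₂ 1ℤ (- 1ℤ) h h′ (identity e k g x y s))
        where
        identity : ∀ e k g x y s → (x - y) * (e * (x * x + x * y + y * y + s * (x + y) - s * s) - k * (x + y)) ≡
          1ℤ * (e * ((x - s) * ((x + s) * (x + s))) - k * ((x - s) * (x + s)) - g * g)
          + (- 1ℤ) * (e * ((y - s) * ((y + s) * (y + s))) - k * ((y - s) * (y + s)) - g * g)
        identity = solve-∀ ℤ-ring

      -- Dividing differences of the cubic relation twice gives e (a₁ + a₂ + a₃ + s) = k, and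
      -- substituting back gives `e` times the goal. If `e` vanished, so would `k` and `g`; then P
      -- uᵢ = X, contrary to u₁ ≠ u₂.
      abscissa : D (a x₁) → D (a x₂) → D (a x₃) → a x₂ ≢ a x₁ → a x₃ ≢ a x₁ → a x₃ ≢ a x₂ →
        Z (a z * a z + (a x₁ * a x₂ + a x₁ * a x₃ + a x₂ * a x₃))
      abscissa d₁ d₂ d₃ n₂₁ n₃₁ n₃₂ = [ (λ ze → ⊥-elim (centre ze)) , (λ h → h) ]′ (Z-split e quad e*quad)
        where
        quad = a z * a z + (a x₁ * a x₂ + a x₁ * a x₃ + a x₂ * a x₃)
        k = (X + X) * g
        h₁₂ = divide {a x₂} {a x₁} {a z} k (D-apart d₂ d₁ n₂₁) R₂ R₁
        h₁₃ = divide {a x₃} {a x₁} {a z} k (D-apart d₃ d₁ n₃₁) R₃ R₁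
        id₁ : ∀ e k x y w s → (w - y) * (e * (x + y + w + s) - k) ≡
          1ℤ * (e * (w * w + w * x + x * x + s * (w + x) - s * s) - k * (w + x))
          + (- 1ℤ) * (e * (y * y + y * x + x * x + s * (y + x) - s * s) - k * (y + x))
        id₁ = solve-∀ ℤ-ring
        hσ : Z (e * (a x₁ + a x₂ + a x₃ + a z) - k)
        hσ = cancel (e * (a x₁ + a x₂ + a x₃ + a z) - k) (D-apart d₃ d₂ n₃₂)
               (lin₂ 1ℤ (- 1ℤ) h₁₃ h₁₂ (id₁ e k (a x₁) (a x₂) (a x₃) (a z)))
        id₂ : ∀ e k x y w s → e * (s * s + (x * y + x * w + y * w)) ≡
          (- 1ℤ) * (e * (y * y + y * x + x * x + s * (y + x) - s * s) - k * (y + x))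
          + (x + y) * (e * (x + y + w + s) - k)
        id₂ = solve-∀ ℤ-ring
        e*quad : Z (e * quad)
        e*quad = lin₂ (- 1ℤ) (a x₁ + a x₂) h₁₂ hσ (id₂ e k (a x₁) (a x₂) (a x₃) (a z))
        id₃ : ∀ P X u v → P * (u - v) ≡ 1ℤ * (P * u - X) + (- 1ℤ) * (P * v - X)
        id₃ = solve-∀ ℤ-ring
        id₅ : ∀ e k x y w → (x + y) * k ≡ (- 1ℤ) * (e * w - k * (x + y)) + w * e
        id₅ = solve-∀ ℤ-ring
        id₆ : ∀ e k d m g → g * g ≡ (- 1ℤ) * (e * d - k * m - g * g) + d * e + (- m) * k
        id₆ = solve-∀ ℤ-ring
        id₇ : ∀ v g → v ≡ 1ℤ * (v - g) + 1ℤ * g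
        id₇ = solve-∀ ℤ-ring
        centre : ¬ Z e
        centre ze = u₁≉u₂ S (cancel (u₁ S - u₂ S) P≉0
            (lin₂ 1ℤ (- 1ℤ) (U (link₁ S) (apart₁ S) d₁ c₁₁) (U (link₂ S) (apart₂ S) d₂ c₂₁) (id₃ P X (u₁ S) (u₂ S))))
          where
          w = chord (a x₂) (a x₁) (a z)
          zk : Z k
          zk = cancel k (D-sum₂ d₂ d₁) (lin₂ (- 1ℤ) w h₁₂ ze (id₅ e k (a x₂) (a x₁) w))
          zg : Z g
          zg = Z-sq g (lin₃ (- 1ℤ) (cubic (a x₁) (a z)) (- sq-diff x₁ z) R₁ ze zk (id₆ e k (cubic (a x₁) (a z)) (sq-diff x₁ z) g))
          U : ∀ {x u} → Link x z u → Apart x z → D (a x) → Z (P * (c x - c x₁) - X * sq-diff x x₁) → Z (P * u - X)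
          U {x} {u} l ap dx h = cancel (P * u - X) (N-* (link-a l ap) (D-sum₂ dx (in-D S)))
            (lin₂ 1ℤ 1ℤ (g-link l h) zg (id₇ (sq-diff x z * (P * u - X)) g))

    -- All abscissae have the same square, and `D-sum₂` excludes opposite ones. So two solutions
    -- with different abscissae already contradict each other.
    no-many-distinct : ∀ {x₁ x₂ x₃} → D (a x₁) → D (a x₂) → D (a x₃) →
      a x₂ ≢ a x₁ → a x₃ ≢ a x₁ → a x₃ ≢ a x₂ → ¬ Many x₁ x₂ x₃
    no-many-distinct d₁ d₂ d₃ n₂₁ n₃₁ n₃₂ ([] , () , _)
    no-many-distinct d₁ d₂ d₃ n₂₁ n₃₁ n₃₂ (_ ∷ [] , s≤s () , _)
    no-many-distinct {x₁} {x₂} {x₃} d₁ d₂ d₃ n₂₁ n₃₁ n₃₂ M@(z ∷ z′ ∷ zs , _ , (S ∷ S′ ∷ _) , ((n ∷ _) ∷ _)) =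
      D-sum₂ (in-D S) (in-D S′) (cancel (a z + a z′) n (lin₂ 1ℤ (- 1ℤ) (root S) (root S′) (identity (a z) (a z′) _)))
      where
      T = many⇒star d₁ d₂ d₃ n₂₁ n₃₁ n₃₂ M
      root : ∀ {z} → Solution x₁ x₂ x₃ z → Z (a z * a z + (a x₁ * a x₂ + a x₁ * a x₃ + a x₂ * a x₃))
      root S = StarSolution.abscissa T S d₁ d₂ d₃ n₂₁ n₃₁ n₃₂
      identity : ∀ s s′ e → (s - s′) * (s + s′) ≡ 1ℤ * (s * s + e) + (- 1ℤ) * (s′ * s′ + e)
      identity = solve-∀ ℤ-ring

    -- For equal first coordinates both squared links have the same coefficient `cubic`, so equal
    -- last coordinates would force equal b.
    N-c-of-equal-a : ∀ {x y z u v} → D (a x) → D (a z) → a x ≡ a y → Apart x y → Apart x z →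
      Link x z u → Link y z v → N (c y - c x)
    N-c-of-equal-a {x@(pt aₓ bₓ cₓ)} {pt _ b′ c′} {pt s t r} dx dz refl (mkApart xy) xz l l′ h =
      xy (Z0 (ℤₚ.+-inverseʳ aₓ) ,
          cancel _ (N-cubic dx dz l xz) (lin₃ 1ℤ (- 1ℤ) (- (cₓ + c′ - (r + r))) (link-square l) (link-square l′) h (id₁ (cubic aₓ s) bₓ b′ cₓ c′ t r)) ,
          lin₁ (- 1ℤ) h (id₂ cₓ c′))
      where
      id₁ : ∀ d b b′ c c′ t r → d * (b - b′) ≡
        1ℤ * ((b - t) * d - (c - r) * (c - r)) + (- 1ℤ) * ((b′ - t) * d - (c′ - r) * (c′ - r)) + (- (c + c′ - (r + r))) * (c′ - c)
      id₁ = solve-∀ ℤ-ring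
      id₂ : ∀ c c′ → c - c′ ≡ (- 1ℤ) * (c′ - c)
      id₂ = solve-∀ ℤ-ring

    -- At s = a₁ = a₂ the resultant reduces to d₃ γ₂². The factor d₃ is nonzero because a₃ differs,
    -- and γ₂ because a single solution `S` exists.
    no-many-pair : ∀ {x₁ x₂ x₃} → D (a x₁) → D (a x₂) → D (a x₃) → Apart x₁ x₂ →
      a x₁ ≡ a x₂ → a x₃ ≢ a x₁ → ¬ Many x₁ x₂ x₃
    no-many-pair d₁ d₂ d₃ ap e n₃₁ ([] , () , _)
    no-many-pair {x₁} {x₂} {x₃} d₁ d₂ d₃ ap refl n₃₁ M@(z ∷ _ , _ , S ∷ _ , _) =
      N-* nd (N-* nγ nγ) (lin₂ 1ℤ (b₂₁ * cubic (a x₃) (a x₁) - (b₃₁ * cubic (a x₃) (a x₁) - c₃₁ * c₃₁))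
        (many-resultant d₁ M (a x₁) (cubic-self (a x₁))) (Z0 (cubic-self (a x₁)))
        (identity (cubic (a x₁) (a x₁)) (cubic (a x₃) (a x₁)) b₂₁ b₃₁ (c x₂ - c x₁) c₃₁))
      where
      b₂₁ = b x₂ - b x₁
      b₃₁ = b x₃ - b x₁
      c₃₁ = c x₃ - c x₁
      nγ = N-c-of-equal-a d₁ (in-D S) refl ap (apart₁ S) (link₁ S) (link₂ S)
      nd : N (cubic (a x₃) (a x₁))
      nd = N-* (D-apart d₃ d₁ n₃₁) (N-* (D-sum₂ d₃ d₁) (D-sum₂ d₃ d₁))
      identity : ∀ d₂ d₃ β₂ β₃ γ₂ γ₃ → d₃ * (γ₂ * γ₂) ≡
        1ℤ * (d₂ * (β₃ * d₃ - γ₃ * γ₃) - d₃ * (β₂ * d₂ - γ₂ * γ₂)) + (β₂ * d₃ - (β₃ * d₃ - γ₃ * γ₃)) * d₂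
      identity = solve-∀ ℤ-ring

    -- With equal first coordinates the elimination is linear in the last coordinate of z.
    eliminate-equal : ∀ {x y z u v} → D (a x) → D (a z) → a x ≡ a y → Apart x z → Link x z u → Link y z v →
      Z (((c y - c x) + (c y - c x)) * (c z - c x) + ((b y - b x) * cubic (a x) (a z) - (c y - c x) * (c y - c x)))
    eliminate-equal {x@(pt aₓ bₓ cₓ)} {pt _ b′ c′} {pt s t r} dx dz refl xz l l′ =
      cancel _ (N-cubic dx dz l xz) (lin₁ 1ℤ (eliminate l l′) (identity (cubic aₓ s) (r - cₓ) _))
      where
      identity : ∀ d R k → d * k ≡ 1ℤ * ((d - d) * (R * R) + d * k)
      identity = solve-∀ ℤ-ring

    -- Two equations linear in `c z` remain; eliminating it gives the cubic `f`. At s = a₁ this is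
    -- γ₂ γ₃ (γ₃ - γ₂), a product of nonzero differences.
    no-many-equal : ∀ {x₁ x₂ x₃} → D (a x₁) → Apart x₁ x₂ → Apart x₁ x₃ → Apart x₂ x₃ →
      a x₁ ≡ a x₂ → a x₁ ≡ a x₃ → ¬ Many x₁ x₂ x₃
    no-many-equal d₁ ap₁₂ ap₁₃ ap₂₃ e₂ e₃ ([] , () , _)
    no-many-equal {x₁} {x₂} {x₃} d₁ ap₁₂ ap₁₃ ap₂₃ refl refl M@(z ∷ _ , _ , S ∷ _ , _) =
      N-* n₂ (N-* n₃ n₃₂) (lin₂ 1ℤ (- κ) (vanish-at poly-f (ℕₚ.m≤m+n 3 9) root M (a x₁)) (Z0 (cubic-self (a x₁)))
        (id₂ κ (cubic (a x₁) (a x₁)) γ₂ γ₃ (c x₃ - c x₂) (telescope (c x₁) (c x₂) (c x₃))))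
      where
      β₂ = b x₂ - b x₁
      β₃ = b x₃ - b x₁
      γ₂ = c x₂ - c x₁
      γ₃ = c x₃ - c x₁
      κ = γ₃ * β₂ - γ₂ * β₃
      n₂ = N-c-of-equal-a d₁ (in-D S) refl ap₁₂ (apart₁ S) (link₁ S) (link₂ S)
      n₃ = N-c-of-equal-a d₁ (in-D S) refl ap₁₃ (apart₁ S) (link₁ S) (link₃ S)
      n₃₂ = N-c-of-equal-a d₁ (in-D S) refl ap₂₃ (apart₂ S) (link₂ S) (link₃ S)
      f : ℤ → ℤ
      f s = κ * cubic (a x₁) s + γ₂ * (γ₃ * (γ₃ - γ₂))
      poly-f : Poly 3 f
      poly-f = poly-+ 3 (poly-k* 3 κ (poly-cubic (a x₁))) (poly-const 3 _)
      id₁ : ∀ R d β₂ β₃ γ₂ γ₃ → (γ₃ * β₂ - γ₂ * β₃) * d + γ₂ * (γ₃ * (γ₃ - γ₂)) ≡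
        γ₃ * ((γ₂ + γ₂) * R + (β₂ * d - γ₂ * γ₂)) + (- γ₂) * ((γ₃ + γ₃) * R + (β₃ * d - γ₃ * γ₃))
      id₁ = solve-∀ ℤ-ring
      root : ∀ {z} → Solution x₁ x₂ x₃ z → Z (f (a z))
      root {z} S = lin₂ γ₃ (- γ₂) (eliminate-equal d₁ (in-D S) refl (apart₁ S) (link₁ S) (link₂ S))
        (eliminate-equal d₁ (in-D S) refl (apart₁ S) (link₁ S) (link₃ S)) (id₁ (c z - c x₁) (cubic (a x₁) (a z)) β₂ β₃ γ₂ γ₃)
      id₂ : ∀ κ d γ₂ γ₃ δ → δ ≡ γ₃ - γ₂ → γ₂ * (γ₃ * δ) ≡ 1ℤ * (κ * d + γ₂ * (γ₃ * (γ₃ - γ₂))) + (- κ) * d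
      id₂ κ d γ₂ γ₃ _ refl = arith κ d γ₂ γ₃
        where
        arith : ∀ κ d γ₂ γ₃ → γ₂ * (γ₃ * (γ₃ - γ₂)) ≡ 1ℤ * (κ * d + γ₂ * (γ₃ * (γ₃ - γ₂))) + (- κ) * d
        arith = solve-∀ ℤ-ring
      telescope : ∀ x y z → z - y ≡ (z - x) - (y - x)
      telescope = solve-∀ ℤ-ring

    AtMostTwo : Point → Point → Point → Set
    AtMostTwo x₁ x₂ x₃ = ∀ {z z′ z″} → Solution x₁ x₂ x₃ z → Solution x₁ x₂ x₃ z′ → Solution x₁ x₂ x₃ z″ →
      a z ≡ a z′ → a z ≡ a z″ → Apart z z′ → Apart z z″ → Apart z′ z″ → ⊥

    N-c-of-solutions : ∀ {x z z′ u v} → D (a x) → D (a z) → Apart x z → Link x z u → Link x z′ v →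
      a z ≡ a z′ → Apart z z′ → N (c z - c z′)
    N-c-of-solutions {pt aₓ bₓ cₓ} {pt s t r} {pt _ t′ r′} dx dz xz l l′ refl (mkApart ap) h =
      ap (Z0 (ℤₚ.+-inverseʳ s) ,
          cancel _ (N-cubic dx dz l xz) (lin₃ (- 1ℤ) 1ℤ (cₓ + cₓ - (r + r′)) (link-square l) (link-square l′) h
            (identity (cubic aₓ s) bₓ cₓ t t′ r r′)) , h)
      where
      identity : ∀ d b c t t′ r r′ → d * (t - t′) ≡
        (- 1ℤ) * ((b - t) * d - (c - r) * (c - r)) + 1ℤ * ((b - t′) * d - (c - r′) * (c - r′)) + (c + c - (r + r′)) * (r - r′)
      identity = solve-∀ ℤ-ring

    -- The second divided difference of a quadratic polynomial is its leading coefficient.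
    quadratic : ∀ A d B k r r′ r″ → N (r - r′) → N (r - r″) → N (r′ - r″) →
      Z (A * (r * r) + d * (B * r + k)) → Z (A * (r′ * r′) + d * (B * r′ + k)) → Z (A * (r″ * r″) + d * (B * r″ + k)) → Z A
    quadratic A d B k r r′ r″ n n′ n″ h h′ h″ =
      cancel _ n″ (lin₂ 1ℤ (- 1ℤ) (step n h h′) (step n′ h h″) (id₂ A (d * B) r r′ r″))
      where
      id₁ : ∀ A d B k r r′ → (r - r′) * (A * (r + r′) + d * B) ≡
        1ℤ * (A * (r * r) + d * (B * r + k)) + (- 1ℤ) * (A * (r′ * r′) + d * (B * r′ + k))
      id₁ = solve-∀ ℤ-ring
      step : ∀ {r r′} → N (r - r′) → Z (A * (r * r) + d * (B * r + k)) → Z (A * (r′ * r′) + d * (B * r′ + k)) →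
        Z (A * (r + r′) + d * B)
      step {r} {r′} n h h′ = cancel _ n (lin₂ 1ℤ (- 1ℤ) h h′ (id₁ A d B k r r′))
      id₂ : ∀ A B r r′ r″ → (r′ - r″) * A ≡ 1ℤ * (A * (r + r′) + B) + (- 1ℤ) * (A * (r + r″) + B)
      id₂ = solve-∀ ℤ-ring

    -- Three solutions above s would give the quadratics from `eliminate` three roots, so cubic aᵢ s
    -- would not depend on i. Its second divided difference in a is a₁ + a₂ + a₃ + s, which `D-sum₄`
    -- keeps from vanishing.
    at-most-two-distinct : ∀ {x₁ x₂ x₃} → D (a x₁) → D (a x₂) → D (a x₃) →
      a x₂ ≢ a x₁ → a x₃ ≢ a x₁ → a x₃ ≢ a x₂ → AtMostTwo x₁ x₂ x₃
    at-most-two-distinct {x₁} {x₂} {x₃} d₁ d₂ d₃ n₂₁ n₃₁ n₃₂ {z@(pt s t r)} {z′@(pt _ t′ r′)} {z″@(pt _ t″ r″)} S S′ S″ refl refl p p′ p″ =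
      D-sum₄ d₁ d₂ d₃ (in-D S) (cancel _ (D-apart d₃ d₂ n₃₂)
        (lin₂ 1ℤ (- 1ℤ) (chord n₃₁ d₃ (leading link₃)) (chord n₂₁ d₂ (leading link₂)) (id₂ (a x₁) (a x₂) (a x₃) s)))
      where
      N-shift : ∀ r r′ c → N (r - r′) → N ((r - c) - (r′ - c))
      N-shift r r′ c n h = n (lin₁ 1ℤ h (arith r r′ c))
        where
        arith : ∀ r r′ c → r - r′ ≡ 1ℤ * ((r - c) - (r′ - c))
        arith = solve-∀ ℤ-ring
      apart-c : ∀ {z z′} (S : Solution x₁ x₂ x₃ z) (S′ : Solution x₁ x₂ x₃ z′) → a z ≡ a z′ → Apart z z′ → N ((c z - c x₁) - (c z′ - c x₁))
      apart-c {z} {z′} S S′ e ap = N-shift (c z) (c z′) (c x₁) (N-c-of-solutions d₁ (in-D S) (apart₁ S) (link₁ S) (link₁ S′) e ap)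
      leading : ∀ {y} {u : ∀ {z} → Solution x₁ x₂ x₃ z → ℤ} → (∀ {z} (S : Solution x₁ x₂ x₃ z) → Link y z (u S)) →
        Z (cubic (a y) s - cubic (a x₁) s)
      leading {y} l = quadratic (cubic (a y) s - cubic (a x₁) s) (cubic (a x₁) s) ((c y - c x₁) + (c y - c x₁))
        ((b y - b x₁) * cubic (a y) s - (c y - c x₁) * (c y - c x₁)) (r - c x₁) (r′ - c x₁) (r″ - c x₁) (apart-c S S′ refl p) (apart-c S S″ refl p′) (apart-c S′ S″ refl p″)
        (eliminate (link₁ S) (l S)) (eliminate (link₁ S′) (l S′)) (eliminate (link₁ S″) (l S″))
      id₁ : ∀ x y s → (y - x) * (y * y + y * x + x * x + s * (y + x) - s * s) ≡
        1ℤ * ((y - s) * ((y + s) * (y + s)) - (x - s) * ((x + s) * (x + s)))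
      id₁ = solve-∀ ℤ-ring
      chord : ∀ {y} → y ≢ a x₁ → D y → Z (cubic y s - cubic (a x₁) s) →
        Z (y * y + y * a x₁ + a x₁ * a x₁ + s * (y + a x₁) - s * s)
      chord {y} n dy h = cancel _ (D-apart dy d₁ n) (lin₁ 1ℤ h (id₁ (a x₁) y s))
      id₂ : ∀ x y w s → (w - y) * (x + y + w + s) ≡
        1ℤ * (w * w + w * x + x * x + s * (w + x) - s * s) + (- 1ℤ) * (y * y + y * x + x * x + s * (y + x) - s * s)
      id₂ = solve-∀ ℤ-ring

    -- `eliminate-equal` is linear in `c z` with nonzero leading coefficient 2 γ, so two solutions
    -- are already impossible.
    at-most-two-pair : ∀ {x₁ x₂ x₃} → D (a x₁) → Apart x₁ x₂ → a x₁ ≡ a x₂ → AtMostTwo x₁ x₂ x₃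
    at-most-two-pair {x₁} {x₂} d₁ ap refl {z@(pt s t r)} {z′@(pt _ t′ r′)} S S′ _ refl _ p _ _ =
      N-c-of-solutions d₁ (in-D S) (apart₁ S) (link₁ S) (link₁ S′) refl p
        (cancel _ (N-c-of-equal-a d₁ (in-D S) refl ap (apart₁ S) (link₁ S) (link₂ S))
          (Z-half d₁ _ (lin₂ 1ℤ (- 1ℤ) (eliminate-equal d₁ (in-D S) refl (apart₁ S) (link₁ S) (link₂ S))
            (eliminate-equal d₁ (in-D S′) refl (apart₁ S′) (link₁ S′) (link₂ S′)) (identity (c x₂ - c x₁) r r′ (c x₁) _))))
      where
      identity : ∀ γ r r′ c k → γ * (r - r′) + γ * (r - r′) ≡ 1ℤ * ((γ + γ) * (r - c) + k) + (- 1ℤ) * ((γ + γ) * (r′ - c) + k)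
      identity = solve-∀ ℤ-ring

    Bounded : Point → Point → Point → Set
    Bounded x₁ x₂ x₃ = ¬ Many x₁ x₂ x₃ × AtMostTwo x₁ x₂ x₃

    bounded₁₂ : ∀ {x₁ x₂ x₃} → Bounded x₂ x₁ x₃ → Bounded x₁ x₂ x₃
    bounded₁₂ (n , t) = (λ M → n (many₁₂ M)) , λ S S′ S″ → t (swap₁₂ S) (swap₁₂ S′) (swap₁₂ S″)

    bounded₂₃ : ∀ {x₁ x₂ x₃} → Bounded x₁ x₃ x₂ → Bounded x₁ x₂ x₃
    bounded₂₃ (n , t) = (λ M → n (many₂₃ M)) , λ S S′ S″ → t (swap₂₃ S) (swap₂₃ S′) (swap₂₃ S″)

    bounded : ∀ {x₁ x₂ x₃} → D (a x₁) → D (a x₂) → D (a x₃) → Apart x₁ x₂ → Apart x₁ x₃ → Apart x₂ x₃ → Bounded x₁ x₂ x₃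
    bounded {x₁} {x₂} {x₃} d₁ d₂ d₃ p₁₂ p₁₃ p₂₃ with a x₁ ℤₚ.≟ a x₂ | a x₁ ℤₚ.≟ a x₃ | a x₂ ℤₚ.≟ a x₃
    ... | yes e₁₂ | yes e₁₃ | _ = no-many-equal d₁ p₁₂ p₁₃ p₂₃ e₁₂ e₁₃ , at-most-two-pair d₁ p₁₂ e₁₂
    ... | yes e₁₂ | no n₁₃ | _ = no-many-pair d₁ d₂ d₃ p₁₂ e₁₂ (n₁₃ ∘ sym) , at-most-two-pair d₁ p₁₂ e₁₂
    ... | no n₁₂ | yes e₁₃ | _ = bounded₂₃ (no-many-pair d₁ d₃ d₂ p₁₃ e₁₃ (n₁₂ ∘ sym) , at-most-two-pair d₁ p₁₃ e₁₃)
    ... | no n₁₂ | no n₁₃ | yes e₂₃ = bounded₁₂ (bounded₂₃ (no-many-pair d₂ d₃ d₁ p₂₃ e₂₃ n₁₂ , at-most-two-pair d₂ p₂₃ e₂₃))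
    ... | no n₁₂ | no n₁₃ | no n₂₃ = no-many-distinct d₁ d₂ d₃ (n₁₂ ∘ sym) (n₁₃ ∘ sym) (n₂₃ ∘ sym) ,
                                      at-most-two-distinct d₁ d₂ d₃ (n₁₂ ∘ sym) (n₁₃ ∘ sym) (n₂₃ ∘ sym)

    module Sieve {x₁ x₂ x₃ : Point} (two : AtMostTwo x₁ x₂ x₃) where

      other? : ∀ h z → Dec (a h ≢ a z)
      other? h z = ¬? (a h ℤₚ.≟ a z)

      filter-length : ∀ h zs → Solution x₁ x₂ x₃ h → All (Solution x₁ x₂ x₃) zs → All (Apart h) zs → AllPairs Apart zs →
        length zs ℕ.≤ suc (length (filter (other? h) zs))
      filter-length h [] _ _ _ _ = z≤n
      filter-length h (y ∷ zs) H (S ∷ Ss) (p ∷ ps) (q ∷ qs) with a h ℤₚ.≟ a y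
      ... | no _ = s≤s (filter-length h zs H Ss ps qs)
      ... | yes e = s≤s (ℕₚ.≤-reflexive (cong length (sym (Listₚ.filter-all (other? h) (none zs Ss ps q)))))
        where
        none : ∀ zs → All (Solution x₁ x₂ x₃) zs → All (Apart h) zs → All (Apart y) zs → All (λ z → a h ≢ a z) zs
        none [] [] [] [] = []
        none (z ∷ zs) (S′ ∷ Ss) (p′ ∷ ps) (q ∷ qs) = (λ e′ → two H S S′ e e′ p p′ q) ∷ none zs Ss ps qs

      -- Each chosen head discards at most one later solution, so 2 k - 1 solutions suffice for `k`
      -- abscissae. `Q` carries the inequalities with the heads chosen before through the recursion.
      sieve : ∀ {Q : Point → Set} k zs → All (Solution x₁ x₂ x₃) zs → All Q zs → AllPairs Apart zs → k ℕ.+ k ℕ.≤ suc (length zs) →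
        Σ (List Point) λ ws → k ℕ.≤ length ws × All (Solution x₁ x₂ x₃) ws × All Q ws × Abscissae-apart ws
      sieve zero zs _ _ _ _ = [] , z≤n , [] , [] , []
      sieve (suc k) [] _ _ _ (s≤s le) with subst (ℕ._≤ 0) (ℕₚ.+-suc k k) le
      ... | ()
      sieve {Q} (suc k) (h ∷ zs) (H ∷ Ss) (Qh ∷ Qs) (p ∷ ps) (s≤s le)
        with sieve {λ z → Q z × a h ≢ a z} k (filter (other? h) zs)
               (Allₚ.filter⁺ (other? h) Ss) (All.zip (Allₚ.filter⁺ (other? h) Qs , Allₚ.all-filter (other? h) zs))
               (AllPairsₚ.filter⁺ (other? h) ps)
               (ℕₚ.≤-trans (ℕₚ.≤-pred (subst (ℕ._≤ suc (length zs)) (ℕₚ.+-suc k k) le)) (filter-length h zs H Ss p ps))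
      ... | ws , len , Ws , Qws , ap = h ∷ ws , s≤s len , H ∷ Ws , Qh ∷ All.map proj₁ Qws ,
            All.zipWith (λ { (W , _ , ne) → D-apart (in-D H) (in-D W) ne }) (Ws , Qws) ∷ ap

    -- Sieving 25 = 2 * 13 - 1 solutions leaves the 13 abscissae that `Many` asks for; the predicate
    -- `λ _ → ℤ` is a trivial start for `Q`.
    few-solutions : ∀ {x₁ x₂ x₃} → D (a x₁) → D (a x₂) → D (a x₃) → Apart x₁ x₂ → Apart x₁ x₃ → Apart x₂ x₃ →
      ∀ zs → length zs ≡ 25 → All (Solution x₁ x₂ x₃) zs → ¬ AllPairs Apart zs
    few-solutions {x₁} {x₂} {x₃} d₁ d₂ d₃ p₁₂ p₁₃ p₂₃ zs len sols ap with bounded d₁ d₂ d₃ p₁₂ p₁₃ p₂₃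
    ... | noMany , two with Sieve.sieve two {λ _ → ℤ} 13 zs sols (All.map (λ {z} _ → a z) sols) ap (ℕₚ.≤-reflexive (cong suc (sym len)))
    ...   | ws , len′ , Ws , _ , ap′ = noMany (ws , len′ , Ws , ap′)

-- Primes between consecutive powers of four.

module PrimesInIntervals where

  open import Data.Nat
  open import Data.Nat.Properties
  open import Data.Nat.Divisibility
  open import Data.Nat.Primality
  open import Data.Nat.Primality.Factorisation using (factorise; PrimeFactorisation)
  open import Data.Nat.Combinatorics using (_C_; nCk≡nC[n∸k]; nCn≡1; nCk+nC[k+1]≡[n+1]C[k+1])
  open import Data.Nat.Combinatorics.Specification using (k>n⇒nCk≡0)
  open import Data.Nat.LCM using (lcm; m∣lcm[m,n]; n∣lcm[m,n]; lcm-least)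
  open import Data.Nat.Coprimality using (Coprime; coprime-divisor)
  open import Data.Nat.Induction using (<-rec)
  open import Data.Nat.ListAction using (product)
  open import Data.Nat.Tactic.RingSolver using (solve-∀)
  open import Data.List using ([]; _∷_)
  open import Data.List.Relation.Unary.All using (All; []; _∷_)
  open import Relation.Nullary.Decidable using (_×-dec_)

  nC0≡1 : ∀ n → n C 0 ≡ 1
  nC0≡1 n = trans (nCk≡nC[n∸k] {k = 0} {n = n} z≤n) (nCn≡1 n)

  absorption : ∀ n k → suc k * (suc n C suc k) ≡ suc n * (n C k)
  absorption n zero = trans (*-identityˡ _) (trans (nC1 n) (sym (trans (cong (suc n *_) (nC0≡1 n)) (*-identityʳ (suc n)))))
    where
    nC1 : ∀ n → suc n C 1 ≡ suc n
    nC1 zero    = refl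
    nC1 (suc n) = trans (sym (nCk+nC[k+1]≡[n+1]C[k+1] (suc n) 0)) (cong₂ _+_ (nC0≡1 (suc n)) (nC1 n))
  absorption zero (suc k) = trans (cong (suc (suc k) *_) (k>n⇒nCk≡0 {1} {suc (suc k)} (s≤s (s≤s z≤n)))) (trans (*-zeroʳ (suc (suc k)))
    (sym (trans (*-identityˡ _) (k>n⇒nCk≡0 {0} {suc k} (s≤s z≤n)))))
  absorption (suc n) (suc k) = begin
    suc (suc k) * (suc (suc n) C suc (suc k))
      ≡⟨ cong (suc (suc k) *_) (sym (nCk+nC[k+1]≡[n+1]C[k+1] (suc n) (suc k))) ⟩
    suc (suc k) * (suc n C suc k + suc n C suc (suc k))
      ≡⟨ split (suc k) (suc n C suc k) (suc n C suc (suc k)) ⟩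
    suc n C suc k + (suc k * (suc n C suc k) + suc (suc k) * (suc n C suc (suc k)))
      ≡⟨ cong (suc n C suc k +_) (cong₂ _+_ (absorption n k) (absorption n (suc k))) ⟩
    suc n C suc k + (suc n * (n C k) + suc n * (n C suc k))
      ≡⟨ cong (suc n C suc k +_) (trans (sym (*-distribˡ-+ (suc n) (n C k) (n C suc k))) (cong (suc n *_) (nCk+nC[k+1]≡[n+1]C[k+1] n k))) ⟩
    suc (suc n) * (suc n C suc k) ∎
    where
    open ≡-Reasoning
    split : ∀ k x y → suc k * (x + y) ≡ x + (k * x + suc k * y)
    split = solve-∀

  -- Pascal's rule lowers k + l until it equals p. There absorption makes p divide k times the
  -- binomial, and k < p.
  prime∣binomial : ∀ {p} → Prime p → ∀ k l → k < p → l < p → p ≤ k + l → p ∣ (k + l) C k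
  prime∣binomial pr zero l _ l<p p≤l = ⊥-elim (<⇒≱ l<p p≤l)
  prime∣binomial {p} pr (suc k) zero k<p _ p≤k = ⊥-elim (<⇒≱ k<p (subst (p ≤_) (+-identityʳ (suc k)) p≤k))
  prime∣binomial {p} pr (suc k) (suc l) k<p l<p p≤n with m≤n⇒m<n∨m≡n p≤n
  ... | inj₁ (s≤s p≤n′) = subst (p ∣_) (nCk+nC[k+1]≡[n+1]C[k+1] (k + suc l) k)
          (∣m∣n⇒∣m+n (prime∣binomial pr k (suc l) (<-trans (n<1+n k) k<p) l<p p≤n′)
            (subst (λ n → p ∣ n C suc k) (sym (+-suc k l))
              (prime∣binomial pr (suc k) l k<p (<-trans (n<1+n l) l<p) (subst (p ≤_) (+-suc k l) p≤n′))))
  ... | inj₂ refl with euclidsLemma (suc k) (suc (k + suc l) C suc k) pr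
                        (subst (p ∣_) (sym (absorption (k + suc l) k)) (m∣m*n ((k + suc l) C k)))
  ...   | inj₁ p∣k = ⊥-elim (<⇒≱ k<p (∣⇒≤ p∣k))
  ...   | inj₂ h   = h

  central odd-central : ℕ → ℕ
  central m = (m + m) C m
  odd-central m = suc (m + m) C m

  odd-central-central : ∀ m → suc m * odd-central m ≡ suc (m + m) * central m
  odd-central-central m = trans (cong (suc m *_) (trans (nCk≡nC[n∸k] (≤-trans (m≤m+n m m) (n≤1+n (m + m))))
    (cong (suc (m + m) C_) (trans (+-∸-assoc 1 (m≤m+n m m)) (cong suc (m+n∸m≡n m m)))))) (absorption (m + m) m)

  central-suc : ∀ m → central (suc m) ≡ 2 * odd-central m
  central-suc m = *-cancelˡ-≡ _ _ (suc m) (begin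
    suc m * (suc (m + suc m) C suc m) ≡⟨ cong (λ n → suc m * (suc n C suc m)) (+-suc m m) ⟩
    suc m * (suc (suc (m + m)) C suc m) ≡⟨ absorption (suc (m + m)) m ⟩
    suc (suc (m + m)) * odd-central m ≡⟨ arith m (odd-central m) ⟩
    suc m * (2 * odd-central m) ∎)
    where
    open ≡-Reasoning
    arith : ∀ m d → suc (suc (m + m)) * d ≡ suc m * (2 * d)
    arith = solve-∀

  odd-central≤4^ : ∀ m → odd-central m ≤ 4 ^ m
  odd-central≤4^ zero = ≤-refl
  odd-central≤4^ (suc m) = ≤-trans (*-cancelˡ-≤ (suc (suc m)) (begin
    suc (suc m) * odd-central (suc m) ≡⟨ odd-central-central (suc m) ⟩
    suc (suc m + suc m) * central (suc m) ≡⟨ cong (suc (suc m + suc m) *_) (central-suc m) ⟩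
    suc (suc m + suc m) * (2 * odd-central m) ≤⟨ m≤m+n _ (2 * odd-central m) ⟩
    suc (suc m + suc m) * (2 * odd-central m) + 2 * odd-central m ≡⟨ arith m (odd-central m) ⟩
    suc (suc m) * (4 * odd-central m) ∎)) (*-monoʳ-≤ 4 (odd-central≤4^ m))
    where
    open ≤-Reasoning
    arith : ∀ m d → suc (suc m + suc m) * (2 * d) + 2 * d ≡ suc (suc m) * (4 * d)
    arith = solve-∀

  4^≤central : ∀ m → 4 ^ m ≤ suc (m + m) * central m
  4^≤central zero = ≤-refl
  4^≤central (suc m) = *-cancelˡ-≤ (suc m) (begin
    suc m * (4 * 4 ^ m) ≤⟨ m≤m+n _ (2 * 4 ^ m) ⟩
    suc m * (4 * 4 ^ m) + 2 * 4 ^ m ≡⟨ arith₁ m (4 ^ m) ⟩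
    2 * suc (suc m + suc m) * 4 ^ m ≤⟨ *-monoʳ-≤ (2 * suc (suc m + suc m)) (4^≤central m) ⟩
    2 * suc (suc m + suc m) * (suc (m + m) * central m) ≡⟨ cong (2 * suc (suc m + suc m) *_) (sym (odd-central-central m)) ⟩
    2 * suc (suc m + suc m) * (suc m * odd-central m) ≡⟨ arith₂ m (odd-central m) ⟩
    suc m * (suc (suc m + suc m) * (2 * odd-central m)) ≡⟨ cong (λ c → suc m * (suc (suc m + suc m) * c)) (sym (central-suc m)) ⟩
    suc m * (suc (suc m + suc m) * central (suc m)) ∎)
    where
    open ≤-Reasoning
    arith₁ : ∀ m x → suc m * (4 * x) + 2 * x ≡ 2 * suc (suc m + suc m) * x
    arith₁ = solve-∀
    arith₂ : ∀ m d → 2 * suc (suc m + suc m) * (suc m * d) ≡ suc m * (suc (suc m + suc m) * (2 * d))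
    arith₂ = solve-∀

  lcm-upto : ℕ → ℕ
  lcm-upto zero    = 1
  lcm-upto (suc n) = lcm (suc n) (lcm-upto n)

  lcm-upto-step : ∀ n → lcm-upto n ∣ lcm-upto (suc n)
  lcm-upto-step n = n∣lcm[m,n] (suc n) (lcm-upto n)

  -- 1/x = 1/y - 1/z forces x to divide every common multiple of y and z.
  harmonic-∣ : ∀ {x y z L} .{{_ : NonZero y}} .{{_ : NonZero z}} → y * (x + z) ≡ x * z → y ∣ L → z ∣ L → x ∣ L
  harmonic-∣ {x} {y} {z} {L} e (divides A refl) (divides B L≡Bz) =
    ∣m+n∣m⇒∣n (subst (x ∣_) (sym (trans (+-comm (x * B) (A * y)) key)) (m∣m*n A)) (m∣m*n B)
    where
    instance yz≢0 : NonZero (y * z)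
             yz≢0 = m*n≢0 y z
    arith₁ : ∀ x y z A B → y * z * (A * y + x * B) ≡ y * z * (A * y) + x * y * (B * z)
    arith₁ = solve-∀
    arith₂ : ∀ x y z A → y * z * (A * y) + x * y * (A * y) ≡ A * y * (y * (x + z))
    arith₂ = solve-∀
    arith₃ : ∀ x y z A → A * y * (x * z) ≡ y * z * (x * A)
    arith₃ = solve-∀
    key : A * y + x * B ≡ x * A
    key = *-cancelˡ-≡ _ _ (y * z) (begin
      y * z * (A * y + x * B) ≡⟨ arith₁ x y z A B ⟩
      y * z * (A * y) + x * y * (B * z) ≡⟨ cong (λ w → y * z * (A * y) + x * y * w) (sym L≡Bz) ⟩
      y * z * (A * y) + x * y * (A * y) ≡⟨ arith₂ x y z A ⟩
      A * y * (y * (x + z)) ≡⟨ cong (A * y *_) e ⟩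
      A * y * (x * z) ≡⟨ arith₃ x y z A ⟩
      y * z * (x * A) ∎)
      where open ≡-Reasoning

  binomial-nonZero : ∀ n k → k ≤ n → NonZero (n C k)
  binomial-nonZero n zero _ = subst NonZero (sym (nC0≡1 n)) _
  binomial-nonZero (suc n) (suc k) (s≤s k≤n) = subst NonZero (nCk+nC[k+1]≡[n+1]C[k+1] n k)
    (>-nonZero (≤-trans (>-nonZero⁻¹ (n C k) {{binomial-nonZero n k k≤n}}) (m≤m+n _ _)))

  -- These are the denominators of Leibniz's harmonic triangle. Each entry is the difference of the
  -- entry above it and its left neighbour, which is the relation that `harmonic-∣` needs.
  leibniz-∣-lcm : ∀ n k → k ≤ n → suc n * (n C k) ∣ lcm-upto (suc n)
  leibniz-∣-lcm n zero _ = subst (_∣ lcm-upto (suc n)) (sym (trans (cong (suc n *_) (nC0≡1 n)) (*-identityʳ (suc n))))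
    (m∣lcm[m,n] (suc n) (lcm-upto n))
  leibniz-∣-lcm (suc n) (suc k) (s≤s k≤n) =
    harmonic-∣ {{m*n≢0 (suc n) (n C k) {{_}} {{binomial-nonZero n k k≤n}}}}
               {{m*n≢0 (suc (suc n)) (suc n C k) {{_}} {{binomial-nonZero (suc n) k (≤-trans k≤n (n≤1+n n))}}}}
      (begin
      suc n * (n C k) * (suc (suc n) * (suc n C suc k) + suc (suc n) * (suc n C k))
        ≡⟨ arith₁ (suc n * (n C k)) (suc (suc n)) (suc n C suc k) (suc n C k) ⟩
      suc n * (n C k) * (suc (suc n) * (suc n C k + suc n C suc k))
        ≡⟨ cong₂ (λ u v → u * (suc (suc n) * v)) (sym (absorption n k)) (nCk+nC[k+1]≡[n+1]C[k+1] (suc n) k) ⟩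
      suc k * (suc n C suc k) * (suc (suc n) * (suc (suc n) C suc k))
        ≡⟨ arith₂ (suc k) (suc n C suc k) (suc (suc n)) (suc (suc n) C suc k) ⟩
      suc (suc n) * (suc n C suc k) * (suc k * (suc (suc n) C suc k))
        ≡⟨ cong (suc (suc n) * (suc n C suc k) *_) (absorption (suc n) k) ⟩
      suc (suc n) * (suc n C suc k) * (suc (suc n) * (suc n C k)) ∎)
      (∣-trans (leibniz-∣-lcm n k k≤n) (lcm-upto-step (suc n)))
      (leibniz-∣-lcm (suc n) k (≤-trans k≤n (n≤1+n n)))
    where
    open ≡-Reasoning
    arith₁ : ∀ y N u v → y * (N * u + N * v) ≡ y * (N * (v + u))
    arith₁ = solve-∀
    arith₂ : ∀ k u N v → k * u * (N * v) ≡ N * u * (k * v)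
    arith₂ = solve-∀

  lcm-upto-nonZero : ∀ n → NonZero (lcm-upto n)
  lcm-upto-nonZero zero = _
  lcm-upto-nonZero (suc n) = ≢-nonZero λ e → ≢-nonZero⁻¹ (suc n * lcm-upto n) {{m*n≢0 (suc n) (lcm-upto n) {{_}} {{lcm-upto-nonZero n}}}}
    (0∣⇒≡0 (subst (_∣ suc n * lcm-upto n) e (lcm-least {suc n} {lcm-upto n} (m∣m*n (lcm-upto n)) (n∣m*n (suc n)))))

  4^≤lcm-upto : ∀ m → 4 ^ m ≤ lcm-upto (suc (m + m))
  4^≤lcm-upto m = ≤-trans (4^≤central m) (∣⇒≤ {{lcm-upto-nonZero (suc (m + m))}} (leibniz-∣-lcm (m + m) m (m≤m+n m m)))

  prime-part : ℕ → ℕ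
  prime-part n with prime? n
  ... | yes _ = n
  ... | no  _ = 1

  prime-product : ℕ → ℕ → ℕ
  prime-product lo zero    = 1
  prime-product lo (suc k) = prime-part (lo + suc k) * prime-product lo k

  prime∣prime-part : ∀ {p n} → Prime p → p ∣ prime-part n → p ∣ n
  prime∣prime-part {p} {n} pr d with prime? n
  ... | yes _ = d
  ... | no  _ = ⊥-elim (¬prime[1] (subst Prime (∣1⇒≡1 d) pr))

  prime-part-pos : ∀ n → 0 < prime-part n
  prime-part-pos n with prime? n
  ... | yes pr = >-nonZero⁻¹ n {{prime⇒nonZero pr}}
  ... | no _ = s≤s z≤n

  prime-product-small : ∀ {p} → Prime p → ∀ lo k → lo + k < p → ¬ p ∣ prime-product lo k
  prime-product-small pr lo zero lt d = ¬prime[1] (subst Prime (∣1⇒≡1 d) pr)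
  prime-product-small {p} pr lo (suc k) lt d with euclidsLemma (prime-part (lo + suc k)) (prime-product lo k) pr d
  ... | inj₁ h = <⇒≱ lt (∣⇒≤ {{>-nonZero (subst (0 <_) (sym (+-suc lo k)) (s≤s z≤n))}} (prime∣prime-part pr h))
  ... | inj₂ h = prime-product-small pr lo k (<-trans (subst (lo + k <_) (sym (+-suc lo k)) (n<1+n _)) lt) h

  prime-∤⇒*∣ : ∀ {p n X} → Prime p → ¬ p ∣ n → n ∣ X → p ∣ X → p * n ∣ X
  prime-∤⇒*∣ {p} {n} pr p∤n (divides q refl) p∣X with euclidsLemma q n pr p∣X
  ... | inj₁ (divides r refl) = divides r (*-assoc r p n)
  ... | inj₂ h = ⊥-elim (p∤n h)

  prime-product-∣ : ∀ lo k X → (∀ p → Prime p → lo < p → p ≤ lo + k → p ∣ X) → prime-product lo k ∣ X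
  prime-product-∣ lo zero X h = 1∣ X
  prime-product-∣ lo (suc k) X h with prime-product-∣ lo k X (λ p pr l u → h p pr l (≤-trans u (+-monoʳ-≤ lo (n≤1+n k)))) | prime? (lo + suc k)
  ... | ih | no _   = subst (_∣ X) (sym (*-identityˡ _)) ih
  ... | ih | yes pr = prime-∤⇒*∣ pr (prime-product-small pr lo k (subst (lo + k <_) (sym (+-suc lo k)) (n<1+n _))) ih
                        (h (lo + suc k) pr (subst (lo <_) (sym (+-suc lo k)) (s≤s (m≤m+n lo k))) ≤-refl)

  prime-product-split : ∀ a k → prime-product 0 (a + k) ≡ prime-product a k * prime-product 0 a
  prime-product-split a zero = trans (cong (prime-product 0) (+-identityʳ a)) (sym (*-identityˡ _))
  prime-product-split a (suc k) = trans (cong (prime-product 0) (+-suc a k))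
    (trans (cong₂ (λ u v → prime-part u * v) (sym (+-suc a k)) (prime-product-split a k)) (sym (*-assoc (prime-part (a + suc k)) _ _)))

  -- Erdős's induction. An even n > 2 adds no prime. For n = 2 M + 1 the primes above M + 1 divide
  -- `odd-central M`, which is at most 4^M, and the rest is the case M + 1.
  prime-product≤4^ : ∀ n → prime-product 0 n ≤ 4 ^ n
  prime-product≤4^ = <-rec _ step
    where
    open ≤-Reasoning
    halve : ∀ n → (Σ ℕ λ m → n ≡ m + m) ⊎ (Σ ℕ λ m → n ≡ suc (m + m))
    halve zero = inj₁ (0 , refl)
    halve (suc n) with halve n
    ... | inj₁ (m , refl) = inj₂ (m , refl)
    ... | inj₂ (m , refl) = inj₁ (suc m , cong suc (sym (+-suc m m)))
    step : ∀ n → (∀ {k} → k < n → prime-product 0 k ≤ 4 ^ k) → prime-product 0 n ≤ 4 ^ n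
    step n rec with halve n
    ... | inj₁ (zero , refl) = ≤-refl
    ... | inj₁ (suc zero , refl) = s≤s (s≤s z≤n)
    ... | inj₁ (suc (suc m) , refl) with prime? (suc (suc m) + suc (suc m))
    ...   | no _ = begin
      1 * prime-product 0 (suc (m + suc (suc m))) ≡⟨ *-identityˡ _ ⟩
      prime-product 0 (suc (m + suc (suc m))) ≤⟨ rec ≤-refl ⟩
      4 ^ suc (m + suc (suc m)) ≤⟨ m≤n*m (4 ^ suc (m + suc (suc m))) 4 ⟩
      4 ^ (suc (suc m) + suc (suc m)) ∎
    ...   | yes pr = ⊥-elim (composite⇒¬prime (composite-≢ 2 (λ e → 0≢1+n (trans (suc-injective (suc-injective e)) (+-suc m (suc m)))) (divides (suc (suc m)) (arith m))) pr)
      where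
      arith : ∀ m → suc (suc m) + suc (suc m) ≡ suc (suc m) * 2
      arith = solve-∀
    step n rec | inj₂ (zero , refl) = s≤s z≤n
    step n rec | inj₂ (suc m , refl) = begin
      prime-product 0 (suc (M + M)) ≡⟨ prime-product-split (suc M) M ⟩
      prime-product (suc M) M * prime-product 0 (suc M)
        ≤⟨ *-mono-≤ (∣⇒≤ {{binomial-nonZero (suc (M + M)) M (≤-trans (m≤m+n M M) (n≤1+n _))}}
                       (prime-product-∣ (suc M) M (odd-central M) divides-odd-central))
                    (rec (s≤s (subst (suc M ≤_) (sym (cong suc (+-suc m m))) (s≤s (s≤s (m≤m+n m m)))))) ⟩
      odd-central M * 4 ^ suc M ≤⟨ *-monoˡ-≤ (4 ^ suc M) (odd-central≤4^ M) ⟩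
      4 ^ M * 4 ^ suc M ≡⟨ sym (^-distribˡ-+-* 4 M (suc M)) ⟩
      4 ^ (M + suc M) ≡⟨ cong (4 ^_) (+-suc M M) ⟩
      4 ^ suc (M + M) ∎
      where
      M = suc m
      divides-odd-central : ∀ p → Prime p → suc M < p → p ≤ suc M + M → p ∣ odd-central M
      divides-odd-central p pr lo hi = subst (λ n → p ∣ n C M) (+-suc M M)
        (prime∣binomial pr M (suc M) (<-trans (n<1+n M) lo) lo (subst (p ≤_) (sym (+-suc M M)) hi))

  prime∣^⇒∣ : ∀ {p} q e → Prime p → p ∣ q ^ e → p ∣ q
  prime∣^⇒∣ q zero    pr d = ⊥-elim (¬prime[1] (subst Prime (∣1⇒≡1 d) pr))
  prime∣^⇒∣ q (suc e) pr d = [ (λ h → h) , prime∣^⇒∣ q e pr ]′ (euclidsLemma q (q ^ e) pr d)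

  prime∣prime⇒≡ : ∀ {p q} → Prime p → Prime q → p ∣ q → p ≡ q
  prime∣prime⇒≡ pp pq d with prime⇒irreducible pq d
  ... | inj₁ refl = ⊥-elim (¬prime[1] pp)
  ... | inj₂ e    = e

  prime-power-coprime : ∀ {p q} e → Prime p → Prime q → q ≢ p → Coprime (q ^ e) p
  prime-power-coprime {p} {q} e pp pq ne (d∣qᵉ , d∣p) with prime⇒irreducible pp d∣p
  ... | inj₁ d≡1  = d≡1
  ... | inj₂ refl = ⊥-elim (ne (sym (prime∣prime⇒≡ pp pq (prime∣^⇒∣ q e pp d∣qᵉ))))

  -- Prime factors of `a` are cancelled one at a time from both sides. The hypothesis survives:
  -- powers of the cancelled prime shift by one exponent, powers of any other prime are coprime to
  -- it.
  prime-powers⇒∣ : ∀ a b .{{_ : NonZero a}} → (∀ p e → Prime p → p ^ e ∣ a → p ^ e ∣ b) → a ∣ b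
  prime-powers⇒∣ a b h = subst (_∣ b) (sym isFactorisation)
    (go factors factorsPrime b λ p e pr d → h p e pr (subst (p ^ e ∣_) (sym isFactorisation) d))
    where
    open PrimeFactorisation (factorise a)
    go : ∀ ps → All Prime ps → ∀ b → (∀ q e → Prime q → q ^ e ∣ product ps → q ^ e ∣ b) → product ps ∣ b
    go [] _ b h = 1∣ b
    go (p ∷ ps) (pp ∷ pps) b h with h p 1 pp (subst (_∣ p * product ps) (sym (*-identityʳ p)) (m∣m*n (product ps)))
    ... | divides b′ refl = subst (p * product ps ∣_) (trans (*-comm p b′) (cong (b′ *_) (sym (*-identityʳ p))))
                              (*-monoʳ-∣ p (go ps pps b′ divide))
      where
      divide : ∀ q e → Prime q → q ^ e ∣ product ps → q ^ e ∣ b′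
      divide q e pq d with q ≟ p
      ... | yes refl = *-cancelˡ-∣ p {{prime⇒nonZero pp}} (subst (p * p ^ e ∣_) (trans (cong (b′ *_) (*-identityʳ p)) (*-comm b′ p)) (h p (suc e) pp (*-monoʳ-∣ p d)))
      ... | no ne = coprime-divisor (prime-power-coprime e pp pq ne)
                      (subst (q ^ e ∣_) (trans (cong (b′ *_) (*-identityʳ p)) (*-comm b′ p)) (h q e pq (∣n⇒∣m*n p d)))

  cofactor : ∀ {p} e a → ¬ p ^ suc e ∣ a → .{{_ : NonZero p}} → Σ ℕ λ a′ → a ∣ p ^ e * a′ × ¬ p ∣ a′
  cofactor {p} zero a h = a , ∣-reflexive (sym (*-identityˡ a)) , λ d → h (subst (_∣ a) (sym (*-identityʳ p)) d)
  cofactor {p} (suc e) a h with p ∣? a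
  ... | no p∤a = a , n∣m*n (p ^ suc e) , p∤a
  ... | yes (divides a₁ refl) with cofactor {p} e a₁ (λ d → h (subst (p ^ suc (suc e) ∣_) (*-comm p a₁) (*-monoʳ-∣ p d)))
  ...   | a′ , d , n = a′ , subst (a₁ * p ∣_) (trans (*-comm (p ^ e * a′) p) (sym (*-assoc p (p ^ e) a′))) (*-monoˡ-∣ p d) , n

  -- If neither number is divisible by p^(e+1), `cofactor` yields the common multiple p^e a′ b′ with
  -- a′ and b′ prime to p, which p^(e+1) does not divide.
  prime-power∣lcm : ∀ {p} → Prime p → ∀ e a b → p ^ e ∣ lcm a b → p ^ e ∣ a ⊎ p ^ e ∣ b
  prime-power∣lcm pr zero a b d = inj₁ (1∣ a)
  prime-power∣lcm {p} pr (suc e) a b d with p ^ suc e ∣? a | p ^ suc e ∣? b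
  ... | yes h | _     = inj₁ h
  ... | no _  | yes h = inj₂ h
  ... | no na | no nb = ⊥-elim (contra (cofactor e a na) (cofactor e b nb))
    where
    instance
      p≢0 : NonZero p
      p≢0 = prime⇒nonZero pr
      pᵉ≢0 : NonZero (p ^ e)
      pᵉ≢0 = m^n≢0 p e
    contra : (Σ ℕ λ a′ → a ∣ p ^ e * a′ × ¬ p ∣ a′) → (Σ ℕ λ b′ → b ∣ p ^ e * b′ × ¬ p ∣ b′) → ⊥
    contra (a′ , da , na′) (b′ , db , nb′) = [ na′ , nb′ ]′ (euclidsLemma a′ b′ pr
      (*-cancelˡ-∣ (p ^ e) (subst (_∣ p ^ e * (a′ * b′)) (*-comm p (p ^ e))
        (∣-trans d (lcm-least (∣-trans da (*-monoʳ-∣ (p ^ e) (m∣m*n b′))) (∣-trans db (*-monoʳ-∣ (p ^ e) (n∣m*n a′))))))))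

  prime-power∣lcm-upto⇒≤ : ∀ {p} → Prime p → ∀ e n → p ^ e ∣ lcm-upto (suc n) → p ^ e ≤ suc n
  prime-power∣lcm-upto⇒≤ pr e n d with prime-power∣lcm pr e (suc n) (lcm-upto n) d
  ... | inj₁ h = ∣⇒≤ h
  prime-power∣lcm-upto⇒≤ pr e zero d | inj₂ h = ∣⇒≤ h
  prime-power∣lcm-upto⇒≤ pr e (suc n) d | inj₂ h = ≤-trans (prime-power∣lcm-upto⇒≤ pr e n h) (n≤1+n _)

  -- The forms `2 + i` and `suc n` build in a base of at least 2 and a positive argument.
  floor-log : ∀ i n → Σ ℕ λ E → (2 + i) ^ E ≤ suc n × suc n < (2 + i) ^ suc E
  floor-log i zero = 0 , ≤-refl , s≤s (s≤s z≤n)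
  floor-log i (suc n) with floor-log i n
  ... | E , lo , hi with suc (suc n) <? (2 + i) ^ suc E
  ...   | yes h = E , ≤-trans lo (n≤1+n _) , h
  ...   | no h  = suc E , ≮⇒≥ h , <-≤-trans (s≤s hi) (begin
          suc ((2 + i) ^ suc E) ≤⟨ +-monoˡ-≤ ((2 + i) ^ suc E) (m^n>0 (2 + i) (suc E)) ⟩
          (2 + i) ^ suc E + (2 + i) ^ suc E ≤⟨ +-monoʳ-≤ ((2 + i) ^ suc E) (m≤m+n _ (i * (2 + i) ^ suc E)) ⟩
          (2 + i) ^ suc (suc E) ∎)
    where open ≤-Reasoning

  -- Bases run through all integers from 2 to r + 1, prime or composite. Each contributes its
  -- largest power not exceeding n + 1, so the product stays below (n + 1)^r.
  small-powers : ℕ → ℕ → ℕ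
  small-powers n zero    = 1
  small-powers n (suc r) = (2 + r) ^ proj₁ (floor-log r n) * small-powers n r

  small-powers≤ : ∀ n r → small-powers n r ≤ suc n ^ r
  small-powers≤ n zero    = ≤-refl
  small-powers≤ n (suc r) = *-mono-≤ (proj₁ (proj₂ (floor-log r n))) (small-powers≤ n r)

  power∣small-powers : ∀ n r i e → i < r → (2 + i) ^ e ≤ suc n → (2 + i) ^ e ∣ small-powers n r
  power∣small-powers n (suc r) i e (s≤s i≤r) le with m≤n⇒m<n∨m≡n i≤r
  ... | inj₁ i<r = ∣n⇒∣m*n ((2 + r) ^ proj₁ (floor-log r n)) (power∣small-powers n r i e i<r le)
  ... | inj₂ refl with floor-log i n
  ...   | E , lo , hi = ∣m⇒∣m*n (small-powers n i) (subst ((2 + i) ^ e ∣_) (trans (sym (^-distribˡ-+-* (2 + i) e (E ∸ e))) (cong ((2 + i) ^_) (m+[n∸m]≡n e≤E))) (m∣m*n _))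
    where
    e≤E : e ≤ E
    e≤E with e ≤? E
    ... | yes h = h
    ... | no h  = ⊥-elim (<⇒≱ (<-≤-trans hi (^-monoʳ-≤ (2 + i) (≰⇒> h))) le)

  prime∣prime-product : ∀ {p} → Prime p → ∀ k → p ≤ k → p ∣ prime-product 0 k
  prime∣prime-product pr zero z≤n = ⊥-elim (¬prime[0] pr)
  prime∣prime-product {p} pr (suc k) le with m≤n⇒m<n∨m≡n le
  ... | inj₁ (s≤s p≤k) = ∣n⇒∣m*n (prime-part (suc k)) (prime∣prime-product pr k p≤k)
  ... | inj₂ refl with prime? p
  ...   | yes _ = m∣m*n (prime-product 0 k)
  ...   | no np = ⊥-elim (np pr)

  module NoPrimeGap (j : ℕ) (4≤j : 4 ≤ j) where

    -- With `k` a power of four, `r` is an exact square root of `m + m`, and every prime whose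
    -- square is at most `suc (m + m)` is at most `r`.
    k r m : ℕ
    k = 4 ^ j
    r = 2 ^ suc j
    m = k + k

    r*r : r * r ≡ m + m
    r*r = trans (sym (^-distribˡ-+-* 2 (suc j) (suc j))) (trans (cong (2 ^_) (double j)) (trans (sym (^-*-assoc 2 2 (suc j))) (arith k)))
      where
      double : ∀ j → suc j + suc j ≡ 2 * suc j
      double = solve-∀
      arith : ∀ k → 4 * k ≡ (k + k) + (k + k)
      arith = solve-∀

    small-prime : ∀ p → p * p ≤ suc (m + m) → p ≤ r
    small-prime p le with p ≤? r
    ... | yes h = h
    ... | no h  = ⊥-elim (<⇒≱ (begin-strict
        suc (m + m) ≡⟨ cong suc (sym r*r) ⟩
        suc (r * r) <⟨ s≤s (m<m+n (r * r) (≤-trans (m^n>0 2 (suc j)) (m≤m+n r r))) ⟩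
        suc (r * r + (r + r)) ≡⟨ arith r ⟩
        suc r * suc r ≤⟨ *-mono-≤ (≰⇒> h) (≰⇒> h) ⟩
        p * p ∎) le)
      where
      open ≤-Reasoning
      arith : ∀ r → suc (r * r + (r + r)) ≡ suc r * suc r
      arith = solve-∀

    -- A prime power dividing the lcm is at most `suc (m + m)`. An exponent 1 is absorbed by the
    -- primes up to `k`, because of the gap; for a larger exponent the prime is at most `r` and the
    -- whole power divides `small-powers`.
    lcm-∣ : (∀ p → Prime p → k < p → suc (m + m) < p) → lcm-upto (suc (m + m)) ∣ prime-product 0 k * small-powers (m + m) r
    lcm-∣ gap = prime-powers⇒∣ _ _ {{lcm-upto-nonZero (suc (m + m))}} powers
      where
      powers : ∀ p e → Prime p → p ^ e ∣ lcm-upto (suc (m + m)) → p ^ e ∣ prime-product 0 k * small-powers (m + m) r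
      powers p zero pr d = 1∣ _
      powers p (suc zero) pr d = subst (_∣ prime-product 0 k * small-powers (m + m) r) (sym (*-identityʳ p))
        (∣m⇒∣m*n (small-powers (m + m) r) (prime∣prime-product pr k p≤k))
        where
        p≤n = subst (_≤ suc (m + m)) (*-identityʳ p) (prime-power∣lcm-upto⇒≤ pr 1 (m + m) d)
        p≤k : p ≤ k
        p≤k with p ≤? k
        ... | yes h = h
        ... | no h  = ⊥-elim (<⇒≱ (gap p pr (≰⇒> h)) p≤n)
      powers zero (suc (suc e)) pr d = ⊥-elim (¬prime[0] pr)
      powers (suc zero) (suc (suc e)) pr d = ⊥-elim (¬prime[1] pr)
      powers p@(suc (suc i)) (suc (suc e)) pr d =
        ∣n⇒∣m*n (prime-product 0 k) (power∣small-powers (m + m) r i (suc (suc e)) (≤-trans (n≤1+n _) (small-prime p p*p≤n)) le)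
        where
        le = prime-power∣lcm-upto⇒≤ pr (suc (suc e)) (m + m) d
        p*p≤n : p * p ≤ suc (m + m)
        p*p≤n = ≤-trans (*-monoʳ-≤ p (subst (_≤ p * p ^ e) (*-identityʳ p) (*-monoʳ-≤ p (m^n>0 p e)))) le

    -- It reduces to 2 (j + 2) < 2^j, which holds from j = 4 on.
    exponents : suc (suc j) * r < k
    exponents = begin-strict
      suc (suc j) * (2 * 2 ^ j) ≡⟨ arith j (2 ^ j) ⟩
      (2 * suc (suc j)) * 2 ^ j <⟨ *-monoˡ-< (2 ^ j) {{m^n≢0 2 j}} (linear<exp j 4≤j) ⟩
      2 ^ j * 2 ^ j ≡⟨ sym (^-distribˡ-+-* 2 j j) ⟩
      2 ^ (j + j) ≡⟨ cong (2 ^_) (double j) ⟩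
      2 ^ (2 * j) ≡⟨ sym (^-*-assoc 2 2 j) ⟩
      4 ^ j ∎
      where
      open ≤-Reasoning
      arith : ∀ j x → suc (suc j) * (2 * x) ≡ (2 * suc (suc j)) * x
      arith = solve-∀
      double : ∀ j → j + j ≡ 2 * j
      double = solve-∀
      linear<exp : ∀ j → 4 ≤ j → 2 * suc (suc j) < 2 ^ j
      linear<exp j 4≤j = subst (λ j → 2 * suc (suc j) < 2 ^ j) (m+[n∸m]≡n 4≤j) (go (j ∸ 4))
        where
        go : ∀ i → 2 * suc (suc (4 + i)) < 2 ^ (4 + i)
        go zero    = s≤s (m≤m+n 12 3)
        go (suc i) = begin-strict
          2 * suc (suc (4 + suc i)) ≤⟨ m≤m+n _ (2 * (5 + i)) ⟩
          2 * suc (suc (4 + suc i)) + 2 * (5 + i) ≡⟨ step i ⟩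
          2 * (2 * suc (suc (4 + i))) <⟨ *-monoʳ-< 2 (go i) ⟩
          2 ^ (4 + suc i) ∎
          where
          step : ∀ i → 2 * suc (suc (4 + suc i)) + 2 * (5 + i) ≡ 2 * (2 * suc (suc (4 + i)))
          step = solve-∀

    n≤4^ : suc (m + m) ≤ 4 ^ suc (suc j)
    n≤4^ = begin
      suc (m + m) ≤⟨ +-monoˡ-≤ (m + m) (m^n>0 4 j) ⟩
      k + (m + m) ≤⟨ m≤m+n _ (11 * k) ⟩
      k + (m + m) + 11 * k ≡⟨ arith k ⟩
      4 ^ suc (suc j) ∎
      where
      open ≤-Reasoning
      arith : ∀ k → k + ((k + k) + (k + k)) + 11 * k ≡ 4 * (4 * k)
      arith = solve-∀

    no-gap : ¬ (∀ p → Prime p → k < p → suc (m + m) < p)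
    no-gap gap = <⇒≱ (^-monoʳ-< 4 (s≤s (s≤s z≤n)) (+-monoʳ-< k exponents)) (begin
      4 ^ (k + k) ≤⟨ 4^≤lcm-upto (k + k) ⟩
      lcm-upto (suc (m + m)) ≤⟨ ∣⇒≤ {{product≢0}} (lcm-∣ gap) ⟩
      prime-product 0 k * small-powers (m + m) r ≤⟨ *-mono-≤ (prime-product≤4^ k) (≤-trans (small-powers≤ (m + m) r) (^-monoˡ-≤ r n≤4^)) ⟩
      4 ^ k * (4 ^ suc (suc j)) ^ r ≡⟨ cong (4 ^ k *_) (^-*-assoc 4 (suc (suc j)) r) ⟩
      4 ^ k * 4 ^ (suc (suc j) * r) ≡⟨ sym (^-distribˡ-+-* 4 k (suc (suc j) * r)) ⟩
      4 ^ (k + suc (suc j) * r) ∎)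
      where
      open ≤-Reasoning
      positive-product : ∀ lo k → 0 < prime-product lo k
      positive-product lo zero = s≤s z≤n
      positive-product lo (suc k) = *-mono-< (prime-part-pos (lo + suc k)) (positive-product lo k)
      positive-powers : ∀ r → 0 < small-powers (m + m) r
      positive-powers zero = s≤s z≤n
      positive-powers (suc r) = *-mono-< (m^n>0 (2 + r) (proj₁ (floor-log r (m + m)))) (positive-powers r)
      product≢0 = >-nonZero (*-mono-< (positive-product 0 k) (positive-powers r))

    prime-in-interval : Σ ℕ λ p → Prime p × 4 ^ j < p × p ≤ suc (m + m)
    prime-in-interval with anyUpTo? (λ p → candidate? p) (suc (suc (m + m)))
      where
      candidate? : ∀ p → Dec (Prime p × k < p)
      candidate? p = prime? p ×-dec (k <? p)
    ... | yes (p , s≤s p≤n , pr , k<p) = p , pr , k<p , p≤n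
    ... | no none = ⊥-elim (no-gap λ p pr k<p → ≰⇒> λ p≤n → none (p , s≤s p≤n , pr , k<p))

-- Finite sums, indicators, convexity and the handshake lemma.

module FiniteSums where

  open import Data.Nat hiding (_≟_)
  open import Data.Nat.Properties hiding (_≟_)
  import Data.Nat.ListAction as ListAction
  open import Data.Nat.Tactic.RingSolver using (solve-∀)
  open import Data.Bool using (Bool; true; false; _∧_; if_then_else_; T)
  open import Data.Fin using (Fin; zero; suc; toℕ; _≟_)
  import Data.Fin.Properties as Finₚ
  open import Data.List using (map; allFin; tabulate)
  import Data.List.Properties as Listₚ
  open import Relation.Binary.Definitions using (tri<; tri≈; tri>)

  ∑ : ∀ {n} → (Fin n → ℕ) → ℕ
  ∑ {zero}  f = 0
  ∑ {suc n} f = f zero + ∑ (f ∘ suc)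

  ∑-cong : ∀ {n} {f g : Fin n → ℕ} → (∀ i → f i ≡ g i) → ∑ f ≡ ∑ g
  ∑-cong {zero}  h = refl
  ∑-cong {suc n} h = cong₂ _+_ (h zero) (∑-cong (h ∘ suc))

  ∑-distrib-+ : ∀ {n} (f g : Fin n → ℕ) → ∑ (λ i → f i + g i) ≡ ∑ f + ∑ g
  ∑-distrib-+ {zero}  f g = refl
  ∑-distrib-+ {suc n} f g = trans (cong (f zero + g zero +_) (∑-distrib-+ (f ∘ suc) (g ∘ suc))) (interchange (f zero) (g zero) _ _)
    where
    interchange : ∀ a b c d → a + b + (c + d) ≡ (a + c) + (b + d)
    interchange = solve-∀

  ∑-*ˡ : ∀ {n} c (f : Fin n → ℕ) → ∑ (λ i → c * f i) ≡ c * ∑ f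
  ∑-*ˡ {zero}  c f = sym (*-zeroʳ c)
  ∑-*ˡ {suc n} c f = trans (cong (c * f zero +_) (∑-*ˡ c (f ∘ suc))) (sym (*-distribˡ-+ c (f zero) (∑ (f ∘ suc))))

  ∑-*ʳ : ∀ {n} c (f : Fin n → ℕ) → ∑ (λ i → f i * c) ≡ ∑ f * c
  ∑-*ʳ c f = trans (∑-cong λ i → *-comm (f i) c) (trans (∑-*ˡ c f) (*-comm c (∑ f)))

  ∑-mono : ∀ {n} {f g : Fin n → ℕ} → (∀ i → f i ≤ g i) → ∑ f ≤ ∑ g
  ∑-mono {zero}  h = z≤n
  ∑-mono {suc n} h = +-mono-≤ (h zero) (∑-mono (h ∘ suc))

  ∑-const : ∀ n c → ∑ {n} (λ _ → c) ≡ n * c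
  ∑-const zero    c = refl
  ∑-const (suc n) c = cong (c +_) (∑-const n c)

  ∑-zero : ∀ n → ∑ {n} (λ _ → 0) ≡ 0
  ∑-zero n = trans (∑-const n 0) (*-zeroʳ n)

  ∑-comm : ∀ {m n} (f : Fin m → Fin n → ℕ) → ∑ (λ i → ∑ (λ j → f i j)) ≡ ∑ (λ j → ∑ (λ i → f i j))
  ∑-comm {zero}  {n} f = sym (∑-zero n)
  ∑-comm {suc m} f = trans (cong (∑ (f zero) +_) (∑-comm (f ∘ suc))) (sym (∑-distrib-+ (f zero) (λ j → ∑ (λ i → f (suc i) j))))

  ∑-witness : ∀ {n} (f g : Fin n → ℕ) → ∑ g < ∑ f → Σ (Fin n) λ i → g i < f i
  ∑-witness {suc n} f g lt with g zero <? f zero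
  ... | yes h = zero , h
  ... | no h with ∑-witness (f ∘ suc) (g ∘ suc) (≰⇒> λ le → <⇒≱ lt (+-mono-≤ (≮⇒≥ h) le))
  ...   | i , p = suc i , p

  ∑-positive : ∀ {n} (f : Fin n → ℕ) → 0 < ∑ f → Σ (Fin n) λ i → 0 < f i
  ∑-positive {n} f lt = ∑-witness f (λ _ → 0) (subst (_< ∑ f) (sym (∑-zero n)) lt)

  ∑-product : ∀ {m n} (f : Fin m → ℕ) (g : Fin n → ℕ) → ∑ f * ∑ g ≡ ∑ (λ i → ∑ (λ j → f i * g j))
  ∑-product f g = trans (sym (∑-*ʳ (∑ g) f)) (∑-cong λ i → sym (∑-*ˡ (f i) g))

  𝟙 : Bool → ℕ
  𝟙 b = if b then 1 else 0

  𝟙≤1 : ∀ b → 𝟙 b ≤ 1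
  𝟙≤1 true  = ≤-refl
  𝟙≤1 false = z≤n

  𝟙-true : ∀ {b} → 0 < 𝟙 b → b ≡ true
  𝟙-true {true} _ = refl

  𝟙-∧ : ∀ a b → 𝟙 (a ∧ b) ≡ 𝟙 a * 𝟙 b
  𝟙-∧ true  b = sym (+-identityʳ (𝟙 b))
  𝟙-∧ false b = refl

  𝟙-∧≤ : ∀ a b → 𝟙 (a ∧ b) ≤ 𝟙 a
  𝟙-∧≤ true  b = 𝟙≤1 b
  𝟙-∧≤ false b = z≤n

  𝟙-∧-false : ∀ a → 𝟙 (a ∧ false) ≡ 0
  𝟙-∧-false true  = refl
  𝟙-∧-false false = refl

  𝟙*<𝟙⇒≡0 : ∀ b t → 𝟙 b * t < 𝟙 b → t ≡ 0
  𝟙*<𝟙⇒≡0 true zero _ = refl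
  𝟙*<𝟙⇒≡0 true (suc t) (s≤s ())

  ≤-𝟙* : ∀ {k m} b → k ≤ m → (b ≡ false → k ≡ 0) → k ≤ 𝟙 b * m
  ≤-𝟙* true  le _ = subst (_ ≤_) (sym (+-identityʳ _)) le
  ≤-𝟙* false le z = ≤-reflexive (z refl)

  𝟙*≤ : ∀ b m → 𝟙 b * m ≤ m
  𝟙*≤ b m = subst (𝟙 b * m ≤_) (*-identityˡ m) (*-monoˡ-≤ m (𝟙≤1 b))

  positive-* : ∀ a b → 0 < a * b → 0 < a × 0 < b
  positive-* (suc a) (suc b) _ = s≤s z≤n , s≤s z≤n
  positive-* (suc a) zero lt = ⊥-elim (<⇒≱ lt (≤-reflexive (*-zeroʳ a)))

  δ : ∀ {n} → Fin n → Fin n → ℕ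
  δ i j = 𝟙 (does (i ≟ j))

  δ-refl : ∀ {n} (i : Fin n) → δ i i ≡ 1
  δ-refl i with i ≟ i
  ... | yes _ = refl
  ... | no ne = ⊥-elim (ne refl)

  δ-≢ : ∀ {n} {i j : Fin n} → i ≢ j → δ i j ≡ 0
  δ-≢ {i = i} {j} ne with i ≟ j
  ... | yes e = ⊥-elim (ne e)
  ... | no _  = refl

  δ-suc : ∀ {n} (i j : Fin n) → δ (suc i) (suc j) ≡ δ i j
  δ-suc i j with i ≟ j
  ... | yes refl = refl
  ... | no ne    = refl

  ∑-δ : ∀ {n} (c : Fin n) (f : Fin n → ℕ) → ∑ (λ i → δ c i * f i) ≡ f c
  ∑-δ {suc n} zero f = trans (cong₂ _+_ (+-identityʳ (f zero)) (∑-zero n)) (+-identityʳ (f zero))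
  ∑-δ (suc c) f = trans (∑-cong λ i → cong (_* f (suc i)) (δ-suc c i)) (∑-δ c (f ∘ suc))

  ∑-δ-1 : ∀ {n} (c : Fin n) → ∑ (δ c) ≡ 1
  ∑-δ-1 c = trans (∑-cong λ i → sym (*-identityʳ (δ c i))) (∑-δ c (λ _ → 1))

  ∑-≤1 : ∀ {n} (f : Fin n → ℕ) → (∀ i → f i ≤ 1) → (∀ i j → 0 < f i → 0 < f j → i ≡ j) → ∑ f ≤ 1
  ∑-≤1 f le uniq with ∑ f in eq
  ... | zero = z≤n
  ... | suc k with ∑-positive f (subst (0 <_) (sym eq) (s≤s z≤n))
  ...   | i , pi = subst (_≤ 1) eq (subst (∑ f ≤_) (∑-δ-1 i) (∑-mono λ j → bound j))
    where
    bound : ∀ j → f j ≤ δ i j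
    bound j with f j in fj
    ... | zero = z≤n
    ... | suc _ with uniq i j pi (subst (0 <_) (sym fj) (s≤s z≤n))
    ...   | refl = subst (suc _ ≤_) (sym (δ-refl i)) (subst (_≤ 1) fj (le i))

  -- Written with `δ` and with the sums exchanged, the left side weights `f i` by the number of
  -- preimages of `i`.
  ∑-injection : ∀ {m n} (g : Fin m → Fin n) → (∀ i j → g i ≡ g j → i ≡ j) → (f : Fin n → ℕ) → ∑ (f ∘ g) ≤ ∑ f
  ∑-injection g inj f = begin
    ∑ (λ j → f (g j)) ≡⟨ ∑-cong (λ j → sym (∑-δ (g j) f)) ⟩
    ∑ (λ j → ∑ (λ i → δ (g j) i * f i)) ≡⟨ ∑-comm (λ j i → δ (g j) i * f i) ⟩
    ∑ (λ i → ∑ (λ j → δ (g j) i * f i)) ≡⟨ ∑-cong (λ i → ∑-*ʳ (f i) (λ j → δ (g j) i)) ⟩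
    ∑ (λ i → ∑ (λ j → δ (g j) i) * f i) ≤⟨ ∑-mono (λ i → *-monoˡ-≤ (f i) (∑-≤1 (λ j → δ (g j) i) (λ j → 𝟙≤1 _) (uniq i))) ⟩
    ∑ (λ i → 1 * f i) ≡⟨ ∑-cong (λ i → *-identityˡ (f i)) ⟩
    ∑ f ∎
    where
    open ≤-Reasoning
    δ-pos : ∀ {n} {i j : Fin n} → 0 < δ i j → i ≡ j
    δ-pos {i = i} {j} lt with i ≟ j
    ... | yes e = e
    uniq : ∀ i j k → 0 < δ (g j) i → 0 < δ (g k) i → j ≡ k
    uniq i j k p q = inj j k (trans (δ-pos p) (sym (δ-pos q)))

  2*≤sq+sq : ∀ a b → 2 * (a * b) ≤ a * a + b * b
  2*≤sq+sq a b with ≤-total a b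
  ... | inj₁ le = rearrange (m≤n⇒m≤o+n ((b ∸ a) * (b ∸ a)) ≤-refl)
    where
    arith : ∀ a d → d * d + 2 * (a * (a + d)) ≡ a * a + (a + d) * (a + d)
    arith = solve-∀
    rearrange : 2 * (a * b) ≤ (b ∸ a) * (b ∸ a) + 2 * (a * b) → 2 * (a * b) ≤ a * a + b * b
    rearrange h = subst (2 * (a * b) ≤_) (trans (cong (λ z → (b ∸ a) * (b ∸ a) + 2 * (a * z)) (sym (m+[n∸m]≡n le)))
      (trans (arith a (b ∸ a)) (cong (λ z → a * a + z * z) (m+[n∸m]≡n le)))) h
  ... | inj₂ le = rearrange (m≤n⇒m≤o+n ((a ∸ b) * (a ∸ b)) ≤-refl)
    where
    arith : ∀ b d → d * d + 2 * ((b + d) * b) ≡ (b + d) * (b + d) + b * b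
    arith = solve-∀
    rearrange : 2 * (a * b) ≤ (a ∸ b) * (a ∸ b) + 2 * (a * b) → 2 * (a * b) ≤ a * a + b * b
    rearrange h = subst (2 * (a * b) ≤_) (trans (cong (λ z → (a ∸ b) * (a ∸ b) + 2 * (z * b)) (sym (m+[n∸m]≡n le)))
      (trans (arith b (a ∸ b)) (cong (λ z → z * z + b * b) (m+[n∸m]≡n le)))) h

  -- Expanded over pairs, it is 2 fᵢ fⱼ ≤ fᵢ² + fⱼ² with weight wᵢ wⱼ.
  cauchy : ∀ {n} (w f : Fin n → ℕ) → ∑ (λ i → w i * f i) * ∑ (λ i → w i * f i) ≤ ∑ w * ∑ (λ i → w i * (f i * f i))
  cauchy w f = *-cancelˡ-≤ 2 (begin
    2 * (∑ wf * ∑ wf) ≡⟨ cong (2 *_) (∑-product wf wf) ⟩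
    2 * ∑ (λ i → ∑ (λ j → wf i * wf j)) ≡⟨ trans (sym (∑-*ˡ 2 (λ i → ∑ (λ j → wf i * wf j)))) (∑-cong λ i → sym (∑-*ˡ 2 (λ j → wf i * wf j))) ⟩
    ∑ (λ i → ∑ (λ j → 2 * (wf i * wf j))) ≤⟨ ∑-mono (λ i → ∑-mono λ j → pointwise (w i) (w j) (f i) (f j)) ⟩
    ∑ (λ i → ∑ (λ j → w i * wff j + wff i * w j)) ≡⟨ ∑-cong (λ i → ∑-distrib-+ (λ j → w i * wff j) (λ j → wff i * w j)) ⟩
    ∑ (λ i → ∑ (λ j → w i * wff j) + ∑ (λ j → wff i * w j)) ≡⟨ ∑-distrib-+ (λ i → ∑ (λ j → w i * wff j)) (λ i → ∑ (λ j → wff i * w j)) ⟩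
    ∑ (λ i → ∑ (λ j → w i * wff j)) + ∑ (λ i → ∑ (λ j → wff i * w j)) ≡⟨ cong₂ _+_ (sym (∑-product w wff)) (sym (∑-product wff w)) ⟩
    ∑ w * ∑ wff + ∑ wff * ∑ w ≡⟨ arith (∑ w) (∑ wff) ⟩
    2 * (∑ w * ∑ wff) ∎)
    where
    open ≤-Reasoning
    wf wff : Fin _ → ℕ
    wf i = w i * f i
    wff i = w i * (f i * f i)
    arith : ∀ a b → a * b + b * a ≡ 2 * (a * b)
    arith = solve-∀
    id₁ : ∀ v w f g → 2 * (v * f * (w * g)) ≡ v * w * (2 * (f * g))
    id₁ = solve-∀
    id₂ : ∀ v w f g → v * w * (f * f + g * g) ≡ v * (w * (g * g)) + v * (f * f) * w
    id₂ = solve-∀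
    pointwise : ∀ v w f g → 2 * (v * f * (w * g)) ≤ v * (w * (g * g)) + v * (f * f) * w
    pointwise v w f g = subst₂ _≤_ (sym (id₁ v w f g)) (id₂ v w f g) (*-monoʳ-≤ (v * w) (2*≤sq+sq f g))

  -- Two uses of Cauchy's inequality, S₁² ≤ A S₂ and S₂² ≤ S₁ S₃, give S₁⁴ ≤ A² S₁ S₃, and one
  -- factor S₁ cancels.
  power-mean-cube : ∀ {n} (w f : Fin n → ℕ) →
    ∑ (λ i → w i * f i) * (∑ (λ i → w i * f i) * ∑ (λ i → w i * f i)) ≤ ∑ w * ∑ w * ∑ (λ i → w i * (f i * (f i * f i)))
  power-mean-cube w f = go (∑ (λ i → w i * f i)) refl
    where
    open ≤-Reasoning
    S₁ S₂ S₃ A : ℕ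
    S₁ = ∑ (λ i → w i * f i)
    S₂ = ∑ (λ i → w i * (f i * f i))
    S₃ = ∑ (λ i → w i * (f i * (f i * f i)))
    A = ∑ w
    S₂²≤ : S₂ * S₂ ≤ S₁ * S₃
    S₂²≤ = reassociate (cauchy (λ i → w i * f i) f)
      where
      reassociate : ∑ (λ i → w i * f i * f i) * ∑ (λ i → w i * f i * f i) ≤ S₁ * ∑ (λ i → w i * f i * (f i * f i)) → S₂ * S₂ ≤ S₁ * S₃
      reassociate h = ≤-trans (≤-reflexive (cong (λ x → x * x) (∑-cong λ i → sym (*-assoc (w i) (f i) (f i)))))
        (≤-trans h (≤-reflexive (cong (S₁ *_) (∑-cong λ i → *-assoc (w i) (f i) (f i * f i)))))
    id₁ : ∀ s → s * (s * (s * s)) ≡ (s * s) * (s * s)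
    id₁ = solve-∀
    id₂ : ∀ a s t u → (a * t) * (a * t) ≡ (a * a) * (t * t)
    id₂ = solve-∀
    id₃ : ∀ a s t → (a * a) * (s * t) ≡ s * ((a * a) * t)
    id₃ = solve-∀
    go : ∀ s → s ≡ S₁ → S₁ * (S₁ * S₁) ≤ A * A * S₃
    go zero e = subst (λ s → s * (s * s) ≤ A * A * S₃) e z≤n
    go (suc s) e = *-cancelˡ-≤ (suc s) (subst (λ t → t * (S₁ * (S₁ * S₁)) ≤ t * (A * A * S₃)) (sym e) (begin
      S₁ * (S₁ * (S₁ * S₁)) ≡⟨ id₁ S₁ ⟩
      (S₁ * S₁) * (S₁ * S₁) ≤⟨ *-mono-≤ (cauchy w f) (cauchy w f) ⟩
      (A * S₂) * (A * S₂) ≡⟨ id₂ A S₁ S₂ S₃ ⟩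
      (A * A) * (S₂ * S₂) ≤⟨ *-monoʳ-≤ (A * A) S₂²≤ ⟩
      (A * A) * (S₁ * S₃) ≡⟨ id₃ A S₁ S₃ ⟩
      S₁ * (A * A * S₃) ∎))

  sum-allFin : ∀ n (f : Fin n → ℕ) → ListAction.sum (map f (allFin n)) ≡ ∑ f
  sum-allFin n f = trans (cong ListAction.sum (Listₚ.map-tabulate (λ i → i) f)) (go n f)
    where
    go : ∀ n (f : Fin n → ℕ) → ListAction.sum (tabulate f) ≡ ∑ f
    go zero    f = refl
    go (suc n) f = cong (f zero +_) (go n (f ∘ suc))

  degree-sum : ∀ {n} (G : SimpleGraph n) → ∑ (λ i → ∑ (λ j → 𝟙 (adj G i j))) ≡ 2 * numEdges G
  degree-sum {n} G = begin
    ∑ (λ i → ∑ (λ j → 𝟙 (adj G i j))) ≡⟨ ∑-cong (λ i → ∑-cong λ j → split i j) ⟩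
    ∑ (λ i → ∑ (λ j → up i j + up j i)) ≡⟨ ∑-cong (λ i → ∑-distrib-+ (up i) (λ j → up j i)) ⟩
    ∑ (λ i → ∑ (up i) + ∑ (λ j → up j i)) ≡⟨ ∑-distrib-+ (λ i → ∑ (up i)) (λ i → ∑ (λ j → up j i)) ⟩
    ∑ (λ i → ∑ (up i)) + ∑ (λ i → ∑ (λ j → up j i)) ≡⟨ cong (∑ (λ i → ∑ (up i)) +_) (∑-comm (λ i j → up j i)) ⟩
    ∑ (λ i → ∑ (up i)) + ∑ (λ i → ∑ (up i)) ≡⟨ cong (λ e → e + e) (sym edges) ⟩
    numEdges G + numEdges G ≡⟨ cong (numEdges G +_) (sym (+-identityʳ (numEdges G))) ⟩
    2 * numEdges G ∎
    where
    open ≡-Reasoning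
    up : Fin n → Fin n → ℕ
    up i j = 𝟙 ((toℕ i <ᵇ toℕ j) ∧ adj G i j)
    edges : numEdges G ≡ ∑ (λ i → ∑ (up i))
    edges = trans (sum-allFin n _) (∑-cong λ i → sum-allFin n (up i))
    <ᵇ-true : ∀ {a b} → a < b → (a <ᵇ b) ≡ true
    <ᵇ-true {a} {b} lt with a <ᵇ b | <⇒<ᵇ lt
    ... | true | _ = refl
    <ᵇ-false : ∀ {a b} → b ≤ a → (a <ᵇ b) ≡ false
    <ᵇ-false {a} {b} le with a <ᵇ b in eq
    ... | false = refl
    ... | true = ⊥-elim (<⇒≱ (<ᵇ⇒< a b (subst T (sym eq) _)) le)
    split : ∀ i j → 𝟙 (adj G i j) ≡ up i j + up j i
    split i j with <-cmp (toℕ i) (toℕ j)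
    ... | tri< lt _ _ = trans (sym (+-identityʳ _)) (cong₂ (λ a b → 𝟙 (a ∧ adj G i j) + 𝟙 (b ∧ adj G j i)) (sym (<ᵇ-true lt)) (sym (<ᵇ-false (<⇒≤ lt))))
    ... | tri> _ _ gt = trans (cong 𝟙 (symm G i j)) (cong₂ (λ a b → 𝟙 (a ∧ adj G i j) + 𝟙 (b ∧ adj G j i)) (sym (<ᵇ-false (<⇒≤ gt))) (sym (<ᵇ-true gt)))
    ... | tri≈ _ e _ with Finₚ.toℕ-injective e
    ...   | refl = trans (cong 𝟙 (irrefl G i)) (sym (cong (λ a → 𝟙 (a ∧ adj G i i) + 𝟙 (a ∧ adj G i i)) (<ᵇ-false {toℕ i} ≤-refl)))

-- The algebraic graph and its freeness.

module LowerBoundGraph where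

  open IntegersModulo
  open CommonNeighbours
  open Point
  open FiniteSums using (∑; ∑-mono; ∑-const; ∑-injection; ∑-distrib-+; ∑-δ-1; 𝟙; δ; δ-refl; degree-sum)
  open import Data.Nat as ℕ using (ℕ; zero; suc)
  import Data.Nat.Properties as ℕₚ
  import Data.Nat.Divisibility as ℕᵈ
  open import Data.Nat.Primality using (Prime; prime⇒nonZero)
  import Data.Nat.Tactic.RingSolver as ℕ-solver
  open import Data.Integer as ℤ using (ℤ; +_; -_; _+_; _-_; 1ℤ; ∣_∣; _⊖_)
  import Data.Integer.Properties as ℤₚ
  import Data.Integer.DivMod as ℤᵈ
  open import Data.Integer.Divisibility.Signed using (divides; ∣⇒∣ᵤ)
  open import Tactic.RingSolver using (solve-∀)
  open import Data.Bool using (Bool; true; false; _∧_; not)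
  import Data.Bool.Properties as Boolₚ
  open import Data.Fin as Fin using (Fin; toℕ; fromℕ<; splitAt; _↑ˡ_; combine; quotient; remainder)
  open import Data.Fin.Patterns using (0F; 1F; 2F)
  import Data.Fin.Properties as Finₚ
  open import Data.List using (tabulate)
  import Data.List.Properties as Listₚ
  import Data.List.Relation.Unary.All.Properties as Allₚ
  import Data.List.Relation.Unary.AllPairs.Properties as AllPairsₚ
  open import Relation.Nullary.Decidable using (dec-true)

  -- `rest` isolated vertices pad the graph to a prescribed order; a copy of the pattern cannot use
  -- them, since all its vertices have neighbours.
  module AlgebraicGraph (p : ℕ) (isPrime : Prime p) (m : ℕ) (4m<p : 4 ℕ.* m ℕ.< p) (rest : ℕ) where

    open Modulo p isPrime

    n₀ : ℕ
    n₀ = m ℕ.* (p ℕ.* p)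

    D : ℤ → Set
    D x = Σ (Fin m) λ i → x ≡ + suc (toℕ i)

    Z-small : ∀ {x y} → x ℕ.< p → y ℕ.< p → Z (+ x - + y) → x ≡ y
    Z-small {x} {y} x<p y<p z = [ (λ le → ordered le y<p h) , (λ le → sym (ordered le x<p (subst (p ℕᵈ.∣_) (ℤₚ.∣m⊖n∣≡∣n⊖m∣ x y) h))) ]′ (ℕₚ.≤-total x y)
      where
      h : p ℕᵈ.∣ ∣ x ⊖ y ∣
      h = subst (λ w → p ℕᵈ.∣ ∣ w ∣) (ℤₚ.m-n≡m⊖n x y) (∣⇒∣ᵤ z)
      ordered : ∀ {x y} → x ℕ.≤ y → y ℕ.< p → p ℕᵈ.∣ ∣ x ⊖ y ∣ → x ≡ y
      ordered {x} {y} le y<p d with y ℕ.∸ x in eq | subst (p ℕᵈ.∣_) (ℤₚ.∣⊖∣-≤ le) d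
      ... | zero  | _ = ℕₚ.≤-antisym le (ℕₚ.m∸n≡0⇒m≤n eq)
      ... | suc k | d′ = ⊥-elim (ℕₚ.<⇒≱ y<p (ℕₚ.≤-trans (ℕᵈ.∣⇒≤ d′) (subst (ℕ._≤ y) eq (ℕₚ.m∸n≤m y x))))

    small : ∀ (i : Fin m) → suc (toℕ i) ℕ.< p
    small i = ℕₚ.≤-<-trans (Finₚ.toℕ<n i) (ℕₚ.≤-<-trans (ℕₚ.m≤m+n m (3 ℕ.* m)) 4m<p)

    D-inj : ∀ {x y} → D x → D y → Z (x - y) → x ≡ y
    D-inj (i , refl) (j , refl) z = cong +_ (Z-small (small i) (small j) z)

    N-positive : ∀ k → suc k ℕ.< p → N (+ suc k)
    N-positive k lt z = ℕₚ.<⇒≱ lt (ℕᵈ.∣⇒≤ (∣⇒∣ᵤ z))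

    D-sum₂ : ∀ {x y} → D x → D y → N (x + y)
    D-sum₂ (i , refl) (j , refl) = N-positive (toℕ i ℕ.+ suc (toℕ j)) (ℕₚ.≤-<-trans
      (ℕₚ.≤-trans (ℕₚ.+-mono-≤ (Finₚ.toℕ<n i) (Finₚ.toℕ<n j)) (ℕₚ.+-monoʳ-≤ m (ℕₚ.m≤m+n m (m ℕ.+ (m ℕ.+ 0))))) 4m<p)

    D-sum₄ : ∀ {x y z w} → D x → D y → D z → D w → N (x + y + z + w)
    D-sum₄ (i , refl) (j , refl) (k , refl) (l , refl) =
      N-positive (toℕ i ℕ.+ suc (toℕ j) ℕ.+ suc (toℕ k) ℕ.+ suc (toℕ l)) (ℕₚ.≤-<-trans
        (subst (suc (toℕ i) ℕ.+ suc (toℕ j) ℕ.+ suc (toℕ k) ℕ.+ suc (toℕ l) ℕ.≤_) (four m)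
          (ℕₚ.+-mono-≤ (ℕₚ.+-mono-≤ (ℕₚ.+-mono-≤ (Finₚ.toℕ<n i) (Finₚ.toℕ<n j)) (Finₚ.toℕ<n k)) (Finₚ.toℕ<n l))) 4m<p)
      where
      four : ∀ m → m ℕ.+ m ℕ.+ m ℕ.+ m ≡ 4 ℕ.* m
      four = ℕ-solver.solve-∀

    open Geometry p isPrime D D-inj D-sum₂ D-sum₄

    first : Fin n₀ → Fin m
    first k = quotient (p ℕ.* p) k

    second third : Fin n₀ → Fin p
    second k = quotient p (remainder {m} (p ℕ.* p) k)
    third  k = remainder {p} p (remainder {m} (p ℕ.* p) k)

    point : Fin n₀ → Point
    point k = pt (+ suc (toℕ (first k))) (+ toℕ (second k)) (+ toℕ (third k))

    point-apart : ∀ {k l} → k ≢ l → Apart (point k) (point l)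
    point-apart {k} {l} ne = mkApart λ { (za , zb , zc) → ne (assemble
      (Finₚ.toℕ-injective (ℕₚ.suc-injective (Z-small (small (first k)) (small (first l)) za)))
      (Finₚ.toℕ-injective (Z-small (Finₚ.toℕ<n (second k)) (Finₚ.toℕ<n (second l)) zb))
      (Finₚ.toℕ-injective (Z-small (Finₚ.toℕ<n (third k)) (Finₚ.toℕ<n (third l)) zc))) }
      where
      assemble : first k ≡ first l → second k ≡ second l → third k ≡ third l → k ≡ l
      assemble e₁ e₂ e₃ = trans (sym (Finₚ.combine-remQuot {m} (p ℕ.* p) k)) (trans (cong₂ combine e₁
        (trans (sym (Finₚ.combine-remQuot {p} p _)) (trans (cong₂ combine e₂ e₃) (Finₚ.combine-remQuot {p} p _))))
        (Finₚ.combine-remQuot {m} (p ℕ.* p) l))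

    -- Exchanging the two points exchanges `e₁` and `e₂`, which makes the relation symmetric.
    e₁ e₂ : Point → Point → ℤ
    e₁ x y = b x + c y - a x * (a y * a y)
    e₂ x y = c x + b y - a y * (a x * a x)

    edge : Point → Point → Bool
    edge x y = does (Z? (e₁ x y)) ∧ does (Z? (e₂ x y))

    edge-sym : ∀ x y → edge x y ≡ edge y x
    edge-sym x y = trans (Boolₚ.∧-comm (does (Z? (e₁ x y))) (does (Z? (e₂ x y))))
      (cong₂ (λ u v → does (Z? u) ∧ does (Z? v)) (cong (_- a y * (a x * a x)) (ℤₚ.+-comm (c x) (b y)))
                                                  (cong (_- a x * (a y * a y)) (ℤₚ.+-comm (b x) (c y))))

    edge-true : ∀ x y → edge x y ≡ true → Z (e₁ x y) × Z (e₂ x y)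
    edge-true x y = both (Z? (e₁ x y)) (Z? (e₂ x y))
      where
      both : ∀ {A B : Set} (d : Dec A) (e : Dec B) → does d ∧ does e ≡ true → A × B
      both (yes z₁) (yes z₂) _ = z₁ , z₂

    true-edge : ∀ x y → Z (e₁ x y) → Z (e₂ x y) → edge x y ≡ true
    true-edge x y z₁ z₂ = cong₂ _∧_ (dec-true (Z? (e₁ x y)) z₁) (dec-true (Z? (e₂ x y)) z₂)

    adjacent : Fin n₀ ⊎ Fin rest → Fin n₀ ⊎ Fin rest → Bool
    adjacent (inj₁ k) (inj₁ l) = not (does (k Fin.≟ l)) ∧ edge (point k) (point l)
    adjacent (inj₁ k) (inj₂ _) = false
    adjacent (inj₂ _) _        = false

    adjacent-sym : ∀ u v → adjacent u v ≡ adjacent v u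
    adjacent-sym (inj₁ k) (inj₁ l) = cong₂ _∧_ (cong not (≟-sym k l)) (edge-sym (point k) (point l))
      where
      ≟-sym : ∀ (k l : Fin n₀) → does (k Fin.≟ l) ≡ does (l Fin.≟ k)
      ≟-sym k l with k Fin.≟ l | l Fin.≟ k
      ... | yes _ | yes _ = refl
      ... | no _  | no _  = refl
      ... | yes e | no n  = ⊥-elim (n (sym e))
      ... | no n  | yes e = ⊥-elim (n (sym e))
    adjacent-sym (inj₁ k) (inj₂ _) = refl
    adjacent-sym (inj₂ _) (inj₁ _) = refl
    adjacent-sym (inj₂ _) (inj₂ _) = refl

    adjacent-irrefl : ∀ u → adjacent u u ≡ false
    adjacent-irrefl (inj₁ k) with k Fin.≟ k
    ... | yes _ = refl
    ... | no n  = ⊥-elim (n refl)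
    adjacent-irrefl (inj₂ _) = refl

    G : SimpleGraph (n₀ ℕ.+ rest)
    G = record
      { adj    = λ i j → adjacent (splitAt n₀ i) (splitAt n₀ j)
      ; symm   = λ i j → adjacent-sym (splitAt n₀ i) (splitAt n₀ j)
      ; irrefl = λ i → adjacent-irrefl (splitAt n₀ i)
      }

    record Adjacent (u v : Fin n₀ ⊎ Fin rest) : Set where
      constructor adjacency
      field
        {k l} : Fin n₀
        u≡ : u ≡ inj₁ k
        v≡ : v ≡ inj₁ l
        on-e₁ : Z (e₁ (point k) (point l))
        on-e₂ : Z (e₂ (point k) (point l))

    adjacent⇒ : ∀ u v → adjacent u v ≡ true → Adjacent u v
    adjacent⇒ (inj₁ k) (inj₁ l) h with k Fin.≟ l
    ... | no _ = adjacency refl refl (proj₁ (edge-true (point k) (point l) h)) (proj₂ (edge-true (point k) (point l) h))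

    edges⇒link : ∀ x z y → Z (e₁ x y) → Z (e₂ x y) → Z (e₁ z y) → Z (e₂ z y) → Link x z (a y)
    edges⇒link x z y x₁ x₂ z₁ z₂ = link (lin₂ 1ℤ (- 1ℤ) x₁ z₁ (id₁ (a x) (a z) (a y) (b x) (b z) (c y)))
                                        (lin₂ 1ℤ (- 1ℤ) x₂ z₂ (id₂ (a x) (a z) (a y) (c x) (c z) (b y)))
      where
      id₁ : ∀ a s u b t w → b - t - (a - s) * (u * u) ≡ 1ℤ * (b + w - a * (u * u)) + (- 1ℤ) * (t + w - s * (u * u))
      id₁ = solve-∀ ℤ-ring
      id₂ : ∀ a s u c r w → c - r - (a * a - s * s) * u ≡ 1ℤ * (c + w - u * (a * a)) + (- 1ℤ) * (r + w - u * (s * s))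
      id₂ = solve-∀ ℤ-ring

    -- For a fixed `z` the two equations determine a neighbour from its first coordinate.
    edges-separate : ∀ z y y′ → Apart y y′ → Z (e₁ z y) → Z (e₂ z y) → Z (e₁ z y′) → Z (e₂ z y′) → N (a y - a y′)
    edges-separate z y y′ (mkApart ap) h₁ h₂ h₁′ h₂′ zu =
      ap (zu , lin₃ 1ℤ (- 1ℤ) (a z * a z) h₂ h₂′ zu (id₂ (a z) (a y) (a y′) (c z) (b y) (b y′))
             , lin₃ 1ℤ (- 1ℤ) (a z * (a y + a y′)) h₁ h₁′ zu (id₁ (a z) (a y) (a y′) (b z) (c y) (c y′)))
      where
      id₁ : ∀ s u v t w w′ → w - w′ ≡ 1ℤ * (t + w - s * (u * u)) + (- 1ℤ) * (t + w′ - s * (v * v)) + (s * (u + v)) * (u - v)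
      id₁ = solve-∀ ℤ-ring
      id₂ : ∀ s u v t w w′ → w - w′ ≡ 1ℤ * (t + w - u * (s * s)) + (- 1ℤ) * (t + w′ - v * (s * s)) + (s * s) * (u - v)
      id₂ = solve-∀ ℤ-ring

    hfree : HFree G (subdivision (K 3 25))
    hfree (f , f-inj , hom) =
      few-solutions (d 0F) (d 1F) (d 2F) (x-apart λ ()) (x-apart λ ()) (x-apart λ ())
        (tabulate z) (Listₚ.length-tabulate z) (Allₚ.tabulate⁺ sol) (AllPairsₚ.tabulate⁺ z-apart)
      where
      code : Vert (subdivision (K 3 25)) → Fin n₀ ⊎ Fin rest
      code v = splitAt n₀ (f v)
      X : Fin 3 → Vert (subdivision (K 3 25))
      X i = inj₁ (inj₁ i)
      W : Fin 25 → Vert (subdivision (K 3 25))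
      W j = inj₁ (inj₂ j)
      Y : Fin 3 → Fin 25 → Vert (subdivision (K 3 25))
      Y i j = inj₂ (i , j)
      xy : ∀ i j → Adjacent (code (X i)) (code (Y i j))
      xy i j = adjacent⇒ _ _ (hom (X i) (Y i j) (inj₁ (i , j) , inj₁ (refl , refl)))
      zy : ∀ i j → Adjacent (code (W j)) (code (Y i j))
      zy i j = adjacent⇒ _ _ (hom (W j) (Y i j) (inj₂ (i , j) , inj₂ (refl , refl)))
      module A = Adjacent
      xk : Fin 3 → Fin n₀
      xk i = A.k (xy i 0F)
      zk : Fin 25 → Fin n₀
      zk j = A.k (zy 0F j)
      yk : Fin 3 → Fin 25 → Fin n₀
      yk i j = A.l (xy i j)
      inj₁-inj : ∀ {k l : Fin n₀} → inj₁ {B = Fin rest} k ≡ inj₁ l → k ≡ l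
      inj₁-inj refl = refl
      -- Every adjacency decodes its own indices; this identifies those decoded from the same
      -- vertex.
      same : ∀ {u : Fin n₀ ⊎ Fin rest} {k l} → u ≡ inj₁ k → u ≡ inj₁ l → k ≡ l
      same p q = inj₁-inj (trans (sym p) q)
      differ : ∀ {u v k l} → u ≢ v → code u ≡ inj₁ k → code v ≡ inj₁ l → k ≢ l
      differ ne p q refl = ne (f-inj (trans (sym (Finₚ.splitAt⁻¹-↑ˡ p)) (Finₚ.splitAt⁻¹-↑ˡ q)))
      z : Fin 25 → Point
      z j = point (zk j)
      d : ∀ i → D (a (point (xk i)))
      d i = first (xk i) , refl
      x-apart : ∀ {i j} → i ≢ j → Apart (point (xk i)) (point (xk j))
      x-apart {i} {j} ne = point-apart (differ (λ { refl → ne refl }) (A.u≡ (xy i 0F)) (A.u≡ (xy j 0F)))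
      z-apart : ∀ {i j} → i ≢ j → Apart (z i) (z j)
      z-apart {i} {j} ne = point-apart (differ (λ { refl → ne refl }) (A.u≡ (zy 0F i)) (A.u≡ (zy 0F j)))
      xz-apart : ∀ i j → Apart (point (xk i)) (z j)
      xz-apart i j = point-apart (differ (λ ()) (A.u≡ (xy i 0F)) (A.u≡ (zy 0F j)))
      y-apart : ∀ {i i′} j → i ≢ i′ → Apart (point (yk i j)) (point (yk i′ j))
      y-apart {i} {i′} j ne = point-apart (differ (λ { refl → ne refl }) (A.v≡ (xy i j)) (A.v≡ (xy i′ j)))
      xe : ∀ i j → Z (e₁ (point (xk i)) (point (yk i j))) × Z (e₂ (point (xk i)) (point (yk i j)))
      xe i j with same (A.u≡ (xy i j)) (A.u≡ (xy i 0F))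
      ... | e = subst (λ k → Z (e₁ (point k) (point (yk i j))) × Z (e₂ (point k) (point (yk i j)))) e (A.on-e₁ (xy i j) , A.on-e₂ (xy i j))
      ze : ∀ i j → Z (e₁ (z j) (point (yk i j))) × Z (e₂ (z j) (point (yk i j)))
      ze i j = subst (λ k → Z (e₁ (point k) (point (yk i j))) × Z (e₂ (point k) (point (yk i j)))) (same (A.u≡ (zy i j)) (A.u≡ (zy 0F j)))
        (subst (λ l → Z (e₁ (point (A.k (zy i j))) (point l)) × Z (e₂ (point (A.k (zy i j))) (point l))) (same (A.v≡ (zy i j)) (A.v≡ (xy i j)))
          (A.on-e₁ (zy i j) , A.on-e₂ (zy i j)))
      lk : ∀ i j → Link (point (xk i)) (z j) (a (point (yk i j)))
      lk i j = edges⇒link (point (xk i)) (z j) (point (yk i j)) (proj₁ (xe i j)) (proj₂ (xe i j)) (proj₁ (ze i j)) (proj₂ (ze i j))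
      sep : ∀ {i i′} j → i ≢ i′ → N (a (point (yk i j)) - a (point (yk i′ j)))
      sep {i} {i′} j ne = edges-separate (z j) (point (yk i j)) (point (yk i′ j)) (y-apart j ne) (proj₁ (ze i j)) (proj₂ (ze i j)) (proj₁ (ze i′ j)) (proj₂ (ze i′ j))
      sol : ∀ j → Solution (point (xk 0F)) (point (xk 1F)) (point (xk 2F)) (z j)
      sol j = solution (lk 0F j) (lk 1F j) (lk 2F j) (sep j λ ()) (sep j λ ()) (sep j λ ()) (first (zk j) , refl)
        (xz-apart 0F j) (xz-apart 1F j) (xz-apart 2F j)

    private instance
      p≢0 : ℕ.NonZero p
      p≢0 = prime⇒nonZero isPrime

    residue : ℤ → Fin p
    residue w = fromℕ< (ℤᵈ.n%ℕd<d w p)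

    residue-≈ : ∀ w → Z (w - + toℕ (residue w))
    residue-≈ w = divides (w ℤᵈ./ℕ p) (trans (cong (λ r → w - + r) (Finₚ.toℕ-fromℕ< (ℤᵈ.n%ℕd<d w p)))
      (trans (cong (_- + (w ℤᵈ.%ℕ p)) (ℤᵈ.a≡a%ℕn+[a/ℕn]*n w p)) (cancel-left (+ (w ℤᵈ.%ℕ p)) ((w ℤᵈ./ℕ p) ℤ.* + p))))
      where
      cancel-left : ∀ r q → r + q - r ≡ q
      cancel-left = solve-∀ ℤ-ring

    -- The edge equations solved for the last two coordinates when the first one is prescribed.
    neighbour : Fin n₀ → Fin m → Fin n₀
    neighbour k i = combine i (combine (residue (u * (a x * a x) - c x)) (residue (a x * (u * u) - b x)))
      where
      x = point k
      u = + suc (toℕ i)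

    neighbour-first : ∀ k i → first (neighbour k i) ≡ i
    neighbour-first k i = cong proj₁ (Finₚ.remQuot-combine {m} {p ℕ.* p} i _)

    neighbour-edge : ∀ k i → edge (point k) (point (neighbour k i)) ≡ true
    neighbour-edge k i = true-edge x (point (neighbour k i))
      (at-neighbour e₁ (lin₁ (- 1ℤ) (residue-≈ (a x * (u * u) - b x)) (id₁ (a x) u (b x) _)))
      (at-neighbour e₂ (lin₁ (- 1ℤ) (residue-≈ (u * (a x * a x) - c x)) (id₂ (a x) u (c x) _)))
      where
      x = point k
      u = + suc (toℕ i)
      r₂ = residue (u * (a x * a x) - c x)
      r₃ = residue (a x * (u * u) - b x)
      expected : Point
      expected = pt u (+ toℕ r₂) (+ toℕ r₃)
      point≡ : expected ≡ point (neighbour k i)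
      point≡ = sym (trans (cong (λ t → pt (+ suc (toℕ (proj₁ t))) (+ toℕ (quotient {p} p (proj₂ t))) (+ toℕ (remainder {p} p (proj₂ t))))
                       (Finₚ.remQuot-combine {m} {p ℕ.* p} i (combine r₂ r₃)))
        (cong (λ t → pt u (+ toℕ (proj₁ t)) (+ toℕ (proj₂ t))) (Finₚ.remQuot-combine {p} {p} r₂ r₃)))
      at-neighbour : ∀ (e : Point → Point → ℤ) → Z (e x expected) → Z (e x (point (neighbour k i)))
      at-neighbour e = subst (λ y → Z (e x y)) point≡
      id₁ : ∀ a u b r → b + r - a * (u * u) ≡ (- 1ℤ) * (a * (u * u) - b - r)
      id₁ = solve-∀ ℤ-ring
      id₂ : ∀ a u c r → c + r - u * (a * a) ≡ (- 1ℤ) * (u * (a * a) - c - r)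
      id₂ = solve-∀ ℤ-ring

    degree : Fin (n₀ ℕ.+ rest) → ℕ
    degree v = ∑ (λ w → 𝟙 (adj G v w))

    -- Each first coordinate gives one solution of the edge equations. The added one pays for a
    -- solution that is the vertex itself, which is no edge of the simple graph.
    degree-bound : ∀ k → m ℕ.≤ suc (degree (k ↑ˡ rest))
    degree-bound k = begin
      m ≡⟨ sym (trans (∑-const m 1) (ℕₚ.*-identityʳ m)) ⟩
      ∑ {m} (λ _ → 1) ≤⟨ ∑-mono reached ⟩
      ∑ (λ i → F (neighbour k i ↑ˡ rest)) ≤⟨ ∑-injection (λ i → neighbour k i ↑ˡ rest) injective F ⟩
      ∑ F ≡⟨ ∑-distrib-+ (δ (k ↑ˡ rest)) (λ w → 𝟙 (adj G (k ↑ˡ rest) w)) ⟩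
      ∑ (δ (k ↑ˡ rest)) ℕ.+ degree (k ↑ˡ rest) ≡⟨ cong (ℕ._+ degree (k ↑ˡ rest)) (∑-δ-1 (k ↑ˡ rest)) ⟩
      suc (degree (k ↑ˡ rest)) ∎
      where
      open ℕₚ.≤-Reasoning
      F : Fin (n₀ ℕ.+ rest) → ℕ
      F w = δ (k ↑ˡ rest) w ℕ.+ 𝟙 (adj G (k ↑ˡ rest) w)
      injective : ∀ i j → neighbour k i ↑ˡ rest ≡ neighbour k j ↑ˡ rest → i ≡ j
      injective i j e = trans (sym (neighbour-first k i)) (trans (cong first (Finₚ.↑ˡ-injective rest _ _ e)) (neighbour-first k j))
      reached : ∀ i → 1 ℕ.≤ F (neighbour k i ↑ˡ rest)
      reached i with k Fin.≟ neighbour k i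
      ... | yes e = ℕₚ.≤-trans (ℕₚ.≤-reflexive (sym (trans (cong (λ l → δ (k ↑ˡ rest) (l ↑ˡ rest)) (sym e)) (δ-refl (k ↑ˡ rest))))) (ℕₚ.m≤m+n _ _)
      ... | no ne = ℕₚ.≤-trans (ℕₚ.≤-reflexive (sym (cong 𝟙 is-adjacent))) (ℕₚ.m≤n+m _ _)
        where
        is-adjacent : adj G (k ↑ˡ rest) (neighbour k i ↑ˡ rest) ≡ true
        is-adjacent = trans (cong₂ adjacent (Finₚ.splitAt-↑ˡ n₀ k rest) (Finₚ.splitAt-↑ˡ n₀ (neighbour k i) rest)) both
          where
          both : adjacent (inj₁ k) (inj₁ (neighbour k i)) ≡ true
          both with k Fin.≟ neighbour k i
          ... | yes e = ⊥-elim (ne e)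
          ... | no _  = neighbour-edge k i

    edge-bound : n₀ ℕ.* m ℕ.≤ n₀ ℕ.+ 2 ℕ.* numEdges G
    edge-bound = begin
      n₀ ℕ.* m ≡⟨ sym (∑-const n₀ m) ⟩
      ∑ {n₀} (λ _ → m) ≤⟨ ∑-mono degree-bound ⟩
      ∑ {n₀} (λ k → 1 ℕ.+ degree (k ↑ˡ rest)) ≡⟨ ∑-distrib-+ {n₀} (λ _ → 1) (λ k → degree (k ↑ˡ rest)) ⟩
      ∑ {n₀} (λ _ → 1) ℕ.+ ∑ (λ k → degree (k ↑ˡ rest))
        ≤⟨ ℕₚ.+-mono-≤ (ℕₚ.≤-reflexive (trans (∑-const n₀ 1) (ℕₚ.*-identityʳ n₀)))
                       (∑-injection (_↑ˡ rest) (λ i j → Finₚ.↑ˡ-injective rest i j) degree) ⟩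
      n₀ ℕ.+ ∑ degree ≡⟨ cong (n₀ ℕ.+_) (degree-sum G) ⟩
      n₀ ℕ.+ 2 ℕ.* numEdges G ∎
      where open ℕₚ.≤-Reasoning

-- Fitting the parameters to a given number of vertices.

module LowerBoundCount where

  open LowerBoundGraph
  open PrimesInIntervals using (floor-log; module NoPrimeGap)
  open import Data.Nat
  open import Data.Nat.Properties
  open import Data.Nat.DivMod using (m≡m%n+[m/n]*n; m%n<n; m/n*n≤m)
  open import Data.Nat.Primality using (Prime)
  open import Data.Nat.Tactic.RingSolver using (solve-∀)

  -- In the application d = 17², since p ≤ 17 m, and 2 + β = 64 = 4³, since m is a power of 4.
  module DenseGraph (d β : ℕ) .{{_ : NonZero d}}
    (d-spec : ∀ m → m * (17 * m * (17 * m)) ≡ d * (m * (m * m)))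
    (β-spec : ∀ i → (2 + β) ^ i ≡ 4 ^ i * (4 ^ i * 4 ^ i)) where

    scale : ∀ n → d * (2 + β) ^ 3 ≤ n → Σ ℕ λ i → 3 ≤ i × d * (2 + β) ^ i ≤ n × n ≤ d * (2 + β) ^ suc i
    scale n le = go (n / d) refl
      where
      open ≤-Reasoning
      go : ∀ q → n / d ≡ q → Σ ℕ λ i → 3 ≤ i × d * (2 + β) ^ i ≤ n × n ≤ d * (2 + β) ^ suc i
      go zero eq = ⊥-elim (<⇒≱ (begin-strict
        n ≡⟨ m≡m%n+[m/n]*n n d ⟩
        n % d + n / d * d ≡⟨ cong (λ q → n % d + q * d) eq ⟩
        n % d + 0 ≡⟨ +-identityʳ _ ⟩
        n % d <⟨ m%n<n n d ⟩
        d ≤⟨ m≤m*n d ((2 + β) ^ 3) {{m^n≢0 (2 + β) 3}} ⟩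
        d * (2 + β) ^ 3 ∎) le)
      go (suc q) eq with floor-log β q
      ... | i , lo , hi = i , three , lower , ≤-trans (<⇒≤ n<dq) (*-monoʳ-≤ d hi)
        where
        lower : d * (2 + β) ^ i ≤ n
        lower = begin
          d * (2 + β) ^ i ≤⟨ *-monoʳ-≤ d lo ⟩
          d * suc q ≡⟨ trans (*-comm d (suc q)) (cong (_* d) (sym eq)) ⟩
          n / d * d ≤⟨ m/n*n≤m n d ⟩
          n ∎
        n<dq : n < d * suc (suc q)
        n<dq = begin-strict
          n ≡⟨ m≡m%n+[m/n]*n n d ⟩
          n % d + n / d * d <⟨ +-monoˡ-< (n / d * d) (m%n<n n d) ⟩
          d + n / d * d ≡⟨ cong (λ q → d + q * d) eq ⟩
          d + suc q * d ≡⟨ *-comm (suc (suc q)) d ⟩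
          d * suc (suc q) ∎
        -- The threshold on `n` guarantees this; the prime is then sought with exponent `suc i`,
        -- which must be at least 4.
        three : 3 ≤ i
        three with 3 ≤? i
        ... | yes h = h
        ... | no h  = ⊥-elim (<⇒≱ n<dq (≤-trans (*-monoʳ-≤ d (≤-trans hi (^-monoʳ-≤ (2 + β) (≰⇒> h)))) le))

    -- With m = 4^i the prime lies above 4 m and is at most 16 m + 1 ≤ 17 m, so the m p² vertices
    -- fit into n ≥ d m³. There are at least m⁴ edges, while n ≤ d (2 + β) m³.
    dense-free-graph : ∀ n → d * (2 + β) ^ 3 ≤ n →
      Σ (SimpleGraph n) λ G → HFree G (subdivision (K 3 25)) × n ^ 4 ≤ (d * (2 + β)) ^ 4 * numEdges G ^ 3
    dense-free-graph n le = from-scale (scale n le)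
      where
      Goal : ℕ → Set
      Goal n = Σ (SimpleGraph n) λ G → HFree G (subdivision (K 3 25)) × n ^ 4 ≤ (d * (2 + β)) ^ 4 * numEdges G ^ 3
      from-prime : ∀ i → 3 ≤ i → d * (2 + β) ^ i ≤ n → n ≤ d * (2 + β) ^ suc i →
        (Σ ℕ λ p → Prime p × 4 ^ suc i < p × p ≤ suc ((4 ^ suc i + 4 ^ suc i) + (4 ^ suc i + 4 ^ suc i))) → Goal n
      from-prime i 3≤i lo hi (p , isPrime , 4m<p , p≤) =
        subst Goal (m+[n∸m]≡n n₀≤n) (AG.G , AG.hfree , subst (λ n → n ^ 4 ≤ (d * (2 + β)) ^ 4 * e ^ 3) (sym (m+[n∸m]≡n n₀≤n)) count)
        where
        open ≤-Reasoning
        m = 4 ^ i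
        p≤17m : p ≤ 17 * m
        p≤17m = ≤-trans p≤ (≤-trans (+-monoˡ-≤ _ (m^n>0 4 i)) (≤-reflexive (arith m)))
          where
          arith : ∀ m → m + ((4 * m + 4 * m) + (4 * m + 4 * m)) ≡ 17 * m
          arith = solve-∀
        n₀≤n : m * (p * p) ≤ n
        n₀≤n = begin
          m * (p * p) ≤⟨ *-monoʳ-≤ m (*-mono-≤ p≤17m p≤17m) ⟩
          m * (17 * m * (17 * m)) ≡⟨ d-spec m ⟩
          d * (m * (m * m)) ≡⟨ cong (d *_) (sym (β-spec i)) ⟩
          d * (2 + β) ^ i ≤⟨ lo ⟩
          n ∎
        module AG = AlgebraicGraph p isPrime m 4m<p (n ∸ m * (p * p))
        e = numEdges AG.G
        n₀ = m * (p * p)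
        2≤m : 2 ≤ m
        2≤m = ≤-trans (s≤s (s≤s z≤n)) (^-monoʳ-≤ 4 {1} {i} (≤-trans (s≤s z≤n) 3≤i))
        -- The possible loops in `edge-bound` cost `n₀`, at most half of `n₀ * m`.
        n₀m≤4e : n₀ * m ≤ 4 * e
        n₀m≤4e = +-cancelˡ-≤ (n₀ * m) _ _ (begin
          n₀ * m + n₀ * m ≤⟨ +-mono-≤ AG.edge-bound AG.edge-bound ⟩
          (n₀ + 2 * e) + (n₀ + 2 * e) ≡⟨ arith n₀ e ⟩
          n₀ * 2 + 4 * e ≤⟨ +-monoˡ-≤ (4 * e) (*-monoʳ-≤ n₀ 2≤m) ⟩
          n₀ * m + 4 * e ∎)
          where
          arith : ∀ n e → (n + 2 * e) + (n + 2 * e) ≡ n * 2 + 4 * e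
          arith = solve-∀
        m⁴≤e : m * (m * (m * m)) ≤ e
        m⁴≤e = *-cancelˡ-≤ 4 (begin
          4 * (m * (m * (m * m))) ≤⟨ m≤m+n _ (12 * (m * (m * (m * m)))) ⟩
          4 * (m * (m * (m * m))) + 12 * (m * (m * (m * m))) ≡⟨ arith m ⟩
          m * (4 * m * (4 * m)) * m ≤⟨ *-monoˡ-≤ m (*-monoʳ-≤ m (*-mono-≤ (<⇒≤ 4m<p) (<⇒≤ 4m<p))) ⟩
          n₀ * m ≤⟨ n₀m≤4e ⟩
          4 * e ∎)
          where
          arith : ∀ m → 4 * (m * (m * (m * m))) + 12 * (m * (m * (m * m))) ≡ m * (4 * m * (4 * m)) * m
          arith = solve-∀
        n≤ : n ≤ d * (2 + β) * (m * (m * m))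
        n≤ = ≤-trans hi (≤-reflexive (trans (sym (*-assoc d (2 + β) ((2 + β) ^ i))) (cong (d * (2 + β) *_) (β-spec i))))
        count : n ^ 4 ≤ (d * (2 + β)) ^ 4 * e ^ 3
        count = begin
          n ^ 4 ≤⟨ ^-monoˡ-≤ 4 n≤ ⟩
          (d * (2 + β) * (m * (m * m))) ^ 4 ≡⟨ arith (d * (2 + β)) m ⟩
          (d * (2 + β)) ^ 4 * (m * (m * (m * m))) ^ 3 ≤⟨ *-monoʳ-≤ ((d * (2 + β)) ^ 4) (^-monoˡ-≤ 3 m⁴≤e) ⟩
          (d * (2 + β)) ^ 4 * e ^ 3 ∎
          where
          unfolded : ∀ k m → k * (m * (m * m)) * (k * (m * (m * m)) * (k * (m * (m * m)) * (k * (m * (m * m)) * 1))) ≡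
            k * (k * (k * (k * 1))) * (m * (m * (m * m)) * (m * (m * (m * m)) * (m * (m * (m * m)) * 1)))
          unfolded = solve-∀
          arith : ∀ k m → (k * (m * (m * m))) ^ 4 ≡ k ^ 4 * (m * (m * (m * m))) ^ 3
          arith k m = unfolded k m
      from-scale : (Σ ℕ λ i → 3 ≤ i × d * (2 + β) ^ i ≤ n × n ≤ d * (2 + β) ^ suc i) → Goal n
      from-scale (i , 3≤i , lo , hi) = from-prime i 3≤i lo hi (NoPrimeGap.prime-in-interval (suc i) (s≤s 3≤i))

-- The upper bound: lists of used vertices and counting tools.

module UpperBoundProof where

  open FiniteSums
  open import Data.Nat hiding (_≟_)
  open import Data.Nat.Properties hiding (_≟_)
  open import Data.Nat.DivMod using (m≡m%n+[m/n]*n; m%n<n; m/n*n≤m)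
  open import Data.Nat.Induction using (<-rec)
  open import Data.Nat.Tactic.RingSolver using (solve-∀)
  open import Data.Bool using (Bool; true; false; _∧_; _∨_; not) renaming (T to True)
  open import Data.Fin using (Fin; zero; suc; _≟_)
  open import Data.Fin.Patterns using (0F; 1F; 2F; 3F)
  open import Data.List using (List; []; _∷_; length)
  open import Data.List.Membership.Propositional using (_∈_; _∉_)
  open import Data.List.Relation.Unary.Any using (here; there)
  open import Data.List.Relation.Unary.All as All using (All; []; _∷_)
  open import Data.List.Relation.Unary.AllPairs as AllPairs using (AllPairs; []; _∷_)

  ι : ∀ {n} → List (Fin n) → Fin n → ℕ
  ι []      v = 0
  ι (w ∷ F) v = δ w v + ι F v

  ∑-ι : ∀ {n} (F : List (Fin n)) → ∑ (ι F) ≡ length F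
  ∑-ι {n} []  = ∑-zero n
  ∑-ι (w ∷ F) = trans (∑-distrib-+ (δ w) (ι F)) (cong₂ _+_ (∑-δ-1 w) (∑-ι F))

  ∈⇒ι-positive : ∀ {n} {F : List (Fin n)} {v} → v ∈ F → 0 < ι F v
  ∈⇒ι-positive {v = v} (here refl) = ≤-trans (≤-reflexive (sym (δ-refl v))) (m≤m+n _ _)
  ∈⇒ι-positive {F = w ∷ F} {v} (there h) = ≤-trans (∈⇒ι-positive h) (m≤n+m _ (δ w v))

  ι-positive⇒∈ : ∀ {n} (F : List (Fin n)) {v} → 0 < ι F v → v ∈ F
  ι-positive⇒∈ (w ∷ F) {v} lt with w ≟ v
  ... | yes refl = here refl
  ... | no _     = there (ι-positive⇒∈ F lt)

  ι-zero⇒∉ : ∀ {n} {F : List (Fin n)} {v} → ι F v ≡ 0 → v ∉ F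
  ι-zero⇒∉ e h = <⇒≱ (∈⇒ι-positive h) (≤-reflexive e)

  ι-unique : ∀ {n} {F : List (Fin n)} → AllPairs _≢_ F → ∀ v → ι F v ≤ 1
  ι-unique [] v = z≤n
  ι-unique {F = w ∷ F} (h ∷ hs) v with w ≟ v
  ... | no _     = ι-unique hs v
  ... | yes refl = ≤-reflexive (cong suc (absent F h))
    where
    absent : ∀ F → All (w ≢_) F → ι F w ≡ 0
    absent [] [] = refl
    absent (u ∷ F) (ne ∷ nes) = cong₂ _+_ (δ-≢ (ne ∘ sym)) (absent F nes)

  fresh-element : ∀ {n} (C F : List (Fin n)) → AllPairs _≢_ C → length F < length C → Σ (Fin n) λ v → v ∈ C × v ∉ F
  fresh-element C F u lt with ∑-witness (ι C) (ι F) (subst₂ _<_ (sym (∑-ι F)) (sym (∑-ι C)) lt)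
  ... | v , h = v , ι-positive⇒∈ C (≤-trans (s≤s z≤n) h) , ι-zero⇒∉ (n≤0⇒n≡0 (≤-pred (≤-trans h (ι-unique u v))))

  -- Greedy embedding of the subdivided graph.

  module Embedding {N : ℕ} (G : SimpleGraph N) where

    V : Set
    V = Fin N

    Conf : Set
    Conf = Fin 4 → V

    record Valid (x : Fin 3 → V) (c : Conf) : Set where
      field
        x-adj : ∀ i → adj G (x i) (c (suc i)) ≡ true
        z-adj : ∀ i → adj G (c zero) (c (suc i)) ≡ true
        distinct : ∀ k l → c k ≡ c l → k ≡ l
    open Valid

    -- The list of used vertices starts with the three roots, so the single avoidance condition
    -- separates a new configuration both from the earlier ones and from the roots.
    data Family (x : Fin 3 → V) : ℕ → List V → Set where
      nil  : Family x 0 (x 0F ∷ x 1F ∷ x 2F ∷ [])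
      cons : ∀ {k F} c → Valid x c → (∀ l → c l ∉ F) → Family x k F →
             Family x (suc k) (c 0F ∷ c 1F ∷ c 2F ∷ c 3F ∷ F)

    module _ {x : Fin 3 → V} where

      family-length : ∀ {k F} → Family x k F → length F ≡ 3 + k * 4
      family-length nil = refl
      family-length (cons c v a fam) = cong (4 +_) (family-length fam)

      conf : ∀ {k F} → Family x k F → Fin k → Conf
      conf (cons c v a fam) zero    = c
      conf (cons c v a fam) (suc j) = conf fam j

      conf-valid : ∀ {k F} (fam : Family x k F) j → Valid x (conf fam j)
      conf-valid (cons c v a fam) zero    = v
      conf-valid (cons c v a fam) (suc j) = conf-valid fam j

      there⁴ : ∀ {v a b c d : V} {F} → v ∈ F → v ∈ a ∷ b ∷ c ∷ d ∷ F
      there⁴ = there ∘ there ∘ there ∘ there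

      conf-∈ : ∀ {k F} (fam : Family x k F) j l → conf fam j l ∈ F
      conf-∈ (cons c v a fam) zero 0F = here refl
      conf-∈ (cons c v a fam) zero 1F = there (here refl)
      conf-∈ (cons c v a fam) zero 2F = there (there (here refl))
      conf-∈ (cons c v a fam) zero 3F = there (there (there (here refl)))
      conf-∈ (cons c v a fam) (suc j) l = there⁴ (conf-∈ fam j l)

      x-∈ : ∀ {k F} → Family x k F → ∀ i → x i ∈ F
      x-∈ nil 0F = here refl
      x-∈ nil 1F = there (here refl)
      x-∈ nil 2F = there (there (here refl))
      x-∈ (cons c v a fam) i = there⁴ (x-∈ fam i)

      conf-≢-x : ∀ {k F} (fam : Family x k F) j l i → conf fam j l ≢ x i
      conf-≢-x (cons c v a fam) zero    l i e = a l (subst (_∈ _) (sym e) (x-∈ fam i))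
      conf-≢-x (cons c v a fam) (suc j) l i e = conf-≢-x fam j l i e

      conf-injective : ∀ {k F} (fam : Family x k F) j j′ l l′ → conf fam j l ≡ conf fam j′ l′ → j ≡ j′ × l ≡ l′
      conf-injective (cons c v a fam) zero    zero     l l′ e = refl , distinct v l l′ e
      conf-injective (cons c v a fam) zero    (suc j′) l l′ e = ⊥-elim (a l (subst (_∈ _) (sym e) (conf-∈ fam j′ l′)))
      conf-injective (cons c v a fam) (suc j) zero     l l′ e = ⊥-elim (a l′ (subst (_∈ _) e (conf-∈ fam j l)))
      conf-injective (cons c v a fam) (suc j) (suc j′) l l′ e with conf-injective fam j j′ l l′ e
      ... | refl , e′ = refl , e′

    family⇒contains : ∀ {x F} → (∀ i j → x i ≡ x j → i ≡ j) → Family x 25 F → Contains G (subdivision (K 3 25))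
    family⇒contains {x} x-inj fam = f , (λ {u} {v} → injective u v) , hom
      where
      f : Vert (subdivision (K 3 25)) → V
      f (inj₁ (inj₁ i)) = x i
      f (inj₁ (inj₂ j)) = conf fam j zero
      f (inj₂ (i , j))  = conf fam j (suc i)
      injective : ∀ u v → f u ≡ f v → u ≡ v
      injective (inj₁ (inj₁ i)) (inj₁ (inj₁ i′)) e = cong (inj₁ ∘ inj₁) (x-inj i i′ e)
      injective (inj₁ (inj₁ i)) (inj₁ (inj₂ j′)) e = ⊥-elim (conf-≢-x fam j′ _ i (sym e))
      injective (inj₁ (inj₁ i)) (inj₂ (i′ , j′)) e = ⊥-elim (conf-≢-x fam j′ _ i (sym e))
      injective (inj₁ (inj₂ j)) (inj₁ (inj₁ i′)) e = ⊥-elim (conf-≢-x fam j _ i′ e)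
      injective (inj₂ (i , j))  (inj₁ (inj₁ i′)) e = ⊥-elim (conf-≢-x fam j _ i′ e)
      injective (inj₁ (inj₂ j)) (inj₁ (inj₂ j′)) e with conf-injective fam j j′ _ _ e
      ... | refl , _ = refl
      injective (inj₁ (inj₂ j)) (inj₂ (i′ , j′)) e with conf-injective fam j j′ _ _ e
      ... | _ , ()
      injective (inj₂ (i , j)) (inj₁ (inj₂ j′)) e with conf-injective fam j j′ _ _ e
      ... | _ , ()
      injective (inj₂ (i , j)) (inj₂ (i′ , j′)) e with conf-injective fam j j′ _ _ e
      ... | refl , refl = refl
      hom : ∀ u v → PAdj (subdivision (K 3 25)) u v → adj G (f u) (f v) ≡ true
      hom _ _ (inj₁ (i , j) , inj₁ (refl , refl)) = x-adj (conf-valid fam j) i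
      hom _ _ (inj₁ (i , j) , inj₂ (refl , refl)) = trans (symm G _ _) (x-adj (conf-valid fam j) i)
      hom _ _ (inj₂ (i , j) , inj₁ (refl , refl)) = trans (symm G _ _) (z-adj (conf-valid fam j) i)
      hom _ _ (inj₂ (i , j) , inj₂ (refl , refl)) = z-adj (conf-valid fam j) i

    -- When the last of the 25 configurations is chosen, 3 + 24 * 4 = 99 vertices are in use.
    greedy : ∀ {x} → (∀ i j → x i ≡ x j → i ≡ j) →
      (∀ F → length F ≤ 99 → Σ Conf λ c → Valid x c × (∀ l → c l ∉ F)) → Contains G (subdivision (K 3 25))
    greedy {x} x-inj extend = family⇒contains x-inj (proj₂ (build 25 ≤-refl))
      where
      build : ∀ k → k ≤ 25 → Σ (List V) (Family x k)
      build zero _ = _ , nil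
      build (suc k) k<25 with build k (≤-trans (n≤1+n k) k<25)
      ... | F , fam with extend F (subst (_≤ 99) (sym (family-length fam)) (+-monoʳ-≤ 3 (*-monoˡ-≤ 4 (≤-pred k<25))))
      ...   | c , valid , avoid = _ , cons c valid avoid fam

    three : V → V → V → Fin 3 → V
    three x₁ x₂ x₃ 0F = x₁
    three x₁ x₂ x₃ 1F = x₂
    three x₁ x₂ x₃ 2F = x₃

    three-injective : ∀ {x₁ x₂ x₃} → x₁ ≢ x₂ → x₁ ≢ x₃ → x₂ ≢ x₃ → ∀ i j → three x₁ x₂ x₃ i ≡ three x₁ x₂ x₃ j → i ≡ j
    three-injective n₁₂ n₁₃ n₂₃ 0F 0F e = refl
    three-injective n₁₂ n₁₃ n₂₃ 0F 1F e = ⊥-elim (n₁₂ e)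
    three-injective n₁₂ n₁₃ n₂₃ 0F 2F e = ⊥-elim (n₁₃ e)
    three-injective n₁₂ n₁₃ n₂₃ 1F 0F e = ⊥-elim (n₁₂ (sym e))
    three-injective n₁₂ n₁₃ n₂₃ 1F 1F e = refl
    three-injective n₁₂ n₁₃ n₂₃ 1F 2F e = ⊥-elim (n₂₃ e)
    three-injective n₁₂ n₁₃ n₂₃ 2F 0F e = ⊥-elim (n₁₃ (sym e))
    three-injective n₁₂ n₁₃ n₂₃ 2F 1F e = ⊥-elim (n₂₃ (sym e))
    three-injective n₁₂ n₁₃ n₂₃ 2F 2F e = refl

    four : V → V → V → V → Conf
    four z y₁ y₂ y₃ zero    = z
    four z y₁ y₂ y₃ (suc i) = three y₁ y₂ y₃ i

    four-valid : ∀ {x₁ x₂ x₃ z y₁ y₂ y₃} → y₁ ≢ y₂ → y₁ ≢ y₃ → y₂ ≢ y₃ →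
      adj G x₁ y₁ ≡ true → adj G x₂ y₂ ≡ true → adj G x₃ y₃ ≡ true →
      adj G z y₁ ≡ true → adj G z y₂ ≡ true → adj G z y₃ ≡ true → Valid (three x₁ x₂ x₃) (four z y₁ y₂ y₃)
    four-valid {z = z} {y₁} {y₂} {y₃} n₁₂ n₁₃ n₂₃ a₁ a₂ a₃ b₁ b₂ b₃ = record
      { x-adj = λ { 0F → a₁ ; 1F → a₂ ; 2F → a₃ } ; z-adj = zs
      ; distinct = λ { zero zero _ → refl ; zero (suc i) e → ⊥-elim (z≢y i e) ; (suc i) zero e → ⊥-elim (z≢y i (sym e))
                     ; (suc i) (suc j) e → cong suc (three-injective n₁₂ n₁₃ n₂₃ i j e) } }
      where
      zs : ∀ i → adj G z (three y₁ y₂ y₃ i) ≡ true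
      zs 0F = b₁
      zs 1F = b₂
      zs 2F = b₃
      z≢y : ∀ i → z ≢ three y₁ y₂ y₃ i
      z≢y i e with trans (sym (zs i)) (trans (cong (adj G z) (sym e)) (irrefl G z))
      ... | ()

    four-avoids : ∀ {z y₁ y₂ y₃ F} → z ∉ F → y₁ ∉ F → y₂ ∉ F → y₃ ∉ F → ∀ l → four z y₁ y₂ y₃ l ∉ F
    four-avoids z∉ y₁∉ y₂∉ y₃∉ 0F = z∉
    four-avoids z∉ y₁∉ y₂∉ y₃∉ 1F = y₁∉
    four-avoids z∉ y₁∉ y₂∉ y₃∉ 2F = y₂∉
    four-avoids z∉ y₁∉ y₂∉ y₃∉ 3F = y₃∉

    ∑⁴ : (V → V → V → V → ℕ) → ℕ
    ∑⁴ g = ∑ λ z → ∑ λ y₁ → ∑ λ y₂ → ∑ λ y₃ → g z y₁ y₂ y₃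

    ∑⁴-cong : ∀ {f g} → (∀ z y₁ y₂ y₃ → f z y₁ y₂ y₃ ≡ g z y₁ y₂ y₃) → ∑⁴ f ≡ ∑⁴ g
    ∑⁴-cong h = ∑-cong λ z → ∑-cong λ y₁ → ∑-cong λ y₂ → ∑-cong λ y₃ → h z y₁ y₂ y₃

    ∑⁴-mono : ∀ {f g} → (∀ z y₁ y₂ y₃ → f z y₁ y₂ y₃ ≤ g z y₁ y₂ y₃) → ∑⁴ f ≤ ∑⁴ g
    ∑⁴-mono h = ∑-mono λ z → ∑-mono λ y₁ → ∑-mono λ y₂ → ∑-mono λ y₃ → h z y₁ y₂ y₃

    ∑⁴-+ : ∀ f g → ∑⁴ (λ z y₁ y₂ y₃ → f z y₁ y₂ y₃ + g z y₁ y₂ y₃) ≡ ∑⁴ f + ∑⁴ g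
    ∑⁴-+ f g = trans (∑-cong λ z → trans (∑-cong λ y₁ → trans (∑-cong λ y₂ → ∑-distrib-+ (f z y₁ y₂) (g z y₁ y₂))
      (∑-distrib-+ (λ y₂ → ∑ (f z y₁ y₂)) (λ y₂ → ∑ (g z y₁ y₂))))
      (∑-distrib-+ (λ y₁ → ∑ λ y₂ → ∑ (f z y₁ y₂)) (λ y₁ → ∑ λ y₂ → ∑ (g z y₁ y₂))))
      (∑-distrib-+ (λ z → ∑ λ y₁ → ∑ λ y₂ → ∑ (f z y₁ y₂)) (λ z → ∑ λ y₁ → ∑ λ y₂ → ∑ (g z y₁ y₂)))

    ∑⁴-zero : ∑⁴ (λ _ _ _ _ → 0) ≡ 0
    ∑⁴-zero = trans (∑-cong {N} λ _ → trans (∑-cong {N} λ _ → trans (∑-cong {N} λ _ → ∑-zero N) (∑-zero N)) (∑-zero N)) (∑-zero N)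

    ∑⁴-witness : ∀ f g → ∑⁴ g < ∑⁴ f → Σ V λ z → Σ V λ y₁ → Σ V λ y₂ → Σ V λ y₃ → g z y₁ y₂ y₃ < f z y₁ y₂ y₃
    ∑⁴-witness f g lt with ∑-witness _ _ lt
    ... | z , lt₁ with ∑-witness _ _ lt₁
    ...   | y₁ , lt₂ with ∑-witness _ _ lt₂
    ...     | y₂ , lt₃ with ∑-witness _ _ lt₃
    ...       | y₃ , lt₄ = z , y₁ , y₂ , y₃ , lt₄

    -- A maximal disjoint subfamily of the configurations marked by w has at most 24 members, so it meets
    -- every marked configuration in one of at most 99 vertices.
    few-configurations : ¬ Contains G (subdivision (K 3 25)) →
      ∀ {x₁ x₂ x₃} → x₁ ≢ x₂ → x₁ ≢ x₃ → x₂ ≢ x₃ →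
      (w : V → V → V → V → Bool) →
      (∀ {z y₁ y₂ y₃} → w z y₁ y₂ y₃ ≡ true → Valid (three x₁ x₂ x₃) (four z y₁ y₂ y₃)) →
      ∀ m₀ m₁ → (∀ v → ∑⁴ (λ z y₁ y₂ y₃ → 𝟙 (w z y₁ y₂ y₃) * δ v z) ≤ m₀) →
      (∀ v → ∑⁴ (λ z y₁ y₂ y₃ → 𝟙 (w z y₁ y₂ y₃) * δ v y₁) ≤ m₁) →
      (∀ v → ∑⁴ (λ z y₁ y₂ y₃ → 𝟙 (w z y₁ y₂ y₃) * δ v y₂) ≤ m₁) →
      (∀ v → ∑⁴ (λ z y₁ y₂ y₃ → 𝟙 (w z y₁ y₂ y₃) * δ v y₃) ≤ m₁) →
      ∑⁴ (λ z y₁ y₂ y₃ → 𝟙 (w z y₁ y₂ y₃)) ≤ 99 * (m₀ + 3 * m₁)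
    few-configurations free {x₁} {x₂} {x₃} n₁₂ n₁₃ n₂₃ w valid m₀ m₁ b₀ b₁ b₂ b₃
      with ∑⁴ (λ z y₁ y₂ y₃ → 𝟙 (w z y₁ y₂ y₃)) ≤? 99 * (m₀ + 3 * m₁)
    ... | yes le = le
    ... | no nle = ⊥-elim (free (greedy (three-injective n₁₂ n₁₃ n₂₃) extend))
      where
      hits : List V → V → V → V → V → ℕ
      hits F z y₁ y₂ y₃ = 𝟙 (w z y₁ y₂ y₃) * (ι F z + (ι F y₁ + (ι F y₂ + ι F y₃)))
      hit-bound : ∀ F → ∑⁴ (hits F) ≤ length F * (m₀ + 3 * m₁)
      hit-bound [] = ≤-reflexive (trans (∑⁴-cong λ z y₁ y₂ y₃ → *-zeroʳ (𝟙 (w z y₁ y₂ y₃))) ∑⁴-zero)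
      hit-bound (v ∷ F) = begin
        ∑⁴ (hits (v ∷ F)) ≡⟨ ∑⁴-cong (λ z y₁ y₂ y₃ → expand (𝟙 (w z y₁ y₂ y₃)) (δ v z) (δ v y₁) (δ v y₂) (δ v y₃) (ι F z) (ι F y₁) (ι F y₂) (ι F y₃)) ⟩
        ∑⁴ (λ z y₁ y₂ y₃ → (h₀ z y₁ y₂ y₃ + (h₁ z y₁ y₂ y₃ + (h₂ z y₁ y₂ y₃ + h₃ z y₁ y₂ y₃))) + hits F z y₁ y₂ y₃)
          ≡⟨ trans (∑⁴-+ _ (hits F)) (cong (_+ ∑⁴ (hits F)) (trans (∑⁴-+ h₀ _) (cong (∑⁴ h₀ +_) (trans (∑⁴-+ h₁ _) (cong (∑⁴ h₁ +_) (∑⁴-+ h₂ h₃)))))) ⟩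
        (∑⁴ h₀ + (∑⁴ h₁ + (∑⁴ h₂ + ∑⁴ h₃))) + ∑⁴ (hits F)
          ≤⟨ +-mono-≤ (+-mono-≤ (b₀ v) (+-mono-≤ (b₁ v) (+-mono-≤ (b₂ v) (b₃ v)))) (hit-bound F) ⟩
        (m₀ + (m₁ + (m₁ + m₁))) + length F * (m₀ + 3 * m₁) ≡⟨ cong (λ t → (m₀ + (m₁ + (m₁ + t))) + length F * (m₀ + 3 * m₁)) (sym (+-identityʳ m₁)) ⟩
        suc (length F) * (m₀ + 3 * m₁) ∎
        where
        open ≤-Reasoning
        h₀ h₁ h₂ h₃ : V → V → V → V → ℕ
        h₀ z y₁ y₂ y₃ = 𝟙 (w z y₁ y₂ y₃) * δ v z
        h₁ z y₁ y₂ y₃ = 𝟙 (w z y₁ y₂ y₃) * δ v y₁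
        h₂ z y₁ y₂ y₃ = 𝟙 (w z y₁ y₂ y₃) * δ v y₂
        h₃ z y₁ y₂ y₃ = 𝟙 (w z y₁ y₂ y₃) * δ v y₃
        expand : ∀ w a b c d a′ b′ c′ d′ → w * ((a + a′) + ((b + b′) + ((c + c′) + (d + d′)))) ≡
          (w * a + (w * b + (w * c + w * d))) + w * (a′ + (b′ + (c′ + d′)))
        expand = solve-∀
      extend : ∀ F → length F ≤ 99 → Σ Conf λ c → Valid (three x₁ x₂ x₃) c × (∀ l → c l ∉ F)
      -- There are more marked configurations than hits on `F`, so some marked one has no hit and
      -- avoids `F` altogether.
      extend F len with ∑⁴-witness (λ z y₁ y₂ y₃ → 𝟙 (w z y₁ y₂ y₃)) (hits F)
                          (≤-<-trans (≤-trans (hit-bound F) (*-monoˡ-≤ (m₀ + 3 * m₁) len)) (≰⇒> nle))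
      ... | z , y₁ , y₂ , y₃ , lt = four z y₁ y₂ y₃ , valid (𝟙-true (≤-trans (s≤s z≤n) lt)) ,
            four-avoids (ι-zero⇒∉ (m+n≡0⇒m≡0 _ total≡0)) (ι-zero⇒∉ (m+n≡0⇒m≡0 _ rest₁)) (ι-zero⇒∉ (m+n≡0⇒m≡0 _ rest₂)) (ι-zero⇒∉ (m+n≡0⇒n≡0 (ι F y₂) rest₂))
        where
        total≡0 = 𝟙*<𝟙⇒≡0 (w z y₁ y₂ y₃) _ lt
        rest₁ = m+n≡0⇒n≡0 (ι F z) total≡0
        rest₂ = m+n≡0⇒n≡0 (ι F y₁) rest₁

  ∧-true : ∀ a {b} → a ∧ b ≡ true → a ≡ true × b ≡ true
  ∧-true true h = refl , h

  does-false : ∀ {n} (i j : Fin n) → not (does (i ≟ j)) ≡ true → i ≢ j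
  does-false i j h e with i ≟ j
  does-false i j () e | yes _
  ... | no ne = ne e

  true≢false : true ≢ false
  true≢false ()

  argmin : ∀ {n} (P : Fin n → Bool) (f : Fin n → ℕ) →
    (∀ i → P i ≡ false) ⊎ Σ (Fin n) λ i → P i ≡ true × (∀ j → P j ≡ true → f i ≤ f j)
  argmin {zero} P f = inj₁ λ ()
  argmin {suc n} P f with P zero in eq | argmin (P ∘ suc) (f ∘ suc)
  ... | false | inj₁ none = inj₁ λ { zero → eq ; (suc i) → none i }
  ... | false | inj₂ (i , pi , min) = inj₂ (suc i , pi , λ { zero h → ⊥-elim (true≢false (trans (sym h) eq)) ; (suc j) h → min j h })
  ... | true | inj₁ none = inj₂ (zero , eq , λ { zero _ → ≤-refl ; (suc j) h → ⊥-elim (true≢false (trans (sym h) (none j))) })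
  ... | true | inj₂ (i , pi , min) with f zero ≤? f (suc i)
  ...   | yes le = inj₂ (zero , eq , λ { zero _ → ≤-refl ; (suc j) h → ≤-trans le (min j h) })
  ...   | no nle = inj₂ (suc i , pi , λ { zero _ → <⇒≤ (≰⇒> nle) ; (suc j) h → min j h })

  -- Turán's theorem in terms of non-adjacent ordered pairs.

  module Turan {N : ℕ} (R : Fin N → Fin N → Bool) where

    V : Set
    V = Fin N

    non-degree : (V → Bool) → V → ℕ
    non-degree s x = ∑ λ z → 𝟙 (s z) * 𝟙 (not (R x z))

    non-edges : (V → Bool) → ℕ
    non-edges s = ∑ λ x → 𝟙 (s x) * non-degree s x

    Clique : ℕ → (V → Bool) → Set
    Clique k s = Σ (List V) λ C → length C ≡ k × All (λ v → s v ≡ true) C × AllPairs (λ u v → R u v ≡ true) C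

    -- Induction through a vertex `v` with the fewest non-neighbours, say m. A clique among its D
    -- neighbours extends by `v`. Otherwise D² ≤ r n′, and each of the m other vertices has at least
    -- m non-neighbours, so `non-edges s` is at least n′ + m².
    turan : ∀ r s → ∑ (𝟙 ∘ s) * ∑ (𝟙 ∘ s) ≤ r * non-edges s ⊎ Clique (suc r) s
    step : ∀ r s v → s v ≡ true → (∀ u → s u ≡ true → non-degree s v ≤ non-degree s u) →
      ∑ (𝟙 ∘ s) * ∑ (𝟙 ∘ s) ≤ suc r * non-edges s ⊎ Clique (suc (suc r)) s

    turan zero s with argmin s (λ _ → 0)
    ... | inj₁ none = inj₁ (≤-reflexive (cong (λ t → t * t) (trans (∑-cong λ i → cong 𝟙 (none i)) (∑-zero N))))
    ... | inj₂ (v , sv , _) = inj₂ (v ∷ [] , refl , sv ∷ [] , [] ∷ [])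
    turan (suc r) s with argmin s (non-degree s)
    ... | inj₁ none = inj₁ (subst (_≤ suc r * non-edges s) (sym (cong (λ t → t * t) (trans (∑-cong λ i → cong 𝟙 (none i)) (∑-zero N)))) z≤n)
    ... | inj₂ (v , sv , min) = step r s v sv min

    step r s v sv min = [ (λ h → inj₁ (bound h)) , (λ { (C , len , inC , clique) → inj₂ (v ∷ C , cong suc len ,
        sv ∷ All.map (λ {u} h → proj₁ (∧-true (s u) h)) inC , All.map (λ {u} h → proj₂ (∧-true (s u) h)) inC ∷ clique) }) ]′ (turan r s′)
      where
      open ≤-Reasoning
      s′ : V → Bool
      s′ x = s x ∧ R v x
      D m n′ : ℕ
      D = ∑ (𝟙 ∘ s′)
      m = non-degree s v
      n′ = non-edges s′
      split : ∀ a b → 𝟙 a ≡ 𝟙 (a ∧ b) + 𝟙 a * 𝟙 (not b)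
      split false b     = refl
      split true  true  = refl
      split true  false = refl
      size : ∑ (𝟙 ∘ s) ≡ D + m
      size = trans (∑-cong λ x → split (s x) (R v x)) (∑-distrib-+ (𝟙 ∘ s′) (λ x → 𝟙 (s x) * 𝟙 (not (R v x))))
      weaken : ∀ a b c → 𝟙 (a ∧ b) * c ≤ 𝟙 a * c
      weaken true true c = ≤-refl
      weaken true false c = z≤n
      weaken false b c = z≤n
      lower : n′ + m * m ≤ non-edges s
      lower = begin
        n′ + m * m ≡⟨ cong (n′ +_) (sym (∑-*ʳ m (λ x → 𝟙 (s x) * 𝟙 (not (R v x))))) ⟩
        n′ + ∑ (λ x → 𝟙 (s x) * 𝟙 (not (R v x)) * m) ≡⟨ sym (∑-distrib-+ (λ x → 𝟙 (s′ x) * non-degree s′ x) (λ x → 𝟙 (s x) * 𝟙 (not (R v x)) * m)) ⟩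
        ∑ (λ x → 𝟙 (s′ x) * non-degree s′ x + 𝟙 (s x) * 𝟙 (not (R v x)) * m) ≤⟨ ∑-mono pointwise ⟩
        non-edges s ∎
        where
        pointwise : ∀ x → 𝟙 (s′ x) * non-degree s′ x + 𝟙 (s x) * 𝟙 (not (R v x)) * m ≤ 𝟙 (s x) * non-degree s x
        pointwise x = begin
          𝟙 (s′ x) * non-degree s′ x + 𝟙 (s x) * 𝟙 (not (R v x)) * m
            ≤⟨ +-mono-≤ (*-monoʳ-≤ (𝟙 (s′ x)) (∑-mono λ z → weaken (s z) (R v z) (𝟙 (not (R x z))))) (minimal (s x) (𝟙 (not (R v x))) (min x)) ⟩
          𝟙 (s′ x) * non-degree s x + 𝟙 (s x) * 𝟙 (not (R v x)) * non-degree s x ≡⟨ sym (*-distribʳ-+ (non-degree s x) (𝟙 (s′ x)) (𝟙 (s x) * 𝟙 (not (R v x)))) ⟩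
          (𝟙 (s′ x) + 𝟙 (s x) * 𝟙 (not (R v x))) * non-degree s x ≡⟨ cong (_* non-degree s x) (sym (split (s x) (R v x))) ⟩
          𝟙 (s x) * non-degree s x ∎
          where
          minimal : ∀ b c → (b ≡ true → m ≤ non-degree s x) → 𝟙 b * c * m ≤ 𝟙 b * c * non-degree s x
          minimal true c h = *-monoʳ-≤ (1 * c) (h refl)
          minimal false c h = z≤n
      -- After multiplication by r the mixed term is 2 D (r m) ≤ D² + (r m)².
      arithmetic : ∀ r D m n → D * D ≤ r * n → (D + m) * (D + m) ≤ suc r * (n + m * m)
      arithmetic zero zero m n h = subst (m * m ≤_) (sym (*-identityˡ (n + m * m))) (m≤n+m (m * m) n)
      arithmetic r@(suc _) D m n h = *-cancelˡ-≤ r (begin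
        r * ((D + m) * (D + m)) ≡⟨ id₁ r D m ⟩
        r * (D * D) + 2 * (D * (r * m)) + r * (m * m) ≤⟨ +-monoˡ-≤ (r * (m * m)) (+-monoʳ-≤ (r * (D * D)) (2*≤sq+sq D (r * m))) ⟩
        r * (D * D) + (D * D + r * m * (r * m)) + r * (m * m) ≡⟨ id₂ r D m ⟩
        suc r * (D * D + r * (m * m)) ≤⟨ *-monoʳ-≤ (suc r) (+-monoˡ-≤ (r * (m * m)) h) ⟩
        suc r * (r * n + r * (m * m)) ≡⟨ id₃ r n m ⟩
        r * (suc r * (n + m * m)) ∎)
        where
        id₁ : ∀ r D m → r * ((D + m) * (D + m)) ≡ r * (D * D) + 2 * (D * (r * m)) + r * (m * m)
        id₁ = solve-∀
        id₂ : ∀ r D m → r * (D * D) + (D * D + r * m * (r * m)) + r * (m * m) ≡ suc r * (D * D + r * (m * m))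
        id₂ = solve-∀
        id₃ : ∀ r n m → suc r * (r * n + r * (m * m)) ≡ r * (suc r * (n + m * m))
        id₃ = solve-∀
      bound : D * D ≤ r * n′ → ∑ (𝟙 ∘ s) * ∑ (𝟙 ∘ s) ≤ suc r * non-edges s
      bound h = ≤-trans (≤-reflexive (cong (λ t → t * t) size)) (≤-trans (arithmetic r D m n′ h) (*-monoʳ-≤ (suc r) lower))

  -- H is the codegree from which a pair counts as heavy; 102 = 99 + 3 is what the greedy embedding needs.
  module Cherries {N : ℕ} (G : SimpleGraph N) (free : HFree G (subdivision (K 3 25)))
    (H : ℕ) (102<H : 102 < H) (S : Fin N → Bool) (Δ : ℕ)
    (degree≤ : ∀ x → ∑ (λ y → 𝟙 (S x ∧ (S y ∧ adj G x y))) ≤ Δ) where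

    open Embedding G

    e : V → V → Bool
    e x y = S x ∧ (S y ∧ adj G x y)

    e-sym : ∀ x y → e x y ≡ e y x
    e-sym x y with S x | S y
    ... | true  | true  = symm G x y
    ... | true  | false = refl
    ... | false | true  = refl
    ... | false | false = refl

    e-adj : ∀ x y → e x y ≡ true → adj G x y ≡ true
    e-adj x y h = proj₂ (∧-true (S y) (proj₂ (∧-true (S x) h)))

    e-S : ∀ x y → e x y ≡ true → S x ≡ true
    e-S x y h = proj₁ (∧-true (S x) h)

    E : V → V → ℕ
    E x y = 𝟙 (e x y)

    ∑E≤Δ : ∀ y → ∑ (λ x → E x y) ≤ Δ
    ∑E≤Δ y = ≤-trans (≤-reflexive (∑-cong λ x → cong 𝟙 (e-sym x y))) (degree≤ y)

    cod : V → V → ℕ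
    cod x z = ∑ λ y → 𝟙 (e x y ∧ e z y)

    light heavy : V → V → Bool
    light x z = not (does (x ≟ z)) ∧ (cod x z <ᵇ H)
    heavy x z = not (does (x ≟ z)) ∧ not (cod x z <ᵇ H)

    light-≢ : ∀ {x z} → light x z ≡ true → x ≢ z
    light-≢ {x} {z} h = does-false x z (proj₁ (∧-true (not (does (x ≟ z))) h))

    light-cod : ∀ {x z} → light x z ≡ true → cod x z ≤ H
    light-cod {x} {z} h = <⇒≤ (<ᵇ⇒< (cod x z) H (subst True (sym (proj₂ (∧-true (not (does (x ≟ z))) h))) _))

    heavy-≢ : ∀ {x z} → heavy x z ≡ true → x ≢ z
    heavy-≢ {x} {z} h = does-false x z (proj₁ (∧-true (not (does (x ≟ z))) h))

    heavy-cod : ∀ {x z} → heavy x z ≡ true → H ≤ cod x z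
    heavy-cod {x} {z} h with cod x z <ᵇ H in eq | proj₂ (∧-true (not (does (x ≟ z))) h)
    ... | false | _ = ≮⇒≥ λ lt → subst True eq (<⇒<ᵇ lt)

    common-neighbour : ∀ {x z} F → heavy x z ≡ true → length F ≤ 102 → Σ V λ y → adj G x y ≡ true × adj G z y ≡ true × y ∉ F
    common-neighbour {x} {z} F h len with ∑-witness (λ y → 𝟙 (e x y ∧ e z y)) (λ y → 𝟙 (e x y ∧ e z y) * ι F y)
        (≤-<-trans (∑-mono λ y → 𝟙*≤ (e x y ∧ e z y) (ι F y)) (≤-<-trans (≤-trans (≤-reflexive (∑-ι F)) len) (<-≤-trans 102<H (heavy-cod h))))
    ... | y , lt = y , e-adj x y (proj₁ both) , e-adj z y (proj₂ both) , ι-zero⇒∉ (𝟙*<𝟙⇒≡0 (e x y ∧ e z y) (ι F y) lt)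
      where
      both = ∧-true (e x y) (𝟙-true (≤-trans (s≤s z≤n) lt))

    -- Three members serve as roots and each new `z` is a further member. Its heavy pairs with the
    -- roots supply the middle vertices. The size 103 exceeds the three roots and 99 used vertices.
    no-heavy-clique : ∀ C → 103 ≤ length C → ¬ AllPairs (λ u v → heavy u v ≡ true) C
    no-heavy-clique [] () _
    no-heavy-clique (_ ∷ []) (s≤s ()) _
    no-heavy-clique (_ ∷ _ ∷ []) (s≤s (s≤s ())) _
    no-heavy-clique (x₁ ∷ x₂ ∷ x₃ ∷ C) len clique@((h₁₂ ∷ h₁₃ ∷ h₁) ∷ (h₂₃ ∷ h₂) ∷ h₃ ∷ _) =
      free (greedy (three-injective (heavy-≢ h₁₂) (heavy-≢ h₁₃) (heavy-≢ h₂₃)) extend)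
      where
      distinct : AllPairs _≢_ (x₁ ∷ x₂ ∷ x₃ ∷ C)
      distinct = AllPairs.map heavy-≢ clique
      in-tail : ∀ {z F} → z ∈ x₁ ∷ x₂ ∷ x₃ ∷ C → z ∉ x₁ ∷ x₂ ∷ x₃ ∷ F → z ∈ C
      in-tail (here refl) n = ⊥-elim (n (here refl))
      in-tail (there (here refl)) n = ⊥-elim (n (there (here refl)))
      in-tail (there (there (here refl))) n = ⊥-elim (n (there (there (here refl))))
      in-tail (there (there (there h))) n = h
      extend : ∀ F → length F ≤ 99 → Σ Conf λ c → Valid (three x₁ x₂ x₃) c × (∀ l → c l ∉ F)
      extend F lenF with fresh-element (x₁ ∷ x₂ ∷ x₃ ∷ C) (x₁ ∷ x₂ ∷ x₃ ∷ F) distinct (≤-trans (+-monoʳ-≤ 4 lenF) len)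
      ... | z , z∈ , z∉ with in-tail z∈ z∉
      ...   | z∈C with common-neighbour F (All.lookup h₁ z∈C) (≤-trans lenF (m≤n+m 99 3))
      ...     | y₁ , a₁ , b₁ , y₁∉ with common-neighbour (y₁ ∷ F) (All.lookup h₂ z∈C) (≤-trans (s≤s lenF) (m≤n+m 100 2))
      ...       | y₂ , a₂ , b₂ , y₂∉ with common-neighbour (y₁ ∷ y₂ ∷ F) (All.lookup h₃ z∈C) (≤-trans (s≤s (s≤s lenF)) (m≤n+m 101 1))
      ...         | y₃ , a₃ , b₃ , y₃∉ = four z y₁ y₂ y₃ ,
                    four-valid (λ { refl → y₂∉ (here refl) }) (λ { refl → y₃∉ (here refl) }) (λ { refl → y₃∉ (there (here refl)) }) a₁ a₂ a₃ b₁ b₂ b₃ ,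
                    four-avoids (z∉ ∘ there ∘ there ∘ there) y₁∉ (y₂∉ ∘ there) (y₃∉ ∘ there ∘ there)

    -- Turán's theorem for heavy pairs, whose cliques are bounded. A non-heavy ordered pair is light
    -- or diagonal, and the last summand pays for the diagonal.
    many-light-pairs : ∀ (s : V → Bool) →
      ∑ (𝟙 ∘ s) * ∑ (𝟙 ∘ s) ≤ H * (∑ (λ x → ∑ λ z → 𝟙 (s x) * (𝟙 (s z) * 𝟙 (light x z))) + ∑ (𝟙 ∘ s))
    many-light-pairs s with Turan.turan heavy H s
    ... | inj₂ (C , len , _ , clique) = ⊥-elim (no-heavy-clique C (≤-trans (≤-trans 102<H (n≤1+n H)) (≤-reflexive (sym len))) clique)
    ... | inj₁ le = ≤-trans le (*-monoʳ-≤ H (begin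
      ∑ (λ x → 𝟙 (s x) * ∑ (λ z → 𝟙 (s z) * 𝟙 (not (heavy x z)))) ≡⟨ ∑-cong (λ x → sym (∑-*ˡ (𝟙 (s x)) (λ z → 𝟙 (s z) * 𝟙 (not (heavy x z))))) ⟩
      ∑ (λ x → ∑ λ z → 𝟙 (s x) * (𝟙 (s z) * 𝟙 (not (heavy x z)))) ≤⟨ ∑-mono (λ x → ∑-mono λ z → pointwise x z) ⟩
      ∑ (λ x → ∑ λ z → 𝟙 (s x) * (𝟙 (s z) * 𝟙 (light x z)) + δ x z * 𝟙 (s x))
        ≡⟨ ∑-cong (λ x → ∑-distrib-+ (λ z → 𝟙 (s x) * (𝟙 (s z) * 𝟙 (light x z))) (λ z → δ x z * 𝟙 (s x))) ⟩
      ∑ (λ x → ∑ (λ z → 𝟙 (s x) * (𝟙 (s z) * 𝟙 (light x z))) + ∑ (λ z → δ x z * 𝟙 (s x)))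
        ≡⟨ ∑-cong (λ x → cong (∑ (λ z → 𝟙 (s x) * (𝟙 (s z) * 𝟙 (light x z))) +_) (∑-δ x (λ _ → 𝟙 (s x)))) ⟩
      ∑ (λ x → ∑ (λ z → 𝟙 (s x) * (𝟙 (s z) * 𝟙 (light x z))) + 𝟙 (s x))
        ≡⟨ ∑-distrib-+ (λ x → ∑ (λ z → 𝟙 (s x) * (𝟙 (s z) * 𝟙 (light x z)))) (𝟙 ∘ s) ⟩
      ∑ (λ x → ∑ λ z → 𝟙 (s x) * (𝟙 (s z) * 𝟙 (light x z))) + ∑ (𝟙 ∘ s) ∎))
      where
      open ≤-Reasoning
      cases : ∀ a b c d → 𝟙 a * (𝟙 b * 𝟙 (not (not c ∧ not d))) ≤ 𝟙 a * (𝟙 b * 𝟙 (not c ∧ d)) + 𝟙 c * 𝟙 a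
      cases false b c d = z≤n
      cases true false c d = z≤n
      cases true true true d = ≤-refl
      cases true true false true = ≤-refl
      cases true true false false = z≤n
      pointwise : ∀ x z → 𝟙 (s x) * (𝟙 (s z) * 𝟙 (not (heavy x z))) ≤ 𝟙 (s x) * (𝟙 (s z) * 𝟙 (light x z)) + δ x z * 𝟙 (s x)
      pointwise x z = cases (s x) (s z) (does (x ≟ z)) (cod x z <ᵇ H)

  -- Systems of light cherries through a given vertex, and linked triples.

  module Spread {N : ℕ} (G : SimpleGraph N) (free : HFree G (subdivision (K 3 25)))
    (H : ℕ) (102<H : 102 < H) (S : Fin N → Bool) (Δ : ℕ)
    (degree≤ : ∀ x → ∑ (λ y → 𝟙 (S x ∧ (S y ∧ adj G x y))) ≤ Δ) where

    open Embedding G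
    open Cherries G free H 102<H S Δ degree≤

    cherry : V → V → V → Bool
    cherry z y x = e z y ∧ (e x y ∧ light x z)

    C : V → V → V → ℕ
    C z y x = 𝟙 (cherry z y x)

    C≤E : ∀ z y x → C z y x ≤ E z y
    C≤E z y x with e z y
    ... | true  = 𝟙≤1 _
    ... | false = z≤n

    C≤EE : ∀ z y x → C z y x ≤ E z y * E x y
    C≤EE z y x with e z y | e x y
    ... | true  | true  = 𝟙≤1 _
    ... | true  | false = z≤n
    ... | false | _     = z≤n

    ∑C-middle : ∀ z x → ∑ (λ y → C z y x) ≤ H
    ∑C-middle z x with light x z in eq
    ... | false = ≤-trans (≤-reflexive (trans (∑-cong λ y → vanish (e z y) (e x y)) (∑-zero N))) z≤n
      where
      vanish : ∀ a b → 𝟙 (a ∧ (b ∧ false)) ≡ 0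
      vanish true true = refl
      vanish true false = refl
      vanish false b = refl
    ... | true = ≤-trans (∑-mono λ y → swap (e z y) (e x y)) (light-cod eq)
      where
      swap : ∀ a b → 𝟙 (a ∧ (b ∧ true)) ≤ 𝟙 (b ∧ a)
      swap true true = ≤-refl
      swap true false = z≤n
      swap false b = z≤n

    ∑C-end : ∀ z y → ∑ (λ x → C z y x) ≤ E z y * Δ
    ∑C-end z y = ≤-trans (∑-mono (C≤EE z y)) (≤-trans (≤-reflexive (∑-*ˡ (E z y) (λ x → E x y))) (*-monoʳ-≤ (E z y) (∑E≤Δ y)))

    cherries-at : V → ℕ
    cherries-at z = ∑ λ x → ∑ λ y → C z y x

    cherries-at≤ : ∀ z → cherries-at z ≤ 𝟙 (S z) * (Δ * Δ)
    cherries-at≤ z = begin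
      ∑ (λ x → ∑ λ y → C z y x) ≡⟨ ∑-comm (λ x y → C z y x) ⟩
      ∑ (λ y → ∑ λ x → C z y x) ≤⟨ ∑-mono (∑C-end z) ⟩
      ∑ (λ y → E z y * Δ) ≡⟨ ∑-*ʳ Δ (E z) ⟩
      ∑ (E z) * Δ ≤⟨ *-monoˡ-≤ Δ (≤-𝟙* (S z) (degree≤ z) λ h → trans (∑-cong λ y → cong (λ b → 𝟙 (b ∧ (S y ∧ adj G z y))) h) (∑-zero N)) ⟩
      𝟙 (S z) * Δ * Δ ≡⟨ *-assoc (𝟙 (S z)) Δ Δ ⟩
      𝟙 (S z) * (Δ * Δ) ∎
      where open ≤-Reasoning

    ne : V → V → ℕ
    ne y y′ = 𝟙 (not (does (y ≟ y′)))

    -- Pairs of light cherries from `z` to `x` and `x′` with different middles: a system with one of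
    -- its three cherries left out. Positivity of this number is what `linked` records.
    κ : V → V → V → ℕ
    κ x x′ z = ∑ λ y → ∑ λ y′ → C z y x * (C z y′ x′ * ne y y′)

    κ≤C*C : ∀ x x′ z → κ x x′ z ≤ ∑ (λ y → C z y x) * ∑ (λ y → C z y x′)
    κ≤C*C x x′ z = ≤-trans (∑-mono λ y → ∑-mono λ y′ → *-monoʳ-≤ (C z y x) (≤-trans (*-monoʳ-≤ (C z y′ x′) (𝟙≤1 _)) (≤-reflexive (*-identityʳ _))))
      (≤-reflexive (sym (∑-product (λ y → C z y x) (λ y → C z y x′))))

    linked : V → V → V → Bool
    linked x x′ z = 0 <ᵇ κ x x′ z

    q : V → V → V → ℕ
    q x x′ z = 𝟙 (linked x x′ z)

    q≤κ : ∀ x x′ z → q x x′ z ≤ κ x x′ z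
    q≤κ x x′ z with κ x x′ z
    ... | zero  = z≤n
    ... | suc _ = s≤s z≤n

    κ≤q : ∀ x x′ z → κ x x′ z ≤ q x x′ z * (H * H)
    κ≤q x x′ z = go (κ x x′ z) (≤-trans (κ≤C*C x x′ z) (*-mono-≤ (∑C-middle z x) (∑C-middle z x′)))
      where
      go : ∀ k → k ≤ H * H → k ≤ 𝟙 (0 <ᵇ k) * (H * H)
      go zero    le = z≤n
      go (suc k) le = ≤-trans le (≤-reflexive (sym (*-identityˡ (H * H))))

    linked⇒light : ∀ x x′ z → linked x x′ z ≡ true → light x z ≡ true × light x′ z ≡ true
    linked⇒light x x′ z h with ∑-positive (λ y → ∑ λ y′ → C z y x * (C z y′ x′ * ne y y′)) (positive (κ x x′ z) h)
      where
      positive : ∀ k → (0 <ᵇ k) ≡ true → 0 < k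
      positive (suc k) _ = s≤s z≤n
    ... | y , lt with ∑-positive (λ y′ → C z y x * (C z y′ x′ * ne y y′)) lt
    ...   | y′ , lt′ = is-light y x (proj₁ (positive-* (C z y x) (C z y′ x′ * ne y y′) lt′)) ,
                       is-light y′ x′ (proj₁ (positive-* (C z y′ x′) (ne y y′) (proj₂ (positive-* (C z y x) (C z y′ x′ * ne y y′) lt′))))
      where
      is-light : ∀ y x → 0 < C z y x → light x z ≡ true
      is-light y x p = proj₂ (∧-true (e x y) (proj₂ (∧-true (e z y) (𝟙-true p))))

    -- Its size decides whether a middle vertex `y` can lie in many systems whose other two ends are
    -- `x` and `x′`.
    f : V → V → V → ℕ
    f y x x′ = ∑ λ z → 𝟙 (e z y ∧ linked x x′ z)

    config : (x₁ x₂ x₃ z y₁ y₂ y₃ : V) → Bool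
    config x₁ x₂ x₃ z y₁ y₂ y₃ = cherry z y₁ x₁ ∧ (cherry z y₂ x₂ ∧ (cherry z y₃ x₃ ∧
      (not (does (y₁ ≟ y₂)) ∧ (not (does (y₁ ≟ y₃)) ∧ not (does (y₂ ≟ y₃))))))

    cherry-adj : ∀ z y x → cherry z y x ≡ true → adj G x y ≡ true × adj G z y ≡ true
    cherry-adj z y x h with ∧-true (e z y) h
    ... | hz , h′ = e-adj x y (proj₁ (∧-true (e x y) h′)) , e-adj z y hz

    config-valid : ∀ {x₁ x₂ x₃ z y₁ y₂ y₃} → config x₁ x₂ x₃ z y₁ y₂ y₃ ≡ true → Valid (three x₁ x₂ x₃) (four z y₁ y₂ y₃)
    config-valid {x₁} {x₂} {x₃} {z} {y₁} {y₂} {y₃} h =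
      let c₁ , h₁ = ∧-true (cherry z y₁ x₁) h
          c₂ , h₂ = ∧-true (cherry z y₂ x₂) h₁
          c₃ , h₃ = ∧-true (cherry z y₃ x₃) h₂
          d₁₂ , h₄ = ∧-true (not (does (y₁ ≟ y₂))) h₃
          d₁₃ , d₂₃ = ∧-true (not (does (y₁ ≟ y₃))) h₄
          a₁ , b₁ = cherry-adj z y₁ x₁ c₁
          a₂ , b₂ = cherry-adj z y₂ x₂ c₂
          a₃ , b₃ = cherry-adj z y₃ x₃ c₃
      in four-valid (does-false y₁ y₂ d₁₂) (does-false y₁ y₃ d₁₃) (does-false y₂ y₃ d₂₃) a₁ a₂ a₃ b₁ b₂ b₃

    config-at-z : ∀ x₁ x₂ x₃ v → ∑⁴ (λ z y₁ y₂ y₃ → 𝟙 (config x₁ x₂ x₃ z y₁ y₂ y₃) * δ v z) ≤ H * (H * H)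
    config-at-z x₁ x₂ x₃ v = begin
      ∑⁴ (λ z y₁ y₂ y₃ → 𝟙 (config x₁ x₂ x₃ z y₁ y₂ y₃) * δ v z)
        ≤⟨ ∑⁴-mono (λ z y₁ y₂ y₃ → drop (cherry z y₁ x₁) (cherry z y₂ x₂) (cherry z y₃ x₃) _ (δ v z)) ⟩
      ∑⁴ (λ z y₁ y₂ y₃ → δ v z * (C z y₁ x₁ * (C z y₂ x₂ * C z y₃ x₃)))
        ≡⟨ ∑-cong (λ z → trans (∑-cong λ y₁ → trans (∑-cong λ y₂ → trans (∑-*ˡ (δ v z) (λ y₃ → C z y₁ x₁ * (C z y₂ x₂ * C z y₃ x₃)))
               (cong (δ v z *_) (trans (∑-*ˡ (C z y₁ x₁) (λ y₃ → C z y₂ x₂ * C z y₃ x₃)) (cong (C z y₁ x₁ *_) (∑-*ˡ (C z y₂ x₂) (λ y₃ → C z y₃ x₃))))))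
             (trans (∑-*ˡ (δ v z) (λ y₂ → C z y₁ x₁ * (C z y₂ x₂ * c₃ z))) (cong (δ v z *_) (trans (∑-*ˡ (C z y₁ x₁) (λ y₂ → C z y₂ x₂ * c₃ z)) (cong (C z y₁ x₁ *_) (∑-*ʳ (c₃ z) (λ y₂ → C z y₂ x₂)))))))
           (trans (∑-*ˡ (δ v z) (λ y₁ → C z y₁ x₁ * (c₂ z * c₃ z))) (cong (δ v z *_) (∑-*ʳ (c₂ z * c₃ z) (λ y₁ → C z y₁ x₁))))) ⟩
      ∑ (λ z → δ v z * (c₁ z * (c₂ z * c₃ z))) ≡⟨ ∑-δ v (λ z → c₁ z * (c₂ z * c₃ z)) ⟩
      c₁ v * (c₂ v * c₃ v) ≤⟨ *-mono-≤ (∑C-middle v x₁) (*-mono-≤ (∑C-middle v x₂) (∑C-middle v x₃)) ⟩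
      H * (H * H) ∎
      where
      open ≤-Reasoning
      c₁ c₂ c₃ : V → ℕ
      c₁ z = ∑ λ y → C z y x₁
      c₂ z = ∑ λ y → C z y x₂
      c₃ z = ∑ λ y → C z y x₃
      drop : ∀ a b c d t → 𝟙 (a ∧ (b ∧ (c ∧ d))) * t ≤ t * (𝟙 a * (𝟙 b * 𝟙 c))
      drop false b c d t = z≤n
      drop true false c d t = z≤n
      drop true true false d t = z≤n
      drop true true true d t = ≤-trans (𝟙*≤ d t) (≤-reflexive (sym (*-identityʳ t)))

    -- A bound for the systems with middle vertex `v`: once `v` and its neighbour `z` are fixed, so
    -- is the cherry through `v`, and `κ` counts the other two.
    E-κ : V → V → V → ℕ
    E-κ v x x′ = ∑ λ z → E z v * κ x x′ z

    pull : ∀ z v (g : V → V → V → ℕ) → ∑ (λ y → ∑ λ y′ → ∑ λ y″ → δ v y * (E z y * g y y′ y″)) ≡ E z v * ∑ (λ y′ → ∑ λ y″ → g v y′ y″)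
    pull z v g = trans (∑-cong λ y → trans (∑-cong λ y′ → trans (∑-*ˡ (δ v y) (λ y″ → E z y * g y y′ y″)) (cong (δ v y *_) (∑-*ˡ (E z y) (g y y′))))
        (trans (∑-*ˡ (δ v y) (λ y′ → E z y * ∑ (g y y′))) (cong (δ v y *_) (∑-*ˡ (E z y) (λ y′ → ∑ (g y y′))))))
      (∑-δ v (λ y → E z y * ∑ (λ y′ → ∑ (g y y′))))

    config-at-y₁ : ∀ x₁ x₂ x₃ v → ∑⁴ (λ z y₁ y₂ y₃ → 𝟙 (config x₁ x₂ x₃ z y₁ y₂ y₃) * δ v y₁) ≤ E-κ v x₂ x₃
    config-at-y₁ x₁ x₂ x₃ v = ≤-trans
      (∑⁴-mono λ z y₁ y₂ y₃ → drop (C≤E z y₁ x₁) (cherry z y₂ x₂) (cherry z y₃ x₃) (not (does (y₁ ≟ y₂))) (not (does (y₁ ≟ y₃))) (not (does (y₂ ≟ y₃))) (δ v y₁))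
      (≤-reflexive (∑-cong λ z → pull z v (λ _ y₂ y₃ → C z y₂ x₂ * (C z y₃ x₃ * ne y₂ y₃))))
      where
      drop : ∀ {a E} → 𝟙 a ≤ E → ∀ b c p q r t → 𝟙 (a ∧ (b ∧ (c ∧ (p ∧ (q ∧ r))))) * t ≤ t * (E * (𝟙 b * (𝟙 c * 𝟙 r)))
      drop {false} le b c p q r t = z≤n
      drop {true} le false c p q r t = z≤n
      drop {true} le true false p q r t = z≤n
      drop {true} le true true false q r t = z≤n
      drop {true} le true true true false r t = z≤n
      drop {true} le true true true true false t = z≤n
      drop {true} {E} le true true true true true t = ≤-trans (≤-reflexive (*-comm 1 t)) (*-monoʳ-≤ t (≤-trans le (≤-reflexive (sym (*-identityʳ E)))))

    config-at-y₂ : ∀ x₁ x₂ x₃ v → ∑⁴ (λ z y₁ y₂ y₃ → 𝟙 (config x₁ x₂ x₃ z y₁ y₂ y₃) * δ v y₂) ≤ E-κ v x₁ x₃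
    config-at-y₂ x₁ x₂ x₃ v = ≤-trans
      (∑⁴-mono λ z y₁ y₂ y₃ → drop (cherry z y₁ x₁) (C≤E z y₂ x₂) (cherry z y₃ x₃) (not (does (y₁ ≟ y₂))) (not (does (y₁ ≟ y₃))) (not (does (y₂ ≟ y₃))) (δ v y₂))
      (≤-reflexive (∑-cong λ z → trans (∑-comm (λ y₁ y₂ → ∑ λ y₃ → δ v y₂ * (E z y₂ * (C z y₁ x₁ * (C z y₃ x₃ * ne y₁ y₃)))))
        (pull z v (λ _ y₁ y₃ → C z y₁ x₁ * (C z y₃ x₃ * ne y₁ y₃)))))
      where
      drop : ∀ a {b E} → 𝟙 b ≤ E → ∀ c p q r t → 𝟙 (a ∧ (b ∧ (c ∧ (p ∧ (q ∧ r))))) * t ≤ t * (E * (𝟙 a * (𝟙 c * 𝟙 q)))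
      drop false le c p q r t = z≤n
      drop true {false} le c p q r t = z≤n
      drop true {true} le false p q r t = z≤n
      drop true {true} le true false q r t = z≤n
      drop true {true} le true true false r t = z≤n
      drop true {true} {E} le true true true r t = ≤-trans (𝟙*≤ r t) (≤-trans (≤-reflexive (sym (*-identityʳ t))) (*-monoʳ-≤ t (≤-trans le (≤-reflexive (sym (*-identityʳ E))))))

    config-at-y₃ : ∀ x₁ x₂ x₃ v → ∑⁴ (λ z y₁ y₂ y₃ → 𝟙 (config x₁ x₂ x₃ z y₁ y₂ y₃) * δ v y₃) ≤ E-κ v x₁ x₂
    config-at-y₃ x₁ x₂ x₃ v = ≤-trans
      (∑⁴-mono λ z y₁ y₂ y₃ → drop (cherry z y₁ x₁) (cherry z y₂ x₂) (C≤E z y₃ x₃) (not (does (y₁ ≟ y₂))) (not (does (y₁ ≟ y₃))) (not (does (y₂ ≟ y₃))) (δ v y₃))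
      (≤-reflexive (∑-cong λ z → trans (∑-cong λ y₁ → ∑-comm (λ y₂ y₃ → δ v y₃ * (E z y₃ * (C z y₁ x₁ * (C z y₂ x₂ * ne y₁ y₂)))))
        (trans (∑-comm (λ y₁ y₃ → ∑ λ y₂ → δ v y₃ * (E z y₃ * (C z y₁ x₁ * (C z y₂ x₂ * ne y₁ y₂)))))
          (pull z v (λ _ y₁ y₂ → C z y₁ x₁ * (C z y₂ x₂ * ne y₁ y₂))))))
      where
      drop : ∀ a b {c E} → 𝟙 c ≤ E → ∀ p q r t → 𝟙 (a ∧ (b ∧ (c ∧ (p ∧ (q ∧ r))))) * t ≤ t * (E * (𝟙 a * (𝟙 b * 𝟙 p)))
      drop false b le p q r t = z≤n
      drop true false le p q r t = z≤n
      drop true true {false} le p q r t = z≤n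
      drop true true {true} le false q r t = z≤n
      drop true true {true} {E} le true q r t = ≤-trans (𝟙*≤ (q ∧ r) t) (≤-trans (≤-reflexive (sym (*-identityʳ t))) (*-monoʳ-≤ t (≤-trans le (≤-reflexive (sym (*-identityʳ E))))))

    -- Two estimates follow from this one: f ≤ Δ always, as in `E-κ≤Δ`, and f ≤ M for the middle
    -- vertices kept later.
    E-κ≤f : ∀ v x x′ → E-κ v x x′ ≤ f v x x′ * (H * H)
    E-κ≤f v x x′ = ≤-trans (∑-mono λ z → ≤-trans (*-monoʳ-≤ (E z v) (κ≤q x x′ z)) (≤-reflexive (trans (sym (*-assoc (E z v) (q x x′ z) (H * H))) (cong (_* (H * H)) (sym (𝟙-∧ (e z v) (linked x x′ z)))))))
      (≤-reflexive (∑-*ʳ (H * H) (λ z → 𝟙 (e z v ∧ linked x x′ z))))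

    E-κ≤Δ : ∀ v x x′ → E-κ v x x′ ≤ Δ * (H * H)
    E-κ≤Δ v x x′ = ≤-trans (E-κ≤f v x x′) (*-monoˡ-≤ (H * H) (≤-trans (∑-mono λ z → 𝟙-∧≤ (e z v) (linked x x′ z)) (∑E≤Δ v)))

    -- The shared middle is a common neighbour of `x` and `u`, at most H choices as the pair is
    -- light; then `z` has at most Δ choices and `y₃` at most H.
    shared-middle : ∀ u x x′ → light x u ≡ true →
      ∑⁴ (λ z y y₂ y₃ → C z y u * (C z y₂ x * (C z y₃ x′ * δ y y₂))) ≤ H * Δ * H
    shared-middle u x x′ lt = begin
      ∑⁴ (λ z y y₂ y₃ → C z y u * (C z y₂ x * (C z y₃ x′ * δ y y₂)))
        ≡⟨ ∑⁴-cong (λ z y y₂ y₃ → reorder (C z y u) (C z y₂ x) (C z y₃ x′) (δ y y₂)) ⟩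
      ∑⁴ (λ z y y₂ y₃ → δ y y₂ * (C z y u * C z y₂ x) * C z y₃ x′)
        ≡⟨ ∑-cong (λ z → ∑-cong λ y → ∑-cong λ y₂ → ∑-*ˡ (δ y y₂ * (C z y u * C z y₂ x)) (λ y₃ → C z y₃ x′)) ⟩
      ∑ (λ z → ∑ λ y → ∑ λ y₂ → δ y y₂ * (C z y u * C z y₂ x) * ∑ (λ y₃ → C z y₃ x′))
        ≤⟨ ∑-mono (λ z → ∑-mono λ y → ∑-mono λ y₂ → *-monoʳ-≤ (δ y y₂ * (C z y u * C z y₂ x)) (∑C-middle z x′)) ⟩
      ∑ (λ z → ∑ λ y → ∑ λ y₂ → δ y y₂ * (C z y u * C z y₂ x) * H)
        ≡⟨ ∑-cong (λ z → ∑-cong λ y → trans (∑-*ʳ H (λ y₂ → δ y y₂ * (C z y u * C z y₂ x))) (cong (_* H) (∑-δ y (λ y₂ → C z y u * C z y₂ x)))) ⟩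
      ∑ (λ z → ∑ λ y → C z y u * C z y x * H)
        ≤⟨ ∑-mono (λ z → ∑-mono λ y → *-monoˡ-≤ H (both (e z y) (e u y) (light u z) (e x y) (light x z))) ⟩
      ∑ (λ z → ∑ λ y → 𝟙 (e x y ∧ e u y) * E z y * H) ≡⟨ ∑-comm (λ z y → 𝟙 (e x y ∧ e u y) * E z y * H) ⟩
      ∑ (λ y → ∑ λ z → 𝟙 (e x y ∧ e u y) * E z y * H)
        ≡⟨ ∑-cong (λ y → trans (∑-*ʳ H (λ z → 𝟙 (e x y ∧ e u y) * E z y)) (cong (_* H) (∑-*ˡ (𝟙 (e x y ∧ e u y)) (λ z → E z y)))) ⟩
      ∑ (λ y → 𝟙 (e x y ∧ e u y) * ∑ (λ z → E z y) * H) ≤⟨ ∑-mono (λ y → *-monoˡ-≤ H (*-monoʳ-≤ (𝟙 (e x y ∧ e u y)) (∑E≤Δ y))) ⟩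
      ∑ (λ y → 𝟙 (e x y ∧ e u y) * Δ * H) ≡⟨ trans (∑-*ʳ H (λ y → 𝟙 (e x y ∧ e u y) * Δ)) (cong (_* H) (∑-*ʳ Δ (λ y → 𝟙 (e x y ∧ e u y)))) ⟩
      cod x u * Δ * H ≤⟨ *-monoˡ-≤ H (*-monoˡ-≤ Δ (light-cod lt)) ⟩
      H * Δ * H ∎
      where
      open ≤-Reasoning
      reorder : ∀ a b c d → a * (b * (c * d)) ≡ d * (a * b) * c
      reorder = solve-∀
      both : ∀ a b l c m → 𝟙 (a ∧ (b ∧ l)) * 𝟙 (a ∧ (c ∧ m)) ≤ 𝟙 (c ∧ b) * 𝟙 a
      both false b l c m = z≤n
      both true false l c m = z≤n
      both true true l false m = ≤-reflexive (*-zeroʳ (𝟙 l))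
      both true true l true m = *-mono-≤ (𝟙≤1 l) (𝟙≤1 m)

    light-bound : ℕ
    light-bound = (H * Δ * H + H * Δ * H) + 99 * (H * (H * H) + 3 * (Δ * (H * H)))

    -- A cherry from `z` to `u` and a linked pair at `z` either share a middle vertex or form a
    -- system for the triple (u , x , x′). The former are few because `u` forms light pairs with `x`
    -- and `x′`, the latter by `few-configurations` with the crude bound Δ.
    light-degree : ∀ {x x′} → x ≢ x′ → ∀ u → linked x x′ u ≡ true → ∑ (λ z → ∑ λ y → C z y u * q x x′ z) ≤ light-bound
    light-degree {x} {x′} x≢x′ u h = begin
      ∑ (λ z → ∑ λ y → C z y u * q x x′ z) ≤⟨ ∑-mono (λ z → ∑-mono λ y → *-monoʳ-≤ (C z y u) (q≤κ x x′ z)) ⟩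
      ∑ (λ z → ∑ λ y → C z y u * κ x x′ z)
        ≡⟨ ∑-cong (λ z → ∑-cong λ y → trans (sym (∑-*ˡ (C z y u) (λ y₂ → ∑ λ y₃ → C z y₂ x * (C z y₃ x′ * ne y₂ y₃))))
             (∑-cong λ y₂ → sym (∑-*ˡ (C z y u) (λ y₃ → C z y₂ x * (C z y₃ x′ * ne y₂ y₃))))) ⟩
      ∑⁴ (λ z y y₂ y₃ → C z y u * (C z y₂ x * (C z y₃ x′ * ne y₂ y₃)))
        ≤⟨ ∑⁴-mono (λ z y y₂ y₃ → cases (cherry z y u) (cherry z y₂ x) (cherry z y₃ x′) (does (y ≟ y₂)) (does (y ≟ y₃)) (not (does (y₂ ≟ y₃)))) ⟩
      ∑⁴ (λ z y y₂ y₃ → (t₁ z y y₂ y₃ + t₂ z y y₂ y₃) + 𝟙 (config u x x′ z y y₂ y₃))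
        ≡⟨ trans (∑⁴-+ _ _) (cong (_+ ∑⁴ (λ z y y₂ y₃ → 𝟙 (config u x x′ z y y₂ y₃))) (∑⁴-+ t₁ t₂)) ⟩
      (∑⁴ t₁ + ∑⁴ t₂) + ∑⁴ (λ z y y₂ y₃ → 𝟙 (config u x x′ z y y₂ y₃))
        ≤⟨ +-mono-≤ (+-mono-≤ (shared-middle u x x′ (proj₁ lts)) t₂-bound) configs ⟩
      light-bound ∎
      where
      open ≤-Reasoning
      lts = linked⇒light x x′ u h
      t₁ t₂ : V → V → V → V → ℕ
      t₁ z y y₂ y₃ = C z y u * (C z y₂ x * (C z y₃ x′ * δ y y₂))
      t₂ z y y₂ y₃ = C z y u * (C z y₂ x * (C z y₃ x′ * δ y y₃))
      swap : ∀ a b c d → a * (b * (c * d)) ≡ a * (c * (b * d))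
      swap = solve-∀
      t₂-bound : ∑⁴ t₂ ≤ H * Δ * H
      t₂-bound = ≤-trans (≤-reflexive (∑-cong λ z → ∑-cong λ y → trans (∑-comm (t₂ z y)) (∑-cong λ y₃ → ∑-cong λ y₂ → swap (C z y u) (C z y₂ x) (C z y₃ x′) (δ y y₃))))
        (shared-middle u x′ x (proj₂ lts))
      configs : ∑⁴ (λ z y y₂ y₃ → 𝟙 (config u x x′ z y y₂ y₃)) ≤ 99 * (H * (H * H) + 3 * (Δ * (H * H)))
      configs = few-configurations free (λ eq → light-≢ (proj₁ lts) (sym eq)) (λ eq → light-≢ (proj₂ lts) (sym eq)) x≢x′
        (config u x x′) config-valid (H * (H * H)) (Δ * (H * H)) (config-at-z u x x′)
        (λ v → ≤-trans (config-at-y₁ u x x′ v) (E-κ≤Δ v x x′))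
        (λ v → ≤-trans (config-at-y₂ u x x′ v) (E-κ≤Δ v u x′))
        (λ v → ≤-trans (config-at-y₃ u x x′ v) (E-κ≤Δ v u x))
      cases : ∀ a b c p q r → 𝟙 a * (𝟙 b * (𝟙 c * 𝟙 r)) ≤
        (𝟙 a * (𝟙 b * (𝟙 c * 𝟙 p)) + 𝟙 a * (𝟙 b * (𝟙 c * 𝟙 q))) + 𝟙 (a ∧ (b ∧ (c ∧ (not p ∧ (not q ∧ r)))))
      cases false b c p q r = z≤n
      cases true false c p q r = z≤n
      cases true true false p q r = z≤n
      cases true true true p q false = z≤n
      cases true true true true q true = s≤s z≤n
      cases true true true false true true = s≤s z≤n
      cases true true true false false true = ≤-refl

    -- `many-light-pairs` applied to the linked neighbours of each `y` turns f² into light pairs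
    -- with a common neighbour `y`. Summed over `y` these are the cherries counted by
    -- `light-degree`.
    second-moment : ∀ {x x′} → x ≢ x′ → ∑ (λ y → f y x x′ * f y x x′) ≤ H * ((light-bound + Δ) * ∑ (q x x′))
    second-moment {x} {x′} x≢x′ = begin
      ∑ (λ y → f y x x′ * f y x x′) ≤⟨ ∑-mono (λ y → many-light-pairs (λ z → e z y ∧ linked x x′ z)) ⟩
      ∑ (λ y → H * (L y + f y x x′)) ≡⟨ trans (∑-*ˡ H (λ y → L y + f y x x′)) (cong (H *_) (∑-distrib-+ L (λ y → f y x x′))) ⟩
      H * (∑ L + ∑ (λ y → f y x x′)) ≤⟨ *-monoʳ-≤ H (+-mono-≤ L-bound f-bound) ⟩
      H * (light-bound * ∑ (q x x′) + Δ * ∑ (q x x′)) ≡⟨ cong (H *_) (sym (*-distribʳ-+ (∑ (q x x′)) light-bound Δ)) ⟩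
      H * ((light-bound + Δ) * ∑ (q x x′)) ∎
      where
      open ≤-Reasoning
      L : V → ℕ
      L y = ∑ λ u → ∑ λ z → 𝟙 (e u y ∧ linked x x′ u) * (𝟙 (e z y ∧ linked x x′ z) * 𝟙 (light u z))
      regroup : ∀ a b c d l → 𝟙 (a ∧ b) * (𝟙 (c ∧ d) * 𝟙 l) ≡ 𝟙 b * (𝟙 (c ∧ (a ∧ l)) * 𝟙 d)
      regroup a b c d l = trans (cong₂ (λ s t → s * (t * 𝟙 l)) (𝟙-∧ a b) (𝟙-∧ c d))
        (trans (shuffle (𝟙 a) (𝟙 b) (𝟙 c) (𝟙 d) (𝟙 l)) (cong (λ s → 𝟙 b * (s * 𝟙 d)) (sym (trans (𝟙-∧ c (a ∧ l)) (cong (𝟙 c *_) (𝟙-∧ a l))))))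
        where
        shuffle : ∀ a b c d l → a * b * (c * d * l) ≡ b * (c * (a * l) * d)
        shuffle = solve-∀
      guarded : ∀ b t k → (b ≡ true → t ≤ k) → 𝟙 b * t ≤ k * 𝟙 b
      guarded true t k h = ≤-trans (≤-reflexive (*-identityˡ t)) (≤-trans (h refl) (≤-reflexive (sym (*-identityʳ k))))
      guarded false t k h = z≤n
      L-bound : ∑ L ≤ light-bound * ∑ (q x x′)
      L-bound = begin
        ∑ L ≡⟨ ∑-cong (λ y → ∑-cong λ u → ∑-cong λ z → regroup (e u y) (linked x x′ u) (e z y) (linked x x′ z) (light u z)) ⟩
        ∑ (λ y → ∑ λ u → ∑ λ z → q x x′ u * (C z y u * q x x′ z)) ≡⟨ ∑-comm (λ y u → ∑ λ z → q x x′ u * (C z y u * q x x′ z)) ⟩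
        ∑ (λ u → ∑ λ y → ∑ λ z → q x x′ u * (C z y u * q x x′ z)) ≡⟨ ∑-cong (λ u → ∑-comm (λ y z → q x x′ u * (C z y u * q x x′ z))) ⟩
        ∑ (λ u → ∑ λ z → ∑ λ y → q x x′ u * (C z y u * q x x′ z))
          ≡⟨ ∑-cong (λ u → trans (∑-cong λ z → ∑-*ˡ (q x x′ u) (λ y → C z y u * q x x′ z)) (∑-*ˡ (q x x′ u) (λ z → ∑ λ y → C z y u * q x x′ z))) ⟩
        ∑ (λ u → q x x′ u * ∑ (λ z → ∑ λ y → C z y u * q x x′ z)) ≤⟨ ∑-mono (λ u → guarded (linked x x′ u) _ light-bound (light-degree x≢x′ u)) ⟩
        ∑ (λ u → light-bound * q x x′ u) ≡⟨ ∑-*ˡ light-bound (q x x′) ⟩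
        light-bound * ∑ (q x x′) ∎
      f-bound : ∑ (λ y → f y x x′) ≤ Δ * ∑ (q x x′)
      f-bound = begin
        ∑ (λ y → ∑ λ z → 𝟙 (e z y ∧ linked x x′ z)) ≡⟨ ∑-comm (λ y z → 𝟙 (e z y ∧ linked x x′ z)) ⟩
        ∑ (λ z → ∑ λ y → 𝟙 (e z y ∧ linked x x′ z)) ≡⟨ ∑-cong (λ z → trans (∑-cong λ y → 𝟙-∧ (e z y) (linked x x′ z)) (∑-*ʳ (q x x′ z) (E z))) ⟩
        ∑ (λ z → ∑ (E z) * q x x′ z) ≤⟨ ∑-mono (λ z → *-monoˡ-≤ (q x x′ z) (degree≤ z)) ⟩
        ∑ (λ z → Δ * q x x′ z) ≡⟨ ∑-*ˡ Δ (q x x′) ⟩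
        Δ * ∑ (q x x′) ∎

  -- Counting triples of light cherries with a common end.

  module Assembly {N : ℕ} (G : SimpleGraph N) (free : HFree G (subdivision (K 3 25)))
    (H : ℕ) (102<H : 102 < H) (S : Fin N → Bool) (Δ : ℕ)
    (degree≤ : ∀ x → ∑ (λ y → 𝟙 (S x ∧ (S y ∧ adj G x y))) ≤ Δ)
    (n : ℕ) (size : ∑ (𝟙 ∘ S) ≤ n) (M : ℕ) where

    open Embedding G
    open Cherries G free H 102<H S Δ degree≤
    open Spread G free H 102<H S Δ degree≤

    ∑₂ : (V → V → ℕ) → ℕ
    ∑₂ g = ∑ λ x → ∑ λ y → g x y

    ∑₂-cong : ∀ {f g} → (∀ x y → f x y ≡ g x y) → ∑₂ f ≡ ∑₂ g
    ∑₂-cong h = ∑-cong λ x → ∑-cong λ y → h x y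

    ∑₂-mono : ∀ {f g} → (∀ x y → f x y ≤ g x y) → ∑₂ f ≤ ∑₂ g
    ∑₂-mono h = ∑-mono λ x → ∑-mono λ y → h x y

    ∑₂-+ : ∀ f g → ∑₂ (λ x y → f x y + g x y) ≡ ∑₂ f + ∑₂ g
    ∑₂-+ f g = trans (∑-cong λ x → ∑-distrib-+ (f x) (g x)) (∑-distrib-+ (λ x → ∑ (f x)) (λ x → ∑ (g x)))

    ∑₂-*ˡ : ∀ k g → ∑₂ (λ x y → k * g x y) ≡ k * ∑₂ g
    ∑₂-*ˡ k g = trans (∑-cong λ x → ∑-*ˡ k (g x)) (∑-*ˡ k (λ x → ∑ (g x)))

    ∑₂-*ʳ : ∀ k g → ∑₂ (λ x y → g x y * k) ≡ ∑₂ g * k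
    ∑₂-*ʳ k g = trans (∑-cong λ x → ∑-*ʳ k (g x)) (∑-*ʳ k (λ x → ∑ (g x)))

    ∑₂-comm : ∀ (g : V → V → V → V → ℕ) → ∑₂ (λ x y → ∑₂ λ x′ y′ → g x y x′ y′) ≡ ∑₂ (λ x′ y′ → ∑₂ λ x y → g x y x′ y′)
    ∑₂-comm g = begin
      ∑ (λ x → ∑ λ y → ∑ λ x′ → ∑ λ y′ → g x y x′ y′) ≡⟨ ∑-cong (λ x → ∑-comm (λ y x′ → ∑ λ y′ → g x y x′ y′)) ⟩
      ∑ (λ x → ∑ λ x′ → ∑ λ y → ∑ λ y′ → g x y x′ y′) ≡⟨ ∑-comm (λ x x′ → ∑ λ y → ∑ λ y′ → g x y x′ y′) ⟩
      ∑ (λ x′ → ∑ λ x → ∑ λ y → ∑ λ y′ → g x y x′ y′) ≡⟨ ∑-cong (λ x′ → ∑-cong λ x → ∑-comm (λ y y′ → g x y x′ y′)) ⟩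
      ∑ (λ x′ → ∑ λ x → ∑ λ y′ → ∑ λ y → g x y x′ y′) ≡⟨ ∑-cong (λ x′ → ∑-comm (λ x y′ → ∑ λ y → g x y x′ y′)) ⟩
      ∑ (λ x′ → ∑ λ y′ → ∑ λ x → ∑ λ y → g x y x′ y′) ∎
      where open ≡-Reasoning

    Weight : Set
    Weight = (x₁ y₁ x₂ y₂ x₃ y₃ : V) → ℕ

    -- The classes of triples become weights, so that one set of linearity and symmetry rules serves
    -- them all.
    T : Weight → ℕ
    T h = ∑ λ z → ∑₂ λ x₁ y₁ → ∑₂ λ x₂ y₂ → ∑₂ λ x₃ y₃ → C z y₁ x₁ * (C z y₂ x₂ * (C z y₃ x₃ * h x₁ y₁ x₂ y₂ x₃ y₃))

    T-mono : ∀ {h h′} → (∀ x₁ y₁ x₂ y₂ x₃ y₃ → h x₁ y₁ x₂ y₂ x₃ y₃ ≤ h′ x₁ y₁ x₂ y₂ x₃ y₃) → T h ≤ T h′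
    T-mono le = ∑-mono λ z → ∑₂-mono λ x₁ y₁ → ∑₂-mono λ x₂ y₂ → ∑₂-mono λ x₃ y₃ →
      *-monoʳ-≤ (C z y₁ x₁) (*-monoʳ-≤ (C z y₂ x₂) (*-monoʳ-≤ (C z y₃ x₃) (le x₁ y₁ x₂ y₂ x₃ y₃)))

    T-+ : ∀ h h′ → T (λ x₁ y₁ x₂ y₂ x₃ y₃ → h x₁ y₁ x₂ y₂ x₃ y₃ + h′ x₁ y₁ x₂ y₂ x₃ y₃) ≡ T h + T h′
    T-+ h h′ = trans (∑-cong λ z → trans (∑₂-cong λ x₁ y₁ → trans (∑₂-cong λ x₂ y₂ → trans (∑₂-cong λ x₃ y₃ →
        distribute (C z y₁ x₁) (C z y₂ x₂) (C z y₃ x₃) (h x₁ y₁ x₂ y₂ x₃ y₃) (h′ x₁ y₁ x₂ y₂ x₃ y₃)) (∑₂-+ (t h z x₁ y₁ x₂ y₂) (t h′ z x₁ y₁ x₂ y₂)))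
        (∑₂-+ (λ x₂ y₂ → ∑₂ (t h z x₁ y₁ x₂ y₂)) (λ x₂ y₂ → ∑₂ (t h′ z x₁ y₁ x₂ y₂))))
        (∑₂-+ (λ x₁ y₁ → ∑₂ λ x₂ y₂ → ∑₂ (t h z x₁ y₁ x₂ y₂)) (λ x₁ y₁ → ∑₂ λ x₂ y₂ → ∑₂ (t h′ z x₁ y₁ x₂ y₂))))
      (∑-distrib-+ (λ z → ∑₂ λ x₁ y₁ → ∑₂ λ x₂ y₂ → ∑₂ (t h z x₁ y₁ x₂ y₂)) (λ z → ∑₂ λ x₁ y₁ → ∑₂ λ x₂ y₂ → ∑₂ (t h′ z x₁ y₁ x₂ y₂)))
      where
      t : Weight → (z x₁ y₁ x₂ y₂ x₃ y₃ : V) → ℕ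
      t h z x₁ y₁ x₂ y₂ x₃ y₃ = C z y₁ x₁ * (C z y₂ x₂ * (C z y₃ x₃ * h x₁ y₁ x₂ y₂ x₃ y₃))
      distribute : ∀ a b c g g′ → a * (b * (c * (g + g′))) ≡ a * (b * (c * g)) + a * (b * (c * g′))
      distribute = solve-∀

    T-swap₁₂ : ∀ h → T h ≡ T (λ x₁ y₁ x₂ y₂ x₃ y₃ → h x₂ y₂ x₁ y₁ x₃ y₃)
    T-swap₁₂ h = ∑-cong λ z → trans (∑₂-comm (λ x₁ y₁ x₂ y₂ → ∑₂ λ x₃ y₃ → C z y₁ x₁ * (C z y₂ x₂ * (C z y₃ x₃ * h x₁ y₁ x₂ y₂ x₃ y₃))))
      (∑₂-cong λ x₂ y₂ → ∑₂-cong λ x₁ y₁ → ∑₂-cong λ x₃ y₃ → swap (C z y₁ x₁) (C z y₂ x₂) _)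
      where
      swap : ∀ a b c → a * (b * c) ≡ b * (a * c)
      swap = solve-∀

    T-swap₂₃ : ∀ h → T h ≡ T (λ x₁ y₁ x₂ y₂ x₃ y₃ → h x₁ y₁ x₃ y₃ x₂ y₂)
    T-swap₂₃ h = ∑-cong λ z → ∑₂-cong λ x₁ y₁ → trans (∑₂-comm (λ x₂ y₂ x₃ y₃ → C z y₁ x₁ * (C z y₂ x₂ * (C z y₃ x₃ * h x₁ y₁ x₂ y₂ x₃ y₃))))
      (∑₂-cong λ x₃ y₃ → ∑₂-cong λ x₂ y₂ → swap (C z y₁ x₁) (C z y₂ x₂) (C z y₃ x₃) _)
      where
      swap : ∀ a b c h → a * (b * (c * h)) ≡ a * (c * (b * h))
      swap = solve-∀

    T-one : T (λ _ _ _ _ _ _ → 1) ≡ ∑ (λ z → cherries-at z * (cherries-at z * cherries-at z))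
    T-one = ∑-cong λ z → trans (∑₂-cong λ x₁ y₁ → trans (∑₂-cong λ x₂ y₂ →
        trans (∑₂-cong λ x₃ y₃ → cong (λ c → C z y₁ x₁ * (C z y₂ x₂ * c)) (*-identityʳ (C z y₃ x₃)))
          (trans (∑₂-*ˡ (C z y₁ x₁) (λ x₃ y₃ → C z y₂ x₂ * C z y₃ x₃)) (cong (C z y₁ x₁ *_) (∑₂-*ˡ (C z y₂ x₂) (λ x₃ y₃ → C z y₃ x₃)))))
        (trans (∑₂-*ˡ (C z y₁ x₁) (λ x₂ y₂ → C z y₂ x₂ * cherries-at z)) (cong (C z y₁ x₁ *_) (∑₂-*ʳ (cherries-at z) (λ x₂ y₂ → C z y₂ x₂)))))
      (∑₂-*ʳ (cherries-at z * cherries-at z) (λ x₁ y₁ → C z y₁ x₁))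

    ∑S≤ : ∀ k → ∑ (λ z → 𝟙 (S z) * k) ≤ n * k
    ∑S≤ k = ≤-trans (≤-reflexive (∑-*ʳ k (𝟙 ∘ S))) (*-monoˡ-≤ k size)

    -- The first and third cherries cost Δ² each, and `k` replaces the cost of the second.
    T-two : ∀ (h : V → V → V → V → ℕ) k → (∀ z x₁ y₁ → ∑₂ (λ x₂ y₂ → C z y₂ x₂ * h x₁ y₁ x₂ y₂) ≤ k) →
      T (λ x₁ y₁ x₂ y₂ _ _ → h x₁ y₁ x₂ y₂) ≤ n * (Δ * Δ * k * (Δ * Δ))
    T-two h k le = begin
      T (λ x₁ y₁ x₂ y₂ _ _ → h x₁ y₁ x₂ y₂)
        ≡⟨ ∑-cong (λ z → trans (∑₂-cong λ x₁ y₁ → trans (∑₂-cong λ x₂ y₂ → trans (∑₂-cong λ x₃ y₃ → reorder (C z y₁ x₁) (C z y₂ x₂) (C z y₃ x₃) (h x₁ y₁ x₂ y₂))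
             (∑₂-*ˡ (C z y₁ x₁ * (C z y₂ x₂ * h x₁ y₁ x₂ y₂)) (λ x₃ y₃ → C z y₃ x₃)))
             (trans (∑₂-*ʳ (cherries-at z) (λ x₂ y₂ → C z y₁ x₁ * (C z y₂ x₂ * h x₁ y₁ x₂ y₂))) (cong (_* cherries-at z) (∑₂-*ˡ (C z y₁ x₁) (λ x₂ y₂ → C z y₂ x₂ * h x₁ y₁ x₂ y₂)))))
             (∑₂-*ʳ (cherries-at z) (λ x₁ y₁ → C z y₁ x₁ * ∑₂ (λ x₂ y₂ → C z y₂ x₂ * h x₁ y₁ x₂ y₂)))) ⟩
      ∑ (λ z → ∑₂ (λ x₁ y₁ → C z y₁ x₁ * ∑₂ (λ x₂ y₂ → C z y₂ x₂ * h x₁ y₁ x₂ y₂)) * cherries-at z)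
        ≤⟨ ∑-mono (λ z → *-mono-≤ (≤-trans (∑₂-mono λ x₁ y₁ → *-monoʳ-≤ (C z y₁ x₁) (le z x₁ y₁))
             (≤-trans (≤-reflexive (∑₂-*ʳ k (λ x₁ y₁ → C z y₁ x₁))) (*-monoˡ-≤ k (cherries-at≤ z))))
             (≤-trans (cherries-at≤ z) (𝟙*≤ (S z) (Δ * Δ)))) ⟩
      ∑ (λ z → 𝟙 (S z) * (Δ * Δ) * k * (Δ * Δ)) ≡⟨ ∑-cong (λ z → assoc (𝟙 (S z)) (Δ * Δ) k) ⟩
      ∑ (λ z → 𝟙 (S z) * (Δ * Δ * k * (Δ * Δ))) ≤⟨ ∑S≤ (Δ * Δ * k * (Δ * Δ)) ⟩
      n * (Δ * Δ * k * (Δ * Δ)) ∎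
      where
      open ≤-Reasoning
      reorder : ∀ a b c h → a * (b * (c * h)) ≡ a * (b * h) * c
      reorder = solve-∀
      assoc : ∀ s d k → s * d * k * d ≡ s * (d * k * d)
      assoc = solve-∀

    same-end : T (λ x₁ _ x₂ _ _ _ → δ x₁ x₂) ≤ n * (Δ * Δ * H * (Δ * Δ))
    same-end = T-two (λ x₁ _ x₂ _ → δ x₁ x₂) H λ z x₁ y₁ → begin
      ∑ (λ x₂ → ∑ λ y₂ → C z y₂ x₂ * δ x₁ x₂) ≡⟨ ∑-cong (λ x₂ → trans (∑-*ʳ (δ x₁ x₂) (λ y₂ → C z y₂ x₂)) (*-comm _ (δ x₁ x₂))) ⟩
      ∑ (λ x₂ → δ x₁ x₂ * ∑ (λ y₂ → C z y₂ x₂)) ≡⟨ ∑-δ x₁ (λ x₂ → ∑ (λ y₂ → C z y₂ x₂)) ⟩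
      ∑ (λ y₂ → C z y₂ x₁) ≤⟨ ∑C-middle z x₁ ⟩
      H ∎
      where open ≤-Reasoning

    same-middle : T (λ _ y₁ _ y₂ _ _ → δ y₁ y₂) ≤ n * (Δ * Δ * Δ * (Δ * Δ))
    same-middle = T-two (λ _ y₁ _ y₂ → δ y₁ y₂) Δ λ z x₁ y₁ → begin
      ∑ (λ x₂ → ∑ λ y₂ → C z y₂ x₂ * δ y₁ y₂) ≡⟨ ∑-cong (λ x₂ → trans (∑-cong λ y₂ → *-comm (C z y₂ x₂) (δ y₁ y₂)) (∑-δ y₁ (λ y₂ → C z y₂ x₂))) ⟩
      ∑ (λ x₂ → C z y₁ x₂) ≤⟨ ∑C-end z y₁ ⟩
      E z y₁ * Δ ≤⟨ 𝟙*≤ (e z y₁) Δ ⟩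
      Δ ∎
      where open ≤-Reasoning

    big : V → V → V → Bool
    big y x x′ = M <ᵇ f y x x′

    big-weight : Weight
    big-weight x₁ y₁ x₂ y₂ x₃ y₃ = ne x₂ x₃ * (ne y₂ y₃ * 𝟙 (big y₁ x₂ x₃))

    big-constant : ℕ
    big-constant = H * (light-bound + Δ) * (Δ * (H * H))

    -- For fixed x₂, x₃ and big y₁ there are f choices of z, at most Δ of x₁ and H² of the other
    -- middles. As f exceeds M, M f ≤ f², and `second-moment` applies.
    big-bound : M * T big-weight ≤ n * (Δ * Δ * (Δ * Δ)) * big-constant
    big-bound = begin
      M * T big-weight ≤⟨ *-monoʳ-≤ M T≤ ⟩
      M * ∑₂ (λ x₂ x₃ → ∑ λ y₁ → ne x₂ x₃ * (𝟙 (big y₁ x₂ x₃) * f y₁ x₂ x₃) * k)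
        ≡⟨ trans (sym (∑₂-*ˡ M _)) (∑₂-cong λ x₂ x₃ → sym (∑-*ˡ M (λ y₁ → ne x₂ x₃ * (𝟙 (big y₁ x₂ x₃) * f y₁ x₂ x₃) * k))) ⟩
      ∑₂ (λ x₂ x₃ → ∑ λ y₁ → M * (ne x₂ x₃ * (𝟙 (big y₁ x₂ x₃) * f y₁ x₂ x₃) * k))
        ≤⟨ ∑₂-mono (λ x₂ x₃ → ∑-mono λ y₁ → ≤-trans (≤-reflexive (move-M M (ne x₂ x₃) (𝟙 (big y₁ x₂ x₃) * f y₁ x₂ x₃) k))
             (*-monoˡ-≤ k (*-monoʳ-≤ (ne x₂ x₃) (threshold (f y₁ x₂ x₃))))) ⟩
      ∑₂ (λ x₂ x₃ → ∑ λ y₁ → ne x₂ x₃ * (f y₁ x₂ x₃ * f y₁ x₂ x₃) * k)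
        ≡⟨ ∑₂-cong (λ x₂ x₃ → trans (∑-*ʳ k (λ y₁ → ne x₂ x₃ * (f y₁ x₂ x₃ * f y₁ x₂ x₃))) (cong (_* k) (∑-*ˡ (ne x₂ x₃) (λ y₁ → f y₁ x₂ x₃ * f y₁ x₂ x₃)))) ⟩
      ∑₂ (λ x₂ x₃ → ne x₂ x₃ * ∑ (λ y₁ → f y₁ x₂ x₃ * f y₁ x₂ x₃) * k)
        ≤⟨ ∑₂-mono (λ x₂ x₃ → *-monoˡ-≤ k (if-distinct x₂ x₃)) ⟩
      ∑₂ (λ x₂ x₃ → H * ((light-bound + Δ) * ∑ (q x₂ x₃)) * k)
        ≡⟨ trans (∑₂-cong λ x₂ x₃ → collect H (light-bound + Δ) (∑ (q x₂ x₃)) k) (∑₂-*ʳ big-constant (λ x₂ x₃ → ∑ (q x₂ x₃))) ⟩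
      ∑₂ (λ x₂ x₃ → ∑ (q x₂ x₃)) * big-constant ≤⟨ *-monoˡ-≤ big-constant q-total ⟩
      n * (Δ * Δ * (Δ * Δ)) * big-constant ∎
      where
      open ≤-Reasoning
      k = Δ * (H * H)
      move-M : ∀ M a b k → M * (a * b * k) ≡ a * (M * b) * k
      move-M = solve-∀
      collect : ∀ a b c k → a * (b * c) * k ≡ c * (a * b * k)
      collect = solve-∀
      threshold : ∀ t → M * (𝟙 (M <ᵇ t) * t) ≤ t * t
      threshold t with M <ᵇ t in eq
      ... | false = ≤-trans (≤-reflexive (*-zeroʳ M)) z≤n
      ... | true  = *-mono-≤ (<⇒≤ (<ᵇ⇒< M t (subst True (sym eq) _))) (≤-reflexive (+-identityʳ t))
      if-distinct : ∀ x x′ → ne x x′ * ∑ (λ y → f y x x′ * f y x x′) ≤ H * ((light-bound + Δ) * ∑ (q x x′))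
      if-distinct x x′ with x ≟ x′
      ... | yes _ = z≤n
      ... | no x≢x′ = ≤-trans (≤-reflexive (*-identityˡ _)) (second-moment x≢x′)
      q-total : ∑₂ (λ x₂ x₃ → ∑ (q x₂ x₃)) ≤ n * (Δ * Δ * (Δ * Δ))
      q-total = begin
        ∑ (λ x₂ → ∑ λ x₃ → ∑ λ z → q x₂ x₃ z) ≡⟨ ∑-cong (λ x₂ → ∑-comm (λ x₃ z → q x₂ x₃ z)) ⟩
        ∑ (λ x₂ → ∑ λ z → ∑ λ x₃ → q x₂ x₃ z) ≡⟨ ∑-comm (λ x₂ z → ∑ λ x₃ → q x₂ x₃ z) ⟩
        ∑ (λ z → ∑ λ x₂ → ∑ λ x₃ → q x₂ x₃ z) ≤⟨ ∑-mono (λ z → ∑₂-mono λ x₂ x₃ → ≤-trans (q≤κ x₂ x₃ z) (κ≤C*C x₂ x₃ z)) ⟩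
        ∑ (λ z → ∑₂ λ x₂ x₃ → ∑ (λ y → C z y x₂) * ∑ (λ y → C z y x₃)) ≡⟨ ∑-cong (λ z → sym (∑-product (λ x → ∑ (λ y → C z y x)) (λ x → ∑ (λ y → C z y x)))) ⟩
        ∑ (λ z → cherries-at z * cherries-at z) ≤⟨ ∑-mono (λ z → *-mono-≤ (cherries-at≤ z) (≤-trans (cherries-at≤ z) (𝟙*≤ (S z) (Δ * Δ)))) ⟩
        ∑ (λ z → 𝟙 (S z) * (Δ * Δ) * (Δ * Δ)) ≡⟨ ∑-cong (λ z → *-assoc (𝟙 (S z)) (Δ * Δ) (Δ * Δ)) ⟩
        ∑ (λ z → 𝟙 (S z) * (Δ * Δ * (Δ * Δ))) ≤⟨ ∑S≤ (Δ * Δ * (Δ * Δ)) ⟩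
        n * (Δ * Δ * (Δ * Δ)) ∎
      b : V → V → V → ℕ
      b y₁ x₂ x₃ = ne x₂ x₃ * 𝟙 (big y₁ x₂ x₃)
      inner : ∀ z y₁ → ∑₂ (λ x₂ y₂ → ∑₂ λ x₃ y₃ → C z y₂ x₂ * (C z y₃ x₃ * (ne x₂ x₃ * (ne y₂ y₃ * 𝟙 (big y₁ x₂ x₃))))) ≡ ∑₂ (λ x₂ x₃ → b y₁ x₂ x₃ * κ x₂ x₃ z)
      inner z y₁ = ∑-cong λ x₂ → trans (∑-comm (λ y₂ x₃ → ∑ λ y₃ → C z y₂ x₂ * (C z y₃ x₃ * (ne x₂ x₃ * (ne y₂ y₃ * 𝟙 (big y₁ x₂ x₃))))))
        (∑-cong λ x₃ → trans (∑₂-cong λ y₂ y₃ → factor (C z y₂ x₂) (C z y₃ x₃) (ne x₂ x₃) (ne y₂ y₃) (𝟙 (big y₁ x₂ x₃)))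
          (∑₂-*ˡ (b y₁ x₂ x₃) (λ y₂ y₃ → C z y₂ x₂ * (C z y₃ x₃ * ne y₂ y₃))))
        where
        factor : ∀ c c′ m m′ t → c * (c′ * (m * (m′ * t))) ≡ m * t * (c * (c′ * m′))
        factor = solve-∀
      T≤ : T big-weight ≤ ∑₂ (λ x₂ x₃ → ∑ λ y₁ → ne x₂ x₃ * (𝟙 (big y₁ x₂ x₃) * f y₁ x₂ x₃) * k)
      T≤ = begin
        T big-weight
          ≡⟨ ∑-cong (λ z → ∑₂-cong λ x₁ y₁ → trans (trans (∑₂-cong λ x₂ y₂ → ∑₂-*ˡ (C z y₁ x₁) (λ x₃ y₃ → C z y₂ x₂ * (C z y₃ x₃ * (ne x₂ x₃ * (ne y₂ y₃ * 𝟙 (big y₁ x₂ x₃))))))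
               (∑₂-*ˡ (C z y₁ x₁) (λ x₂ y₂ → ∑₂ λ x₃ y₃ → C z y₂ x₂ * (C z y₃ x₃ * (ne x₂ x₃ * (ne y₂ y₃ * 𝟙 (big y₁ x₂ x₃))))))) (cong (C z y₁ x₁ *_) (inner z y₁))) ⟩
        ∑ (λ z → ∑₂ λ x₁ y₁ → C z y₁ x₁ * W z y₁) ≡⟨ ∑-cong (λ z → trans (∑-comm (λ x₁ y₁ → C z y₁ x₁ * W z y₁)) (∑-cong λ y₁ → ∑-*ʳ (W z y₁) (λ x₁ → C z y₁ x₁))) ⟩
        ∑ (λ z → ∑ λ y₁ → ∑ (λ x₁ → C z y₁ x₁) * W z y₁)
          ≤⟨ ∑-mono (λ z → ∑-mono λ y₁ → *-mono-≤ (∑C-end z y₁) (∑₂-mono λ x₂ x₃ → *-monoʳ-≤ (b y₁ x₂ x₃) (κ≤q x₂ x₃ z))) ⟩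
        ∑ (λ z → ∑ λ y₁ → E z y₁ * Δ * ∑₂ (λ x₂ x₃ → b y₁ x₂ x₃ * (q x₂ x₃ z * (H * H))))
          ≡⟨ ∑-cong (λ z → ∑-cong λ y₁ → trans (sym (∑₂-*ˡ (E z y₁ * Δ) (λ x₂ x₃ → b y₁ x₂ x₃ * (q x₂ x₃ z * (H * H))))) (∑₂-cong λ x₂ x₃ → pointwise z y₁ x₂ x₃)) ⟩
        ∑₂ (λ z y₁ → ∑₂ λ x₂ x₃ → ne x₂ x₃ * 𝟙 (big y₁ x₂ x₃) * k * 𝟙 (e z y₁ ∧ linked x₂ x₃ z))
          ≡⟨ ∑₂-comm (λ z y₁ x₂ x₃ → ne x₂ x₃ * 𝟙 (big y₁ x₂ x₃) * k * 𝟙 (e z y₁ ∧ linked x₂ x₃ z)) ⟩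
        ∑₂ (λ x₂ x₃ → ∑ λ z → ∑ λ y₁ → ne x₂ x₃ * 𝟙 (big y₁ x₂ x₃) * k * 𝟙 (e z y₁ ∧ linked x₂ x₃ z))
          ≡⟨ ∑₂-cong (λ x₂ x₃ → trans (∑-comm (λ z y₁ → ne x₂ x₃ * 𝟙 (big y₁ x₂ x₃) * k * 𝟙 (e z y₁ ∧ linked x₂ x₃ z)))
               (∑-cong λ y₁ → trans (∑-*ˡ (ne x₂ x₃ * 𝟙 (big y₁ x₂ x₃) * k) (λ z → 𝟙 (e z y₁ ∧ linked x₂ x₃ z))) (regroup (ne x₂ x₃) (𝟙 (big y₁ x₂ x₃)) k (f y₁ x₂ x₃)))) ⟩
        ∑₂ (λ x₂ x₃ → ∑ λ y₁ → ne x₂ x₃ * (𝟙 (big y₁ x₂ x₃) * f y₁ x₂ x₃) * k) ∎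
        where
        W : V → V → ℕ
        W z y₁ = ∑₂ λ x₂ x₃ → b y₁ x₂ x₃ * κ x₂ x₃ z
        regroup : ∀ m t k g → m * t * k * g ≡ m * (t * g) * k
        regroup = solve-∀
        shuffle : ∀ E d m t q h → E * d * (m * t * (q * h)) ≡ m * t * (d * h) * (E * q)
        shuffle = solve-∀
        pointwise : ∀ z y₁ x₂ x₃ → E z y₁ * Δ * (b y₁ x₂ x₃ * (q x₂ x₃ z * (H * H))) ≡ ne x₂ x₃ * 𝟙 (big y₁ x₂ x₃) * k * 𝟙 (e z y₁ ∧ linked x₂ x₃ z)
        pointwise z y₁ x₂ x₃ = trans (shuffle (E z y₁) Δ (ne x₂ x₃) (𝟙 (big y₁ x₂ x₃)) (q x₂ x₃ z) (H * H))
          (cong (ne x₂ x₃ * 𝟙 (big y₁ x₂ x₃) * k *_) (sym (𝟙-∧ (e z y₁) (linked x₂ x₃ z))))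

    calm : (x₁ x₂ x₃ y₁ y₂ y₃ : V) → Bool
    calm x₁ x₂ x₃ y₁ y₂ y₃ = not (big y₁ x₂ x₃) ∧ (not (big y₂ x₁ x₃) ∧ not (big y₃ x₁ x₂))

    distinct₃ : V → V → V → Bool
    distinct₃ u v w = not (does (u ≟ v)) ∧ (not (does (u ≟ w)) ∧ not (does (v ≟ w)))

    good : (x₁ y₁ x₂ y₂ x₃ y₃ : V) → Bool
    good x₁ y₁ x₂ y₂ x₃ y₃ = distinct₃ x₁ x₂ x₃ ∧ (distinct₃ y₁ y₂ y₃ ∧ calm x₁ x₂ x₃ y₁ y₂ y₃)

    good-constant : ℕ
    good-constant = 99 * (H * (H * H) + 3 * (M * (H * H)))

    calm-config : (x₁ x₂ x₃ z y₁ y₂ y₃ : V) → Bool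
    calm-config x₁ x₂ x₃ z y₁ y₂ y₃ = config x₁ x₂ x₃ z y₁ y₂ y₃ ∧ calm x₁ x₂ x₃ y₁ y₂ y₃

    calm-config≤ : ∀ x₁ x₂ x₃ z y₁ y₂ y₃ → 𝟙 (calm-config x₁ x₂ x₃ z y₁ y₂ y₃) ≤ 𝟙 (config x₁ x₂ x₃ z y₁ y₂ y₃)
    calm-config≤ x₁ x₂ x₃ z y₁ y₂ y₃ = 𝟙-∧≤ (config x₁ x₂ x₃ z y₁ y₂ y₃) (calm x₁ x₂ x₃ y₁ y₂ y₃)

    not-big⇒≤ : ∀ t → (M <ᵇ t) ≡ false → t ≤ M
    not-big⇒≤ t eq = ≮⇒≥ λ lt → subst True eq (<⇒<ᵇ lt)

    -- pos selects one of the three middle vertices, x and x′ are the two other ends.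
    calm-at : ∀ x₁ x₂ x₃ v x x′ (pos : V → V → V → V) →
      (∀ y₁ y₂ y₃ → calm x₁ x₂ x₃ y₁ y₂ y₃ ≡ true → big (pos y₁ y₂ y₃) x x′ ≡ false) →
      ∑⁴ (λ z y₁ y₂ y₃ → 𝟙 (config x₁ x₂ x₃ z y₁ y₂ y₃) * δ v (pos y₁ y₂ y₃)) ≤ E-κ v x x′ →
      ∑⁴ (λ z y₁ y₂ y₃ → 𝟙 (calm-config x₁ x₂ x₃ z y₁ y₂ y₃) * δ v (pos y₁ y₂ y₃)) ≤ M * (H * H)
    calm-at x₁ x₂ x₃ v x x′ pos not-big le with big v x x′ in eq
    ... | false = ≤-trans (∑⁴-mono λ z y₁ y₂ y₃ → *-monoˡ-≤ (δ v (pos y₁ y₂ y₃)) (calm-config≤ x₁ x₂ x₃ z y₁ y₂ y₃))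
                    (≤-trans le (≤-trans (E-κ≤f v x x′) (*-monoˡ-≤ (H * H) (not-big⇒≤ (f v x x′) eq))))
    -- No calm configuration has a big vertex in this position, so every term vanishes.
    ... | true = ≤-trans (≤-reflexive (trans (∑⁴-cong λ z y₁ y₂ y₃ → vanish z y₁ y₂ y₃) ∑⁴-zero)) z≤n
      where
      vanish : ∀ z y₁ y₂ y₃ → 𝟙 (calm-config x₁ x₂ x₃ z y₁ y₂ y₃) * δ v (pos y₁ y₂ y₃) ≡ 0
      vanish z y₁ y₂ y₃ with v ≟ pos y₁ y₂ y₃
      ... | no _ = *-zeroʳ (𝟙 (calm-config x₁ x₂ x₃ z y₁ y₂ y₃))
      ... | yes refl with calm x₁ x₂ x₃ y₁ y₂ y₃ in cq
      ...   | false = trans (*-identityʳ _) (𝟙-∧-false (config x₁ x₂ x₃ z y₁ y₂ y₃))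
      ...   | true with trans (sym eq) (not-big y₁ y₂ y₃ cq)
      ...     | ()

    calm-configs : ∀ {x₁ x₂ x₃} → x₁ ≢ x₂ → x₁ ≢ x₃ → x₂ ≢ x₃ →
      ∑⁴ (λ z y₁ y₂ y₃ → 𝟙 (calm-config x₁ x₂ x₃ z y₁ y₂ y₃)) ≤ good-constant
    calm-configs {x₁} {x₂} {x₃} n₁₂ n₁₃ n₂₃ = few-configurations free n₁₂ n₁₃ n₂₃ (calm-config x₁ x₂ x₃)
      (λ {z} {y₁} {y₂} {y₃} h → config-valid (proj₁ (∧-true (config x₁ x₂ x₃ z y₁ y₂ y₃) h))) (H * (H * H)) (M * (H * H))
      (λ v → ≤-trans (∑⁴-mono λ z y₁ y₂ y₃ → *-monoˡ-≤ (δ v z) (calm-config≤ x₁ x₂ x₃ z y₁ y₂ y₃)) (config-at-z x₁ x₂ x₃ v))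
      (λ v → calm-at x₁ x₂ x₃ v x₂ x₃ (λ y₁ _ _ → y₁) (λ y₁ y₂ y₃ h → negate (proj₁ (∧-true (not (big y₁ x₂ x₃)) h))) (config-at-y₁ x₁ x₂ x₃ v))
      (λ v → calm-at x₁ x₂ x₃ v x₁ x₃ (λ _ y₂ _ → y₂) (λ y₁ y₂ y₃ h → negate (proj₁ (∧-true (not (big y₂ x₁ x₃)) (proj₂ (∧-true (not (big y₁ x₂ x₃)) h))))) (config-at-y₂ x₁ x₂ x₃ v))
      (λ v → calm-at x₁ x₂ x₃ v x₁ x₂ (λ _ _ y₃ → y₃) (λ y₁ y₂ y₃ h → negate (proj₂ (∧-true (not (big y₂ x₁ x₃)) (proj₂ (∧-true (not (big y₁ x₂ x₃)) h))))) (config-at-y₃ x₁ x₂ x₃ v))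
      where
      negate : ∀ {b} → not b ≡ true → b ≡ false
      negate {false} _ = refl

    good-weight : Weight
    good-weight x₁ y₁ x₂ y₂ x₃ y₃ = 𝟙 (good x₁ y₁ x₂ y₂ x₃ y₃)

    good-bound : T good-weight ≤ n * (n * (n * good-constant))
    good-bound = begin
      T good-weight ≡⟨ ∑-cong (λ z → ∑-cong λ x₁ → ∑-cong λ y₁ → ∑-cong λ x₂ → ∑-comm (λ y₂ x₃ → ∑ λ y₃ → t x₁ x₂ x₃ z y₁ y₂ y₃)) ⟩
      ∑ (λ z → ∑ λ x₁ → ∑ λ y₁ → ∑ λ x₂ → ∑ λ x₃ → ∑ λ y₂ → ∑ λ y₃ → t x₁ x₂ x₃ z y₁ y₂ y₃)
        ≡⟨ ∑-cong (λ z → ∑-cong λ x₁ → trans (∑-comm (λ y₁ x₂ → ∑ λ x₃ → ∑ λ y₂ → ∑ λ y₃ → t x₁ x₂ x₃ z y₁ y₂ y₃))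
             (∑-cong λ x₂ → ∑-comm (λ y₁ x₃ → ∑ λ y₂ → ∑ λ y₃ → t x₁ x₂ x₃ z y₁ y₂ y₃))) ⟩
      ∑ (λ z → ∑ λ x₁ → ∑ λ x₂ → ∑ λ x₃ → ∑ λ y₁ → ∑ λ y₂ → ∑ λ y₃ → t x₁ x₂ x₃ z y₁ y₂ y₃)
        ≡⟨ trans (∑-comm (λ z x₁ → ∑ λ x₂ → ∑ λ x₃ → ∑ λ y₁ → ∑ λ y₂ → ∑ λ y₃ → t x₁ x₂ x₃ z y₁ y₂ y₃))
             (∑-cong λ x₁ → trans (∑-comm (λ z x₂ → ∑ λ x₃ → ∑ λ y₁ → ∑ λ y₂ → ∑ λ y₃ → t x₁ x₂ x₃ z y₁ y₂ y₃))
               (∑-cong λ x₂ → ∑-comm (λ z x₃ → ∑ λ y₁ → ∑ λ y₂ → ∑ λ y₃ → t x₁ x₂ x₃ z y₁ y₂ y₃))) ⟩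
      ∑ (λ x₁ → ∑ λ x₂ → ∑ λ x₃ → ∑⁴ (t x₁ x₂ x₃)) ≤⟨ ∑-mono (λ x₁ → ∑-mono λ x₂ → ∑-mono λ x₃ → per-triple x₁ x₂ x₃) ⟩
      ∑ (λ x₁ → ∑ λ x₂ → ∑ λ x₃ → 𝟙 (S x₁) * (𝟙 (S x₂) * (𝟙 (S x₃) * good-constant)))
        ≡⟨ ∑-cong (λ x₁ → trans (∑-cong λ x₂ → trans (∑-*ˡ (𝟙 (S x₁)) (λ x₃ → 𝟙 (S x₂) * (𝟙 (S x₃) * good-constant)))
               (cong (𝟙 (S x₁) *_) (∑-*ˡ (𝟙 (S x₂)) (λ x₃ → 𝟙 (S x₃) * good-constant)))) (∑-*ˡ (𝟙 (S x₁)) (λ x₂ → 𝟙 (S x₂) * k₁))) ⟩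
      ∑ (λ x₁ → 𝟙 (S x₁) * ∑ (λ x₂ → 𝟙 (S x₂) * k₁)) ≤⟨ ∑-mono (λ x₁ → *-monoʳ-≤ (𝟙 (S x₁)) (≤-trans (∑S≤ k₁) (*-monoʳ-≤ n (∑S≤ good-constant)))) ⟩
      ∑ (λ x₁ → 𝟙 (S x₁) * (n * (n * good-constant))) ≤⟨ ∑S≤ (n * (n * good-constant)) ⟩
      n * (n * (n * good-constant)) ∎
      where
      open ≤-Reasoning
      k₁ = ∑ (λ x₃ → 𝟙 (S x₃) * good-constant)
      t : (x₁ x₂ x₃ z y₁ y₂ y₃ : V) → ℕ
      t x₁ x₂ x₃ z y₁ y₂ y₃ = C z y₁ x₁ * (C z y₂ x₂ * (C z y₃ x₃ * good-weight x₁ y₁ x₂ y₂ x₃ y₃))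
      cherry-S : ∀ z y x → cherry z y x ≡ true → S x ≡ true
      cherry-S z y x h = e-S x y (proj₁ (∧-true (e x y) (proj₂ (∧-true (e z y) h))))
      C-S : ∀ z y x → C z y x ≤ 𝟙 (S x)
      C-S z y x with cherry z y x in eq
      ... | false = z≤n
      ... | true  = ≤-reflexive (sym (cong 𝟙 (cherry-S z y x eq)))
      merge : ∀ a b c d p k → 𝟙 a * (𝟙 b * (𝟙 c * 𝟙 (d ∧ (p ∧ k)))) ≤ 𝟙 d * 𝟙 ((a ∧ (b ∧ (c ∧ p))) ∧ k)
      merge false b c d p k = z≤n
      merge true false c d p k = z≤n
      merge true true false d p k = z≤n
      merge true true true false p k = z≤n
      merge true true true true false k = z≤n
      merge true true true true true k = ≤-reflexive (drop-ones (𝟙 k))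
        where
        drop-ones : ∀ k → 1 * (1 * (1 * k)) ≡ 1 * k
        drop-ones = solve-∀
      plain : ∀ x₁ x₂ x₃ → ∑⁴ (t x₁ x₂ x₃) ≤ good-constant
      plain x₁ x₂ x₃ = ≤-trans (∑⁴-mono λ z y₁ y₂ y₃ → merge (cherry z y₁ x₁) (cherry z y₂ x₂) (cherry z y₃ x₃) (distinct₃ x₁ x₂ x₃) (distinct₃ y₁ y₂ y₃) (calm x₁ x₂ x₃ y₁ y₂ y₃))
        (by-distinctness (distinct₃ x₁ x₂ x₃) refl)
        where
        by-distinctness : ∀ d → distinct₃ x₁ x₂ x₃ ≡ d → ∑⁴ (λ z y₁ y₂ y₃ → 𝟙 d * 𝟙 (calm-config x₁ x₂ x₃ z y₁ y₂ y₃)) ≤ good-constant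
        by-distinctness false _ = ≤-trans (≤-reflexive ∑⁴-zero) z≤n
        by-distinctness true h = ≤-trans (≤-reflexive (∑⁴-cong λ z y₁ y₂ y₃ → *-identityˡ (𝟙 (calm-config x₁ x₂ x₃ z y₁ y₂ y₃))))
          (calm-configs (does-false x₁ x₂ (proj₁ h₁)) (does-false x₁ x₃ (proj₁ h₂)) (does-false x₂ x₃ (proj₂ h₂)))
          where
          h₁ = ∧-true (not (does (x₁ ≟ x₂))) h
          h₂ = ∧-true (not (does (x₁ ≟ x₃))) (proj₂ h₁)
      C-zero : ∀ z y x → S x ≡ false → C z y x ≡ 0
      C-zero z y x h = n≤0⇒n≡0 (subst (C z y x ≤_) (cong 𝟙 h) (C-S z y x))
      zero₁ : ∀ {a} → a ≡ 0 → ∀ b → a * b ≡ 0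
      zero₁ refl b = refl
      -- The indicators of `S` make the final count cubic in `n` rather than in `N`.
      per-triple : ∀ x₁ x₂ x₃ → ∑⁴ (t x₁ x₂ x₃) ≤ 𝟙 (S x₁) * (𝟙 (S x₂) * (𝟙 (S x₃) * good-constant))
      per-triple x₁ x₂ x₃ = ≤-𝟙* (S x₁) (≤-𝟙* (S x₂) (≤-𝟙* (S x₃) (plain x₁ x₂ x₃)
          (λ h → trans (∑⁴-cong λ z y₁ y₂ y₃ → trans (cong (λ c → C z y₁ x₁ * (C z y₂ x₂ * c)) (zero₁ (C-zero z y₃ x₃ h) _)) (trans (cong (C z y₁ x₁ *_) (*-zeroʳ (C z y₂ x₂))) (*-zeroʳ (C z y₁ x₁)))) ∑⁴-zero))
          (λ h → trans (∑⁴-cong λ z y₁ y₂ y₃ → trans (cong (C z y₁ x₁ *_) (zero₁ (C-zero z y₂ x₂ h) _)) (*-zeroʳ (C z y₁ x₁))) ∑⁴-zero))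
          (λ h → trans (∑⁴-cong λ z y₁ y₂ y₃ → zero₁ (C-zero z y₁ x₁ h) _) ∑⁴-zero)

    triples : ℕ
    triples = T (λ _ _ _ _ _ _ → 1)

    same-end-constant same-middle-constant : ℕ
    same-end-constant = n * (Δ * Δ * H * (Δ * Δ))
    same-middle-constant = n * (Δ * Δ * Δ * (Δ * Δ))

    -- A triple repeats an end, repeats a middle, has a big middle or is good. The three positions
    -- within each of the first three classes are exchanged by the symmetries of `T`.
    triples-bound : M * triples ≤
      M * (3 * same-end-constant + 3 * same-middle-constant) + 3 * (n * (Δ * Δ * (Δ * Δ)) * big-constant) + M * (n * (n * (n * good-constant)))
    triples-bound = begin
      M * triples ≤⟨ *-monoʳ-≤ M (T-mono λ x₁ y₁ x₂ y₂ x₃ y₃ → cases (does (x₁ ≟ x₂)) (does (x₁ ≟ x₃)) (does (x₂ ≟ x₃))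
          (does (y₁ ≟ y₂)) (does (y₁ ≟ y₃)) (does (y₂ ≟ y₃)) (big y₁ x₂ x₃) (big y₂ x₁ x₃) (big y₃ x₁ x₂)) ⟩
      M * T (λ x₁ y₁ x₂ y₂ x₃ y₃ → xs x₁ y₁ x₂ y₂ x₃ y₃ + (ys x₁ y₁ x₂ y₂ x₃ y₃ + (bs x₁ y₁ x₂ y₂ x₃ y₃ + good-weight x₁ y₁ x₂ y₂ x₃ y₃)))
        ≡⟨ cong (M *_) (trans (T-+ xs _) (cong (T xs +_) (trans (T-+ ys _) (cong (T ys +_) (T-+ bs good-weight))))) ⟩
      M * (T xs + (T ys + (T bs + T good-weight))) ≡⟨ distribute M (T xs) (T ys) (T bs) (T good-weight) ⟩
      M * (T xs + T ys) + M * T bs + M * T good-weight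
        ≤⟨ +-mono-≤ (+-mono-≤ (*-monoʳ-≤ M (+-mono-≤ xs-bound ys-bound)) bs-bound) (*-monoʳ-≤ M good-bound) ⟩
      M * (3 * same-end-constant + 3 * same-middle-constant) + 3 * (n * (Δ * Δ * (Δ * Δ)) * big-constant) + M * (n * (n * (n * good-constant))) ∎
      where
      open ≤-Reasoning
      distribute : ∀ M a b c d → M * (a + (b + (c + d))) ≡ M * (a + b) + M * c + M * d
      distribute = solve-∀
      three-times : ∀ a → a + (a + a) ≡ 3 * a
      three-times = solve-∀
      x₁₂ x₁₃ x₂₃ y₁₂ y₁₃ y₂₃ b₂ b₃ xs ys bs : Weight
      x₁₂ x₁ y₁ x₂ y₂ x₃ y₃ = δ x₁ x₂
      x₁₃ x₁ y₁ x₂ y₂ x₃ y₃ = δ x₁ x₃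
      x₂₃ x₁ y₁ x₂ y₂ x₃ y₃ = δ x₂ x₃
      y₁₂ x₁ y₁ x₂ y₂ x₃ y₃ = δ y₁ y₂
      y₁₃ x₁ y₁ x₂ y₂ x₃ y₃ = δ y₁ y₃
      y₂₃ x₁ y₁ x₂ y₂ x₃ y₃ = δ y₂ y₃
      b₂ x₁ y₁ x₂ y₂ x₃ y₃ = big-weight x₂ y₂ x₁ y₁ x₃ y₃
      b₃ x₁ y₁ x₂ y₂ x₃ y₃ = big-weight x₃ y₃ x₁ y₁ x₂ y₂
      xs x₁ y₁ x₂ y₂ x₃ y₃ = δ x₁ x₂ + (δ x₁ x₃ + δ x₂ x₃)
      ys x₁ y₁ x₂ y₂ x₃ y₃ = δ y₁ y₂ + (δ y₁ y₃ + δ y₂ y₃)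
      bs x₁ y₁ x₂ y₂ x₃ y₃ = big-weight x₁ y₁ x₂ y₂ x₃ y₃ + (b₂ x₁ y₁ x₂ y₂ x₃ y₃ + b₃ x₁ y₁ x₂ y₂ x₃ y₃)
      xs-bound : T xs ≤ 3 * same-end-constant
      xs-bound = begin
        T xs ≡⟨ trans (T-+ x₁₂ _) (cong (T x₁₂ +_) (T-+ x₁₃ x₂₃)) ⟩
        T x₁₂ + (T x₁₃ + T x₂₃) ≡⟨ cong₂ (λ s t → T x₁₂ + (s + t)) (T-swap₂₃ x₁₃) (trans (T-swap₁₂ x₂₃) (T-swap₂₃ x₁₃)) ⟩
        T x₁₂ + (T x₁₂ + T x₁₂) ≤⟨ +-mono-≤ same-end (+-mono-≤ same-end same-end) ⟩
        same-end-constant + (same-end-constant + same-end-constant) ≡⟨ three-times same-end-constant ⟩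
        3 * same-end-constant ∎
      ys-bound : T ys ≤ 3 * same-middle-constant
      ys-bound = begin
        T ys ≡⟨ trans (T-+ y₁₂ _) (cong (T y₁₂ +_) (T-+ y₁₃ y₂₃)) ⟩
        T y₁₂ + (T y₁₃ + T y₂₃) ≡⟨ cong₂ (λ s t → T y₁₂ + (s + t)) (T-swap₂₃ y₁₃) (trans (T-swap₁₂ y₂₃) (T-swap₂₃ y₁₃)) ⟩
        T y₁₂ + (T y₁₂ + T y₁₂) ≤⟨ +-mono-≤ same-middle (+-mono-≤ same-middle same-middle) ⟩
        same-middle-constant + (same-middle-constant + same-middle-constant) ≡⟨ three-times same-middle-constant ⟩
        3 * same-middle-constant ∎
      bs-bound : M * T bs ≤ 3 * (n * (Δ * Δ * (Δ * Δ)) * big-constant)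
      bs-bound = begin
        M * T bs ≡⟨ cong (M *_) (trans (T-+ big-weight _) (cong (T big-weight +_) (T-+ b₂ b₃))) ⟩
        M * (T big-weight + (T b₂ + T b₃)) ≡⟨ cong₂ (λ s t → M * (T big-weight + (s + t))) (T-swap₁₂ b₂) (trans (T-swap₂₃ b₃) (T-swap₁₂ b₂)) ⟩
        M * (T big-weight + (T big-weight + T big-weight)) ≡⟨ spread M (T big-weight) ⟩
        M * T big-weight + (M * T big-weight + M * T big-weight) ≤⟨ +-mono-≤ big-bound (+-mono-≤ big-bound big-bound) ⟩
        _ ≡⟨ three-times (n * (Δ * Δ * (Δ * Δ)) * big-constant) ⟩
        3 * (n * (Δ * Δ * (Δ * Δ)) * big-constant) ∎
        where
        spread : ∀ M t → M * (t + (t + t)) ≡ M * t + (M * t + M * t)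
        spread = solve-∀
      cases : ∀ p q r p′ q′ r′ b₁ b₂ b₃ → 1 ≤ (𝟙 p + (𝟙 q + 𝟙 r)) + ((𝟙 p′ + (𝟙 q′ + 𝟙 r′)) +
        ((𝟙 (not r) * (𝟙 (not r′) * 𝟙 b₁) + (𝟙 (not q) * (𝟙 (not q′) * 𝟙 b₂) + 𝟙 (not p) * (𝟙 (not p′) * 𝟙 b₃)))
         + 𝟙 ((not p ∧ (not q ∧ not r)) ∧ ((not p′ ∧ (not q′ ∧ not r′)) ∧ (not b₁ ∧ (not b₂ ∧ not b₃))))))
      cases true q r p′ q′ r′ b₁ b₂ b₃ = s≤s z≤n
      cases false true r p′ q′ r′ b₁ b₂ b₃ = s≤s z≤n
      cases false false true p′ q′ r′ b₁ b₂ b₃ = s≤s z≤n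
      cases false false false true q′ r′ b₁ b₂ b₃ = s≤s z≤n
      cases false false false false true r′ b₁ b₂ b₃ = s≤s z≤n
      cases false false false false false true b₁ b₂ b₃ = s≤s z≤n
      cases false false false false false false true b₂ b₃ = s≤s z≤n
      cases false false false false false false false true b₃ = s≤s z≤n
      cases false false false false false false false false true = s≤s z≤n
      cases false false false false false false false false false = ≤-refl

    edges cherries : ℕ
    edges = ∑ λ y → ∑ λ x → E x y
    cherries = ∑ cherries-at

    S-absorb : ∀ k b → (b ≡ false → k ≡ 0) → 𝟙 b * k ≡ k
    S-absorb k true  _ = *-identityˡ k
    S-absorb k false h = sym (h refl)

    -- Cauchy's inequality over `S`, then `many-light-pairs` in each neighbourhood.
    edges²≤ : edges * edges ≤ n * (H * (cherries + edges))
    edges²≤ = begin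
      edges * edges ≡⟨ cong (λ t → t * t) (∑-cong λ y → sym (S-absorb (∑ λ x → E x y) (S y) (λ h → trans (∑-cong λ x → zero-degree x y h) (∑-zero N)))) ⟩
      ∑ (λ y → 𝟙 (S y) * ∑ (λ x → E x y)) * ∑ (λ y → 𝟙 (S y) * ∑ (λ x → E x y)) ≤⟨ cauchy (𝟙 ∘ S) (λ y → ∑ λ x → E x y) ⟩
      ∑ (𝟙 ∘ S) * ∑ (λ y → 𝟙 (S y) * (∑ (λ x → E x y) * ∑ (λ x → E x y)))
        ≤⟨ *-mono-≤ size (∑-mono λ y → ≤-trans (𝟙*≤ (S y) _) (many-light-pairs (λ x → e x y))) ⟩
      n * ∑ (λ y → H * (∑ (λ x → ∑ λ z → E x y * (E z y * 𝟙 (light x z))) + ∑ (λ x → E x y)))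
        ≡⟨ cong (n *_) (trans (∑-*ˡ H (λ y → ∑ (λ x → ∑ λ z → E x y * (E z y * 𝟙 (light x z))) + ∑ (λ x → E x y))) (cong (H *_) (trans (∑-distrib-+ (λ y → ∑ λ x → ∑ λ z → E x y * (E z y * 𝟙 (light x z))) (λ y → ∑ λ x → E x y)) (cong (_+ edges) total)))) ⟩
      n * (H * (cherries + edges)) ∎
      where
      open ≤-Reasoning
      zero-degree : ∀ x y → S y ≡ false → E x y ≡ 0
      zero-degree x y h = trans (cong (λ b → 𝟙 (S x ∧ (b ∧ adj G x y))) h) (𝟙-∧-false (S x))
      regroup : ∀ a b c → 𝟙 a * (𝟙 b * 𝟙 c) ≡ 𝟙 (b ∧ (a ∧ c))
      regroup a b c = trans (shuffle (𝟙 a) (𝟙 b) (𝟙 c)) (sym (trans (𝟙-∧ b (a ∧ c)) (cong (𝟙 b *_) (𝟙-∧ a c))))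
        where
        shuffle : ∀ a b c → a * (b * c) ≡ b * (a * c)
        shuffle = solve-∀
      total : ∑ (λ y → ∑ λ x → ∑ λ z → E x y * (E z y * 𝟙 (light x z))) ≡ cherries
      total = trans (∑-cong λ y → ∑-cong λ x → ∑-cong λ z → regroup (e x y) (e z y) (light x z))
        (trans (∑-comm (λ y x → ∑ λ z → C z y x)) (trans (∑-cong λ x → ∑-comm (λ y z → C z y x)) (∑-comm (λ x z → ∑ λ y → C z y x))))

    cherries³≤ : cherries * (cherries * cherries) ≤ n * n * triples
    cherries³≤ = begin
      cherries * (cherries * cherries) ≡⟨ cong (λ t → t * (t * t)) (∑-cong λ z → sym (S-absorb (cherries-at z) (S z) (λ h → n≤0⇒n≡0 (subst (λ b → cherries-at z ≤ 𝟙 b * (Δ * Δ)) h (cherries-at≤ z))))) ⟩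
      c * (c * c) ≤⟨ power-mean-cube (𝟙 ∘ S) cherries-at ⟩
      ∑ (𝟙 ∘ S) * ∑ (𝟙 ∘ S) * ∑ (λ z → 𝟙 (S z) * (cherries-at z * (cherries-at z * cherries-at z)))
        ≤⟨ *-mono-≤ (*-mono-≤ size size) (∑-mono λ z → 𝟙*≤ (S z) _) ⟩
      n * n * ∑ (λ z → cherries-at z * (cherries-at z * cherries-at z)) ≡⟨ cong (n * n *_) (sym T-one) ⟩
      n * n * triples ∎
      where
      open ≤-Reasoning
      c = ∑ λ z → 𝟙 (S z) * cherries-at z

  -- The arithmetic that excludes a dense free graph.

  cube : ℕ → ℕ
  cube x = x * (x * x)

  cube-mono : ∀ {a b} → a ≤ b → cube a ≤ cube b
  cube-mono le = *-mono-≤ le (*-mono-≤ le le)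

  cube-cancel-≤ : ∀ {a b} → cube a ≤ cube b → a ≤ b
  cube-cancel-≤ {a} {b} le with a ≤? b
  ... | yes h = h
  ... | no h  = ⊥-elim (<⇒≱ (*-mono-< (≰⇒> h) (*-mono-< (≰⇒> h) (≰⇒> h))) le)

  -- Each of the four terms of the bound on the number of triples is at most a fifth of M ε⁶.
  module Arithmetic (n Δ ε Λ T H K c M B C₄ ℓ : ℕ)
    (edges² : ε * ε ≤ n * (H * (Λ + ε)))
    (cherries³ : cube Λ ≤ n * n * T)
    (triples : M * T ≤ M * (3 * (n * (Δ * Δ * H * (Δ * Δ))) + 3 * (n * (Δ * Δ * Δ * (Δ * Δ))))
                       + 3 * (n * (Δ * Δ * (Δ * Δ)) * (H * ℓ * (Δ * (H * H)))) + M * (n * (n * (n * C₄))))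
    (ℓ≤ : ℓ ≤ c * Δ) (nΔ≤ : n * Δ ≤ K * ε) (dense : cube B * (n * cube n) ≤ cube ε) (1≤n : 1 ≤ n) (1≤M : 1 ≤ M)
    (B₀ : 1 ≤ B) (B₁ : 2 * H ≤ B)
    (B₂ : 5 * (8 * cube H) * (3 * H) * (K * K * (K * K)) ≤ B)
    (B₃ : 5 * (8 * cube H) * 3 * (K * (K * K * (K * K))) ≤ B)
    (B₄ : 5 * (8 * cube H) * C₄ ≤ B)
    (M-large : 5 * (8 * cube H) * (3 * (cube H * c)) * cube (K * K) ≤ M) where

    open ≤-Reasoning

    Bn≤ε : B * n ≤ ε
    Bn≤ε = cube-cancel-≤ (begin
      cube (B * n) ≡⟨ id₁ B n ⟩
      cube B * (1 * cube n) ≤⟨ *-monoʳ-≤ (cube B) (*-monoˡ-≤ (cube n) 1≤n) ⟩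
      cube B * (n * cube n) ≤⟨ dense ⟩
      cube ε ∎)
      where
      id₁ : ∀ B n → B * n * (B * n * (B * n)) ≡ B * (B * B) * (1 * (n * (n * n)))
      id₁ = solve-∀

    n≤ε : n ≤ ε
    n≤ε = ≤-trans (≤-trans (≤-reflexive (sym (*-identityˡ n))) (*-monoˡ-≤ n B₀)) Bn≤ε

    -- After doubling, the term 2 H n ε is at most ε² because 2 H ≤ B and B n ≤ ε, so it can be
    -- subtracted.
    ε²≤ : ε * ε ≤ 2 * n * H * Λ
    ε²≤ = +-cancelʳ-≤ (ε * ε) _ _ (begin
      ε * ε + ε * ε ≤⟨ +-mono-≤ edges² edges² ⟩
      n * (H * (Λ + ε)) + n * (H * (Λ + ε)) ≡⟨ id₁ n H Λ ε ⟩
      2 * n * H * Λ + 2 * H * n * ε ≤⟨ +-monoʳ-≤ (2 * n * H * Λ) (*-monoˡ-≤ ε (≤-trans (*-monoˡ-≤ n B₁) Bn≤ε)) ⟩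
      2 * n * H * Λ + ε * ε ∎)
      where
      id₁ : ∀ n H Λ ε → n * (H * (Λ + ε)) + n * (H * (Λ + ε)) ≡ 2 * n * H * Λ + 2 * H * n * ε
      id₁ = solve-∀

    P : ℕ
    P = cube (ε * ε)

    n⁵ : ℕ
    n⁵ = n * n * cube n

    P≤ : P ≤ 8 * cube H * (n⁵ * T)
    P≤ = begin
      cube (ε * ε) ≤⟨ cube-mono ε²≤ ⟩
      cube (2 * n * H * Λ) ≡⟨ id₁ n H Λ ⟩
      8 * cube H * (cube n * cube Λ) ≤⟨ *-monoʳ-≤ (8 * cube H) (*-monoʳ-≤ (cube n) cherries³) ⟩
      8 * cube H * (cube n * (n * n * T)) ≡⟨ cong (8 * cube H *_) (id₂ (cube n) (n * n) T) ⟩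
      8 * cube H * (n⁵ * T) ∎
      where
      id₁ : ∀ n H Λ → 2 * n * H * Λ * (2 * n * H * Λ * (2 * n * H * Λ)) ≡ 8 * (H * (H * H)) * (n * (n * n) * (Λ * (Λ * Λ)))
      id₁ = solve-∀
      id₂ : ∀ a b c → a * (b * c) ≡ b * a * c
      id₂ = solve-∀

    A₀ : ℕ
    A₀ = 8 * cube H

    -- Repeated ends, repeated middles, big middles and good triples. Apart from constants the terms
    -- are M (nΔ)⁴ n², M (nΔ)⁵ n, (nΔ)⁶ and M n⁸, to be compared with M ε⁶. The first two gain from
    -- B n ≤ ε, the third lacks the factor M, and the fourth uses the full density B³ n⁴ ≤ ε³.
    t₁ t₂ t₃ t₄ : ℕ
    t₁ = A₀ * (n⁵ * (M * (3 * (n * (Δ * Δ * H * (Δ * Δ))))))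
    t₂ = A₀ * (n⁵ * (M * (3 * (n * (Δ * Δ * Δ * (Δ * Δ))))))
    t₃ = A₀ * (n⁵ * (3 * (n * (Δ * Δ * (Δ * Δ)) * (H * ℓ * (Δ * (H * H))))))
    t₄ = A₀ * (n⁵ * (M * (n * (n * (n * C₄)))))

    MP≤ : M * P ≤ t₁ + t₂ + t₃ + t₄
    MP≤ = begin
      M * P ≤⟨ *-monoʳ-≤ M P≤ ⟩
      M * (A₀ * (n⁵ * T)) ≡⟨ id₁ M A₀ n⁵ T ⟩
      A₀ * (n⁵ * (M * T)) ≤⟨ *-monoʳ-≤ A₀ (*-monoʳ-≤ n⁵ triples) ⟩
      A₀ * (n⁵ * (M * (s₁ + s₂) + s₃ + s₄)) ≡⟨ id₂ A₀ n⁵ M s₁ s₂ s₃ s₄ ⟩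
      t₁ + t₂ + t₃ + t₄ ∎
      where
      s₁ = 3 * (n * (Δ * Δ * H * (Δ * Δ)))
      s₂ = 3 * (n * (Δ * Δ * Δ * (Δ * Δ)))
      s₃ = 3 * (n * (Δ * Δ * (Δ * Δ)) * (H * ℓ * (Δ * (H * H))))
      s₄ = M * (n * (n * (n * C₄)))
      id₁ : ∀ M A n T → M * (A * (n * T)) ≡ A * (n * (M * T))
      id₁ = solve-∀
      id₂ : ∀ A n M a b c d → A * (n * (M * (a + b) + c + d)) ≡ A * (n * (M * a)) + A * (n * (M * b)) + A * (n * c) + A * (n * d)
      id₂ = solve-∀

    u v : ℕ
    u = n * Δ
    v = K * ε

    u²≤ : u * u ≤ v * v
    u²≤ = *-mono-≤ nΔ≤ nΔ≤

    5t₁≤ : 5 * t₁ ≤ M * P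
    5t₁≤ = begin
      5 * t₁ ≡⟨ id₁ A₀ n M Δ H ⟩
      5 * A₀ * (3 * H) * M * (u * u * (u * u)) * (n * n) ≤⟨ *-monoˡ-≤ (n * n) (*-monoʳ-≤ (5 * A₀ * (3 * H) * M) (*-mono-≤ u²≤ u²≤)) ⟩
      5 * A₀ * (3 * H) * M * (v * v * (v * v)) * (n * n) ≡⟨ id₂ (5 * A₀ * (3 * H)) M K ε n ⟩
      M * (ε * ε * (ε * ε)) * (5 * A₀ * (3 * H) * (K * K * (K * K)) * n * n) ≤⟨ *-monoʳ-≤ (M * (ε * ε * (ε * ε))) (*-mono-≤ (≤-trans (*-monoˡ-≤ n B₂) Bn≤ε) n≤ε) ⟩
      M * (ε * ε * (ε * ε)) * (ε * ε) ≡⟨ id₃ M ε ⟩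
      M * P ∎
      where
      id₁ : ∀ A n M Δ H → 5 * (A * (n * n * (n * (n * n)) * (M * (3 * (n * (Δ * Δ * H * (Δ * Δ))))))) ≡
        5 * A * (3 * H) * M * (n * Δ * (n * Δ) * (n * Δ * (n * Δ))) * (n * n)
      id₁ = solve-∀
      id₂ : ∀ a M K ε n → a * M * (K * ε * (K * ε) * (K * ε * (K * ε))) * (n * n) ≡ M * (ε * ε * (ε * ε)) * (a * (K * K * (K * K)) * n * n)
      id₂ = solve-∀
      id₃ : ∀ M ε → M * (ε * ε * (ε * ε)) * (ε * ε) ≡ M * (ε * ε * (ε * ε * (ε * ε)))
      id₃ = solve-∀

    5t₂≤ : 5 * t₂ ≤ M * P
    5t₂≤ = begin
      5 * t₂ ≡⟨ id₁ A₀ n M Δ ⟩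
      5 * A₀ * 3 * M * (u * (u * u * (u * u))) * n ≤⟨ *-monoˡ-≤ n (*-monoʳ-≤ (5 * A₀ * 3 * M) (*-mono-≤ nΔ≤ (*-mono-≤ u²≤ u²≤))) ⟩
      5 * A₀ * 3 * M * (v * (v * v * (v * v))) * n ≡⟨ id₂ (5 * A₀ * 3) M K ε n ⟩
      M * (ε * (ε * ε * (ε * ε))) * (5 * A₀ * 3 * (K * (K * K * (K * K))) * n) ≤⟨ *-monoʳ-≤ (M * (ε * (ε * ε * (ε * ε)))) (≤-trans (*-monoˡ-≤ n B₃) Bn≤ε) ⟩
      M * (ε * (ε * ε * (ε * ε))) * ε ≡⟨ id₃ M ε ⟩
      M * P ∎
      where
      id₁ : ∀ A n M Δ → 5 * (A * (n * n * (n * (n * n)) * (M * (3 * (n * (Δ * Δ * Δ * (Δ * Δ))))))) ≡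
        5 * A * 3 * M * (n * Δ * (n * Δ * (n * Δ) * (n * Δ * (n * Δ)))) * n
      id₁ = solve-∀
      id₂ : ∀ a M K ε n → a * M * (K * ε * (K * ε * (K * ε) * (K * ε * (K * ε)))) * n ≡ M * (ε * (ε * ε * (ε * ε))) * (a * (K * (K * K * (K * K))) * n)
      id₂ = solve-∀
      id₃ : ∀ M ε → M * (ε * (ε * ε * (ε * ε))) * ε ≡ M * (ε * ε * (ε * ε * (ε * ε)))
      id₃ = solve-∀

    5t₃≤ : 5 * t₃ ≤ M * P
    5t₃≤ = begin
      5 * t₃ ≤⟨ *-monoʳ-≤ 5 (*-monoʳ-≤ A₀ (*-monoʳ-≤ n⁵ (*-monoʳ-≤ 3 (*-monoʳ-≤ (n * (Δ * Δ * (Δ * Δ))) (*-monoˡ-≤ (Δ * (H * H)) (*-monoʳ-≤ H ℓ≤)))))) ⟩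
      5 * (A₀ * (n⁵ * (3 * (n * (Δ * Δ * (Δ * Δ)) * (H * (c * Δ) * (Δ * (H * H))))))) ≡⟨ id₁ A₀ n Δ H c ⟩
      5 * A₀ * (3 * (cube H * c)) * cube (u * u) ≤⟨ *-monoʳ-≤ (5 * A₀ * (3 * (cube H * c))) (cube-mono u²≤) ⟩
      5 * A₀ * (3 * (cube H * c)) * cube (v * v) ≡⟨ id₂ (5 * A₀ * (3 * (cube H * c))) K ε ⟩
      5 * A₀ * (3 * (cube H * c)) * cube (K * K) * P ≤⟨ *-monoˡ-≤ P M-large ⟩
      M * P ∎
      where
      id₁ : ∀ A n Δ H c → 5 * (A * (n * n * (n * (n * n)) * (3 * (n * (Δ * Δ * (Δ * Δ)) * (H * (c * Δ) * (Δ * (H * H))))))) ≡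
        5 * A * (3 * (H * (H * H) * c)) * (n * Δ * (n * Δ) * (n * Δ * (n * Δ) * (n * Δ * (n * Δ))))
      id₁ = solve-∀
      id₂ : ∀ a K ε → a * (K * ε * (K * ε) * (K * ε * (K * ε) * (K * ε * (K * ε)))) ≡
        a * (K * K * (K * K * (K * K))) * (ε * ε * (ε * ε * (ε * ε)))
      id₂ = solve-∀

    5t₄≤ : 5 * t₄ ≤ M * P
    5t₄≤ = begin
      5 * t₄ ≡⟨ id₁ A₀ n M C₄ ⟩
      M * (5 * A₀ * C₄ * (n * cube n * (n * cube n))) ≤⟨ *-monoʳ-≤ M (*-monoˡ-≤ (n * cube n * (n * cube n)) (≤-trans B₄ B≤B⁶)) ⟩
      M * (cube B * cube B * (n * cube n * (n * cube n))) ≡⟨ cong (M *_) (id₂ (cube B) (n * cube n)) ⟩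
      M * (cube B * (n * cube n) * (cube B * (n * cube n))) ≤⟨ *-monoʳ-≤ M (*-mono-≤ dense dense) ⟩
      M * (cube ε * cube ε) ≡⟨ cong (M *_) (id₃ ε) ⟩
      M * P ∎
      where
      id₁ : ∀ A n M C → 5 * (A * (n * n * (n * (n * n)) * (M * (n * (n * (n * C)))))) ≡ M * (5 * A * C * (n * (n * (n * n)) * (n * (n * (n * n)))))
      id₁ = solve-∀
      id₂ : ∀ b m → b * b * (m * m) ≡ b * m * (b * m)
      id₂ = solve-∀
      id₃ : ∀ ε → ε * (ε * ε) * (ε * (ε * ε)) ≡ ε * ε * (ε * ε * (ε * ε))
      id₃ = solve-∀
      B≤B⁶ : B ≤ cube B * cube B
      B≤B⁶ = begin
        B ≡⟨ id₄ B ⟩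
        cube 1 * (1 * (B * 1)) ≤⟨ *-mono-≤ (cube-mono B₀) (*-mono-≤ B₀ (*-monoʳ-≤ B B₀)) ⟩
        cube B * cube B ∎
        where
        id₄ : ∀ B → B ≡ 1 * (1 * (B * 1))
        id₄ = solve-∀

    contradiction : ⊥
    contradiction = <⇒≱ 0<MP (+-cancelˡ-≤ (4 * (M * P)) (M * P) 0 (begin
      4 * (M * P) + M * P ≡⟨ id₁ (M * P) ⟩
      5 * (M * P) ≤⟨ *-monoʳ-≤ 5 MP≤ ⟩
      5 * (t₁ + t₂ + t₃ + t₄) ≡⟨ id₂ t₁ t₂ t₃ t₄ ⟩
      5 * t₁ + 5 * t₂ + 5 * t₃ + 5 * t₄ ≤⟨ +-mono-≤ (+-mono-≤ (+-mono-≤ 5t₁≤ 5t₂≤) 5t₃≤) 5t₄≤ ⟩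
      M * P + M * P + M * P + M * P ≡⟨ id₃ (M * P) ⟩
      4 * (M * P) + 0 ∎))
      where
      id₁ : ∀ x → 4 * x + x ≡ 5 * x
      id₁ = solve-∀
      id₂ : ∀ a b c d → 5 * (a + b + c + d) ≡ 5 * a + 5 * b + 5 * c + 5 * d
      id₂ = solve-∀
      id₃ : ∀ x → x + x + x + x ≡ 4 * x + 0
      id₃ = solve-∀
      0<ε : 0 < ε
      0<ε = ≤-trans 1≤n n≤ε
      0<MP : 0 < M * P
      0<MP = *-mono-< 1≤M (*-mono-< ε² (*-mono-< ε² ε²))
        where ε² = *-mono-< 0<ε 0<ε

  -- Choice of constants and reduction to bounded maximum degree.

  firsts : ∀ {n} → ℕ → (Fin n → Bool) → Fin n → Bool
  firsts zero    P i       = false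
  firsts (suc b) P zero    = P zero
  firsts (suc b) P (suc i) with P zero
  ... | true  = firsts b (P ∘ suc) i
  ... | false = firsts (suc b) (P ∘ suc) i

  size-firsts : ∀ {n} b (P : Fin n → Bool) → ∑ (𝟙 ∘ firsts b P) ≤ b
  size-firsts {n} zero P = ≤-reflexive (∑-zero n)
  size-firsts {zero} (suc b) P = z≤n
  size-firsts {suc n} (suc b) P with P zero
  ... | true  = s≤s (size-firsts b (P ∘ suc))
  ... | false = size-firsts (suc b) (P ∘ suc)

  size-rest : ∀ {n} b m (P : Fin n → Bool) → ∑ (𝟙 ∘ P) ≤ b + m → ∑ (λ i → 𝟙 (P i ∧ not (firsts b P i))) ≤ m
  size-rest zero m P le = ≤-trans (∑-mono λ i → 𝟙-∧≤ (P i) true) le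
  size-rest {zero} (suc b) m P le = z≤n
  size-rest {suc n} (suc b) m P le with P zero
  ... | true  = size-rest b m (P ∘ suc) (≤-pred le)
  ... | false = size-rest (suc b) m (P ∘ suc) le

  -- The order of choice is `c`, `M`, `C₄`, `B`, each depending only on `H`, `K` and earlier ones.
  -- The factor in `4 * K` comes from n Δ ≤ 2 K e and from keeping only half of e.
  record Constants (H K : ℕ) : Set where
    field
      c M C₄ B : ℕ
      c≡ : c ≡ (H * H + H * H) + (99 * (cube H + 3 * (H * H)) + 1)
      C₄≡ : C₄ ≡ 99 * (H * (H * H) + 3 * (M * (H * H)))
      1≤M : 1 ≤ M
      M-large : 5 * (8 * cube H) * (3 * (cube H * c)) * cube (4 * K * (4 * K)) ≤ M
      1≤B : 1 ≤ B
      B₁ : 2 * H ≤ B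
      B₂ : 5 * (8 * cube H) * (3 * H) * (4 * K * (4 * K) * (4 * K * (4 * K))) ≤ B
      B₃ : 5 * (8 * cube H) * 3 * (4 * K * (4 * K * (4 * K) * (4 * K * (4 * K)))) ≤ B
      B₄ : 5 * (8 * cube H) * C₄ ≤ B
      K≤B : K ≤ B

  constants : ∀ H K → Constants H K
  constants H K = record
    { c = c ; M = M ; C₄ = C₄ ; B = suc (2 * H) + (β₂ + (β₃ + (β₄ + K)))
    ; c≡ = refl ; C₄≡ = refl ; 1≤M = s≤s z≤n ; M-large = n≤1+n _ ; 1≤B = s≤s z≤n
    ; B₁ = ≤-trans (n≤1+n (2 * H)) (m≤m+n (suc (2 * H)) _)
    ; B₂ = ≤-trans (m≤m+n β₂ _) (m≤n+m _ (suc (2 * H)))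
    ; B₃ = ≤-trans (m≤m+n β₃ _) (≤-trans (m≤n+m _ β₂) (m≤n+m _ (suc (2 * H))))
    ; B₄ = ≤-trans (m≤m+n β₄ K) (≤-trans (m≤n+m _ β₃) (≤-trans (m≤n+m _ β₂) (m≤n+m _ (suc (2 * H)))))
    ; K≤B = ≤-trans (m≤n+m K β₄) (≤-trans (m≤n+m _ β₃) (≤-trans (m≤n+m _ β₂) (m≤n+m _ (suc (2 * H)))))
    }
    where
    c = (H * H + H * H) + (99 * (cube H + 3 * (H * H)) + 1)
    m₀ = 5 * (8 * cube H) * (3 * (cube H * c)) * cube (4 * K * (4 * K))
    M = suc m₀
    C₄ = 99 * (H * (H * H) + 3 * (M * (H * H)))
    β₂ = 5 * (8 * cube H) * (3 * H) * (4 * K * (4 * K) * (4 * K * (4 * K)))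
    β₃ = 5 * (8 * cube H) * 3 * (4 * K * (4 * K * (4 * K) * (4 * K * (4 * K))))
    β₄ = 5 * (8 * cube H) * C₄

  module Regularise {N : ℕ} (G : SimpleGraph N) (free : HFree G (subdivision (K 3 25)))
    (H : ℕ) (102<H : 102 < H) (K : ℕ) (K-large : 4 * 4 * 4 * (4 * 4 * (4 * 4)) ≤ K) (constants : Constants H K) where

    open Constants constants
    open ≤-Reasoning

    V : Set
    V = Fin N

    ∣_∣ : (V → Bool) → ℕ
    ∣ S ∣ = ∑ (𝟙 ∘ S)

    ends : (V → Bool) → V → V → ℕ
    ends S x y = 𝟙 (S x ∧ (S y ∧ adj G x y))

    e₂ : (V → Bool) → ℕ
    e₂ S = ∑ λ x → ∑ (ends S x)

    -- The factor 8 = 2³ pays for losing up to half of the edges when vertices of large degree are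
    -- removed.
    A : ℕ
    A = 8 * cube B

    Bounded : (V → Bool) → Set
    Bounded S = cube (e₂ S) ≤ A * (∣ S ∣ * cube ∣ S ∣)

    1≤K : 1 ≤ K
    1≤K = ≤-trans (s≤s z≤n) K-large

    K²≤A : K * K ≤ A
    K²≤A = begin
      K * K ≤⟨ *-mono-≤ K≤B K≤B ⟩
      B * B ≡⟨ sym (*-identityˡ (B * B)) ⟩
      1 * (B * B) ≤⟨ *-monoˡ-≤ (B * B) 1≤B ⟩
      cube B ≤⟨ m≤n*m (cube B) 8 ⟩
      A ∎

    e₂≤sq : ∀ S → e₂ S ≤ ∣ S ∣ * ∣ S ∣
    e₂≤sq S = ≤-trans (∑-mono λ x → ∑-mono λ y → pointwise (S x) (S y) (adj G x y)) (≤-reflexive (sym (∑-product (𝟙 ∘ S) (𝟙 ∘ S))))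
      where
      pointwise : ∀ a b c → 𝟙 (a ∧ (b ∧ c)) ≤ 𝟙 a * 𝟙 b
      pointwise true true c = 𝟙≤1 c
      pointwise true false c = z≤n
      pointwise false b c = z≤n

    small : ∀ S → ∣ S ∣ ≤ K → Bounded S
    small S le = begin
      cube (e₂ S) ≤⟨ cube-mono (e₂≤sq S) ⟩
      cube (s * s) ≡⟨ id₁ s ⟩
      s * s * (s * cube s) ≤⟨ *-monoˡ-≤ (s * cube s) (≤-trans (*-mono-≤ le le) K²≤A) ⟩
      A * (s * cube s) ∎
      where
      s = ∣ S ∣
      id₁ : ∀ s → s * s * (s * s * (s * s)) ≡ s * s * (s * (s * (s * s)))
      id₁ = solve-∀

    module Minimal (S : V → Bool) (K<n : K < ∣ S ∣) (IH : ∀ S′ → ∣ S′ ∣ < ∣ S ∣ → Bounded S′)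
      (dense : A * (∣ S ∣ * cube ∣ S ∣) < cube (e₂ S)) where

      n e : ℕ
      n = ∣ S ∣
      e = e₂ S

      1≤n : 1 ≤ n
      1≤n = ≤-trans (s≤s z≤n) K<n

      instance
        n≢0 : NonZero n
        n≢0 = >-nonZero 1≤n
        K≢0 : NonZero K
        K≢0 = >-nonZero 1≤K

      n≤e : n ≤ e
      n≤e = cube-cancel-≤ (begin
        cube n ≡⟨ sym (*-identityˡ (cube n)) ⟩
        1 * cube n ≤⟨ *-mono-≤ 1≤n (≤-refl {cube n}) ⟩
        n * cube n ≡⟨ sym (*-identityˡ (n * cube n)) ⟩
        1 * (n * cube n) ≤⟨ *-monoˡ-≤ (n * cube n) (≤-trans (*-mono-≤ 1≤K 1≤K) K²≤A) ⟩
        A * (n * cube n) ≤⟨ <⇒≤ dense ⟩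
        cube e ∎)

      Δ : ℕ
      -- Rounding up makes n Δ exceed K e and Δ positive; the cost `n` is at most `e`.
      Δ = suc (K * e / n)

      degree : V → ℕ
      degree x = ∑ (ends S x)

      Ke<nΔ : K * e < n * Δ
      Ke<nΔ = begin-strict
        K * e ≡⟨ m≡m%n+[m/n]*n (K * e) n ⟩
        K * e % n + K * e / n * n <⟨ +-monoˡ-< (K * e / n * n) (m%n<n (K * e) n) ⟩
        n + K * e / n * n ≡⟨ *-comm Δ n ⟩
        n * Δ ∎

      nΔ≤ : n * Δ ≤ K * e + e
      nΔ≤ = begin
        n * Δ ≡⟨ *-comm n Δ ⟩
        n + K * e / n * n ≤⟨ +-mono-≤ n≤e (m/n*n≤m (K * e) n) ⟩
        e + K * e ≡⟨ +-comm e (K * e) ⟩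
        K * e + e ∎

      top : V → Bool
      top x = S x ∧ (Δ <ᵇ degree x)

      topΔ≤e : ∣ top ∣ * Δ ≤ e
      topΔ≤e = ≤-trans (≤-reflexive (sym (∑-*ʳ Δ (𝟙 ∘ top)))) (∑-mono λ x → pointwise (S x) (degree x))
        where
        pointwise : ∀ a d → 𝟙 (a ∧ (Δ <ᵇ d)) * Δ ≤ d
        pointwise false d = z≤n
        pointwise true d with Δ <ᵇ d in eq
        ... | false = z≤n
        ... | true  = ≤-trans (≤-reflexive (*-identityˡ Δ)) (<⇒≤ (<ᵇ⇒< Δ d (subst True (sym eq) _)))

      K*top<n : K * ∣ top ∣ < n
      K*top<n = *-cancelʳ-< _ _ _ (≤-<-trans (≤-trans (≤-reflexive (*-assoc K ∣ top ∣ Δ)) (*-monoʳ-≤ K topΔ≤e)) Ke<nΔ)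

      b : ℕ
      -- Rounding up makes K blocks of size `b` cover `S`; by K < n the excess still leaves K b ≤ 2
      -- n.
      b = suc (n / K)

      n<Kb : n < K * b
      n<Kb = begin-strict
        n ≡⟨ m≡m%n+[m/n]*n n K ⟩
        n % K + n / K * K <⟨ +-monoˡ-< (n / K * K) (m%n<n n K) ⟩
        K + n / K * K ≡⟨ *-comm b K ⟩
        K * b ∎

      Kb≤2n : K * b ≤ n + n
      Kb≤2n = begin
        K * b ≡⟨ *-comm K b ⟩
        K + n / K * K ≤⟨ +-mono-≤ (<⇒≤ K<n) (m/n*n≤m n K) ⟩
        n + n ∎

      top≤b : ∣ top ∣ ≤ b
      top≤b = <⇒≤ (*-cancelˡ-< K _ _ (<-trans K*top<n n<Kb))

      K2b≤4n : K * (b + b) ≤ 4 * n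
      K2b≤4n = begin
        K * (b + b) ≡⟨ *-distribˡ-+ K b b ⟩
        K * b + K * b ≤⟨ +-mono-≤ Kb≤2n Kb≤2n ⟩
        (n + n) + (n + n) ≡⟨ id₁ n ⟩
        4 * n ∎
        where
        id₁ : ∀ n → (n + n) + (n + n) ≡ 4 * n
        id₁ = solve-∀

      2b<n : b + b < n
      2b<n = *-cancelˡ-< K _ _ (≤-<-trans K2b≤4n (*-monoˡ-< n (≤-trans (m≤m+n 5 _) K-large)))

      cross : (V → Bool) → ℕ
      cross P = ∑ λ x → ∑ λ y → 𝟙 (top x ∧ (P y ∧ adj G x y))

      -- A set of at most q n / K vertices has edge count cubed at most A (q n / K)⁴. Multiplying by
      -- (q K)³ leaves q⁷ / K times A n⁴, which explains the condition q⁷ ≤ K.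
      piece-arithmetic : ∀ q e′ → q * q * q * (q * q * (q * q)) ≤ K → K * (b + b) ≤ q * n →
        cube e′ ≤ A * ((b + b) * cube (b + b)) → cube (q * K * e′) ≤ A * (n * cube n)
      piece-arithmetic q e′ qK le h = *-cancelˡ-≤ K (begin
        K * cube (q * K * e′) ≡⟨ id₁ K q e′ ⟩
        q * q * q * (K * K * (K * K) * cube e′) ≤⟨ *-monoʳ-≤ (q * q * q) (*-monoʳ-≤ (K * K * (K * K)) h) ⟩
        q * q * q * (K * K * (K * K) * (A * ((b + b) * cube (b + b)))) ≡⟨ id₂ q K A (b + b) ⟩
        q * q * q * (A * (K * (b + b) * cube (K * (b + b)))) ≤⟨ *-monoʳ-≤ (q * q * q) (*-monoʳ-≤ A (*-mono-≤ le (cube-mono le))) ⟩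
        q * q * q * (A * (q * n * cube (q * n))) ≡⟨ id₃ q A n ⟩
        q * q * q * (q * q * (q * q)) * (A * (n * cube n)) ≤⟨ *-monoˡ-≤ (A * (n * cube n)) qK ⟩
        K * (A * (n * cube n)) ∎)
        where
        id₁ : ∀ K q e → K * (q * K * e * (q * K * e * (q * K * e))) ≡ q * q * q * (K * K * (K * K) * (e * (e * e)))
        id₁ = solve-∀
        id₂ : ∀ q K A t → q * q * q * (K * K * (K * K) * (A * (t * (t * (t * t))))) ≡ q * q * q * (A * (K * t * (K * t * (K * t * (K * t)))))
        id₂ = solve-∀
        id₃ : ∀ q A n → q * q * q * (A * (q * n * (q * n * (q * n * (q * n))))) ≡ q * q * q * (q * q * (q * q)) * (A * (n * (n * (n * n))))
        id₃ = solve-∀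

      -- The top vertices and one block together form a set smaller than `S`, to which the
      -- minimality hypothesis applies. This saves more than the factor K that summing over K blocks
      -- loses.
      piece : ∀ P → ∣ P ∣ ≤ b → 4 * K * cross P ≤ e
      piece P le = ≤-trans (*-monoʳ-≤ (4 * K) cross≤) (cube-cancel-≤ (≤-trans
        (piece-arithmetic 4 (e₂ U) K-large K2b≤4n (≤-trans (IH U (≤-<-trans U≤ 2b<n)) (*-monoʳ-≤ A (*-mono-≤ U≤ (cube-mono U≤))))) (<⇒≤ dense)))
        where
        U : V → Bool
        U x = top x ∨ P x
        U≤ : ∣ U ∣ ≤ b + b
        U≤ = ≤-trans (∑-mono λ x → union (top x) (P x)) (≤-trans (≤-reflexive (∑-distrib-+ (𝟙 ∘ top) (𝟙 ∘ P))) (+-mono-≤ top≤b le))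
          where
          union : ∀ a c → 𝟙 (a ∨ c) ≤ 𝟙 a + 𝟙 c
          union true c = s≤s z≤n
          union false c = ≤-refl
        cross≤ : cross P ≤ e₂ U
        cross≤ = ∑-mono λ x → ∑-mono λ y → pointwise (top x) (P x) (top y) (P y) (adj G x y)
          where
          pointwise : ∀ t p t′ p′ a → 𝟙 (t ∧ (p′ ∧ a)) ≤ 𝟙 ((t ∨ p) ∧ ((t′ ∨ p′) ∧ a))
          pointwise false p t′ p′ a = z≤n
          pointwise true p t′ false a = z≤n
          pointwise true p true true a = ≤-refl
          pointwise true p false true a = ≤-refl

      pieces : ∀ J P → ∣ P ∣ ≤ J * b → 4 * K * cross P ≤ J * e
      pieces zero P le = ≤-reflexive (trans (cong (4 * K *_) (n≤0⇒n≡0 (begin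
        cross P ≤⟨ ∑-mono (λ x → ∑-mono λ y → pointwise (top x) (P y) (adj G x y)) ⟩
        ∑ {N} (λ _ → ∣ P ∣) ≡⟨ trans (∑-cong {N} λ _ → n≤0⇒n≡0 le) (∑-zero N) ⟩
        0 ∎))) (*-zeroʳ (4 * K)))
        where
        pointwise : ∀ t p a → 𝟙 (t ∧ (p ∧ a)) ≤ 𝟙 p
        pointwise false p a = z≤n
        pointwise true true a = 𝟙≤1 a
        pointwise true false a = z≤n
      pieces (suc J) P le = begin
        4 * K * cross P ≤⟨ *-monoʳ-≤ (4 * K) (≤-trans (∑-mono λ x → ≤-trans (∑-mono λ y → pointwise (top x) (P y) (P₁ y) (adj G x y)) (≤-reflexive (∑-distrib-+ (row P₁ x) (row P₂ x)))) (≤-reflexive (∑-distrib-+ (λ x → ∑ (row P₁ x)) (λ x → ∑ (row P₂ x))))) ⟩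
        4 * K * (cross P₁ + cross P₂) ≡⟨ *-distribˡ-+ (4 * K) (cross P₁) (cross P₂) ⟩
        4 * K * cross P₁ + 4 * K * cross P₂ ≤⟨ +-mono-≤ (piece P₁ (size-firsts b P)) (pieces J P₂ (size-rest b (J * b) P le)) ⟩
        suc J * e ∎
        where
        row : (V → Bool) → V → V → ℕ
        row P x y = 𝟙 (top x ∧ (P y ∧ adj G x y))
        P₁ P₂ : V → Bool
        P₁ = firsts b P
        P₂ x = P x ∧ not (P₁ x)
        pointwise : ∀ t p p₁ a → 𝟙 (t ∧ (p ∧ a)) ≤ 𝟙 (t ∧ (p₁ ∧ a)) + 𝟙 (t ∧ ((p ∧ not p₁) ∧ a))
        pointwise false p p₁ a = z≤n
        pointwise true false p₁ a = z≤n
        pointwise true true true a = m≤m+n _ _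
        pointwise true true false a = ≤-refl

      4cross≤e : 4 * cross S ≤ e
      4cross≤e = *-cancelˡ-≤ K (≤-trans (≤-reflexive (id₁ K (cross S))) (pieces K S (<⇒≤ n<Kb)))
        where
        id₁ : ∀ K x → K * (4 * x) ≡ 4 * K * x
        id₁ = solve-∀

      S′ : V → Bool
      S′ x = S x ∧ not (Δ <ᵇ degree x)

      e≤2e′ : e ≤ 2 * e₂ S′
      e≤2e′ = +-cancelʳ-≤ e _ _ (begin
        e + e ≤⟨ +-mono-≤ split split ⟩
        (e₂ S′ + (cross S + cross S)) + (e₂ S′ + (cross S + cross S)) ≡⟨ id₁ (e₂ S′) (cross S) ⟩
        2 * e₂ S′ + 4 * cross S ≤⟨ +-monoʳ-≤ (2 * e₂ S′) 4cross≤e ⟩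
        -- Since `e₂` counts ordered pairs, removing the top vertices loses at most 2 `cross S`,
        -- hence at most half of `e`.
        2 * e₂ S′ + e ∎)
        where
        id₁ : ∀ a x → (a + (x + x)) + (a + (x + x)) ≡ 2 * a + 4 * x
        id₁ = solve-∀
        pointwise : ∀ s s′ t t′ a → 𝟙 (s ∧ (s′ ∧ a)) ≤ 𝟙 ((s ∧ not t) ∧ ((s′ ∧ not t′) ∧ a)) + (𝟙 ((s ∧ t) ∧ (s′ ∧ a)) + 𝟙 ((s′ ∧ t′) ∧ (s ∧ a)))
        pointwise false s′ t t′ a = z≤n
        pointwise true false t t′ a = z≤n
        pointwise true true true t′ a = m≤m+n _ _
        pointwise true true false true a = ≤-refl
        pointwise true true false false a = m≤m+n _ _
        split : e ≤ e₂ S′ + (cross S + cross S)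
        split = begin
          e ≤⟨ ∑-mono (λ x → ∑-mono λ y → pointwise (S x) (S y) (Δ <ᵇ degree x) (Δ <ᵇ degree y) (adj G x y)) ⟩
          ∑ (λ x → ∑ λ y → ends S′ x y + (g x y + h x y)) ≡⟨ ∑-cong (λ x → trans (∑-distrib-+ (ends S′ x) (λ y → g x y + h x y)) (cong (∑ (ends S′ x) +_) (∑-distrib-+ (g x) (h x)))) ⟩
          ∑ (λ x → ∑ (ends S′ x) + (∑ (g x) + ∑ (h x))) ≡⟨ trans (∑-distrib-+ (λ x → ∑ (ends S′ x)) _) (cong (e₂ S′ +_) (∑-distrib-+ (λ x → ∑ (g x)) (λ x → ∑ (h x)))) ⟩
          e₂ S′ + (cross S + ∑ (λ x → ∑ (h x))) ≡⟨ cong (λ t → e₂ S′ + (cross S + t)) (trans (∑-comm h) (∑-cong λ y → ∑-cong λ x → cong (λ a → 𝟙 (top y ∧ (S x ∧ a))) (symm G x y))) ⟩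
          e₂ S′ + (cross S + cross S) ∎
          where
          g h : V → V → ℕ
          g x y = 𝟙 (top x ∧ (S y ∧ adj G x y))
          h x y = 𝟙 (top y ∧ (S x ∧ adj G x y))

      degree≤ : ∀ x → ∑ (λ y → 𝟙 (S′ x ∧ (S′ y ∧ adj G x y))) ≤ Δ
      degree≤ x with Δ <ᵇ degree x in eq
      ... | true = ≤-trans (≤-reflexive (trans (∑-cong λ y → vanish (S x) (S′ y ∧ adj G x y)) (∑-zero N))) z≤n
        where
        vanish : ∀ a c → 𝟙 ((a ∧ false) ∧ c) ≡ 0
        vanish true c = refl
        vanish false c = refl
      ... | false = ≤-trans (∑-mono λ y → pointwise (S x) (S y) (not (Δ <ᵇ degree y)) (adj G x y)) (≮⇒≥ λ lt → subst True eq (<⇒<ᵇ lt))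
        where
        pointwise : ∀ s s′ t a → 𝟙 ((s ∧ true) ∧ ((s′ ∧ t) ∧ a)) ≤ 𝟙 (s ∧ (s′ ∧ a))
        pointwise false s′ t a = z≤n
        pointwise true false t a = z≤n
        pointwise true true true a = ≤-refl
        pointwise true true false a = z≤n

      size : ∣ S′ ∣ ≤ n
      size = ∑-mono λ x → 𝟙-∧≤ (S x) (not (Δ <ᵇ degree x))

      module Asm = Assembly G free H 102<H S′ Δ degree≤ n size M

      ε : ℕ
      ε = Asm.edges

      ε≡ : ε ≡ e₂ S′
      ε≡ = ∑-comm (λ y x → 𝟙 (S′ x ∧ (S′ y ∧ adj G x y)))

      e≤2ε : e ≤ 2 * ε
      e≤2ε = subst (λ t → e ≤ 2 * t) (sym ε≡) e≤2e′

      nΔ≤K′ε : n * Δ ≤ 4 * K * ε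
      nΔ≤K′ε = begin
        n * Δ ≤⟨ nΔ≤ ⟩
        K * e + e ≡⟨ cong (K * e +_) (sym (*-identityˡ e)) ⟩
        K * e + 1 * e ≤⟨ +-monoʳ-≤ (K * e) (*-monoˡ-≤ e 1≤K) ⟩
        K * e + K * e ≤⟨ +-mono-≤ (*-monoʳ-≤ K e≤2ε) (*-monoʳ-≤ K e≤2ε) ⟩
        K * (2 * ε) + K * (2 * ε) ≡⟨ id₁ K ε ⟩
        4 * K * ε ∎
        where
        id₁ : ∀ K ε → K * (2 * ε) + K * (2 * ε) ≡ 4 * K * ε
        id₁ = solve-∀

      dense′ : cube B * (n * cube n) ≤ cube ε
      dense′ = *-cancelˡ-≤ 8 (begin
        8 * (cube B * (n * cube n)) ≡⟨ sym (*-assoc 8 (cube B) (n * cube n)) ⟩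
        A * (n * cube n) ≤⟨ <⇒≤ dense ⟩
        cube e ≤⟨ cube-mono e≤2ε ⟩
        cube (2 * ε) ≡⟨ id₁ ε ⟩
        8 * cube ε ∎)
        where
        id₁ : ∀ ε → 2 * ε * (2 * ε * (2 * ε)) ≡ 8 * (ε * (ε * ε))
        id₁ = solve-∀

      ℓ : ℕ
      ℓ = Spread.light-bound G free H 102<H S′ Δ degree≤ + Δ

      ℓ≤ : ℓ ≤ c * Δ
      -- The summand of `light-bound` without a factor Δ is absorbed because Δ is a successor.
      ℓ≤ = subst (λ c → ℓ ≤ c * Δ) (sym c≡) (bound 99 (K * e / n))
        where
        id₁ : ∀ w d H → (H * suc d * H + H * suc d * H) + w * (H * (H * H) + 3 * (suc d * (H * H))) + suc d + w * (H * (H * H) * d) ≡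
          ((H * H + H * H) + (w * (H * (H * H) + 3 * (H * H)) + 1)) * suc d
        id₁ = solve-∀
        bound : ∀ w d → (H * suc d * H + H * suc d * H) + w * (H * (H * H) + 3 * (suc d * (H * H))) + suc d ≤
          ((H * H + H * H) + (w * (H * (H * H) + 3 * (H * H)) + 1)) * suc d
        bound w d = ≤-trans (m≤m+n _ (w * (H * (H * H) * d))) (≤-reflexive (id₁ w d H))

      contradiction : ⊥
      contradiction = Arithmetic.contradiction n Δ ε Asm.cherries Asm.triples H (4 * K) c M B C₄ ℓ
        Asm.edges²≤ Asm.cherries³≤
        (subst (λ C → M * Asm.triples ≤ M * (3 * Asm.same-end-constant + 3 * Asm.same-middle-constant)
          + 3 * (n * (Δ * Δ * (Δ * Δ)) * (H * ℓ * (Δ * (H * H)))) + M * (n * (n * (n * C)))) (sym C₄≡) Asm.triples-bound)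
        ℓ≤ nΔ≤K′ε dense′ 1≤n 1≤M 1≤B B₁ B₂ B₃ B₄ M-large

    bounded : ∀ S → Bounded S
    bounded S = <-rec (λ k → ∀ S → ∣ S ∣ ≡ k → Bounded S) step ∣ S ∣ S refl
      where
      step : ∀ k → (∀ {k′} → k′ < k → ∀ S → ∣ S ∣ ≡ k′ → Bounded S) → ∀ S → ∣ S ∣ ≡ k → Bounded S
      step k rec S refl with ∣ S ∣ ≤? K | cube (e₂ S) ≤? A * (∣ S ∣ * cube ∣ S ∣)
      ... | yes le | _      = small S le
      ... | no _   | yes le = le
      ... | no nle | no big = ⊥-elim (Minimal.contradiction S (≰⇒> nle) (λ S′ lt → rec lt S′ refl) (≰⇒> big))

    edge-bound : cube (numEdges G) ≤ A * (N * cube N)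
    edge-bound = begin
      cube (numEdges G) ≤⟨ cube-mono (m≤n*m (numEdges G) 2) ⟩
      cube (2 * numEdges G) ≡⟨ cong cube (sym (degree-sum G)) ⟩
      cube (e₂ (λ _ → true)) ≤⟨ bounded (λ _ → true) ⟩
      A * (∣ (λ _ → true) ∣ * cube ∣ (λ _ → true) ∣) ≡⟨ cong (λ t → A * (t * cube t)) (trans (∑-const N 1) (*-identityʳ N)) ⟩
      A * (N * cube N) ∎

-- The two bounds with explicit constants.

module Bounds where

  open LowerBoundCount
  open UpperBoundProof
  open import Data.Nat
  open import Data.Nat.Properties
  open import Data.Nat.Tactic.RingSolver using (solve-∀)

  UpperBound LowerBound : Set
  UpperBound = Σ ℕ λ A → 1 ≤ A × (∀ n (G : SimpleGraph n) → HFree G (subdivision (K 3 25)) → numEdges G ^ 3 ≤ A * n ^ 4)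
  LowerBound = Σ ℕ λ a → Σ ℕ λ n₀ → 1 ≤ a × (∀ n → n₀ ≤ n →
    Σ (SimpleGraph n) λ G → HFree G (subdivision (K 3 25)) × n ^ 4 ≤ a * numEdges G ^ 3)

  upper-bound : UpperBound
  -- The least admissible codegree threshold, and q⁷ for q = 4 as `piece-arithmetic` requires.
  upper-bound = from 103 (4 * 4 * 4 * (4 * 4 * (4 * 4))) ≤-refl ≤-refl (constants _ _)
    where
    cube≡ : ∀ x → x * (x * x) ≡ x * (x * (x * 1))
    cube≡ = solve-∀
    fourth≡ : ∀ x → x * (x * (x * x)) ≡ x * (x * (x * (x * 1)))
    fourth≡ = solve-∀
    from : ∀ H K′ → 102 < H → 4 * 4 * 4 * (4 * 4 * (4 * 4)) ≤ K′ → Constants H K′ → UpperBound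
    from H K′ 102<H K-large C = 8 * cube B , *-mono-≤ {1} {8} (s≤s z≤n) (cube-mono 1≤B) , λ n G free →
      subst₂ _≤_ (cube≡ (numEdges G)) (cong (8 * cube B *_) (fourth≡ n)) (Regularise.edge-bound G free H 102<H K′ K-large C)
      where open Constants C

  lower-bound : LowerBound
  lower-bound = from 289 62 (s≤s z≤n) square cubes
    where
    square : ∀ m → m * (17 * m * (17 * m)) ≡ 289 * (m * (m * m))
    square = solve-∀
    cubes : ∀ i → 64 ^ i ≡ 4 ^ i * (4 ^ i * 4 ^ i)
    cubes zero    = refl
    cubes (suc i) = trans (cong (64 *_) (cubes i)) (step (4 ^ i))
      where
      step : ∀ x → 64 * (x * (x * x)) ≡ 4 * x * (4 * x * (4 * x))
      step = solve-∀
    from : ∀ d β → 1 ≤ d → (∀ m → m * (17 * m * (17 * m)) ≡ d * (m * (m * m))) →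
      (∀ i → (2 + β) ^ i ≡ 4 ^ i * (4 ^ i * 4 ^ i)) → LowerBound
    from d β 1≤d d-spec β-spec = (d * (2 + β)) ^ 4 , d * (2 + β) ^ 3 , m^n>0 (d * (2 + β)) {{m*n≢0 d (2 + β)}} 4 ,
      DenseGraph.dense-free-graph d β d-spec β-spec
      where instance
        d≢0 : NonZero d
        d≢0 = >-nonZero 1≤d

open import Data.Nat using (ℕ; _≤_; _*_; _^_)
open import Data.Nat.Properties using (≤-trans; *-monoʳ-≤; ^-monoˡ-≤)
open Bounds using (UpperBound; LowerBound; upper-bound; lower-bound)

theorem1p1 : Σ ℕ λ a → Σ ℕ λ A → Σ ℕ λ N →
    (1 ≤ a) × (1 ≤ A) ×
    ((n m : ℕ) → N ≤ n → IsEx n (subdivision (K 3 25)) m →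
    (n ^ 4 ≤ a * m ^ 3) × (m ^ 3 ≤ A * n ^ 4))
theorem1p1 = combine upper-bound lower-bound
  where
  combine : UpperBound → LowerBound → Σ ℕ λ a → Σ ℕ λ A → Σ ℕ λ N →
    (1 ≤ a) × (1 ≤ A) ×
    ((n m : ℕ) → N ≤ n → IsEx n (subdivision (K 3 25)) m →
    (n ^ 4 ≤ a * m ^ 3) × (m ^ 3 ≤ A * n ^ 4))
  combine (A , 1≤A , upper) (a , n₀ , 1≤a , lower) = a , A , n₀ , 1≤a , 1≤A , bounds
    where
    bounds : ∀ n m → n₀ ≤ n → IsEx n (subdivision (K 3 25)) m → (n ^ 4 ≤ a * m ^ 3) × (m ^ 3 ≤ A * n ^ 4)
    -- The upper bound is applied to the extremal graph itself, while maximality compares it with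
    -- the constructed graph.
    bounds n m le ((G , free , refl) , maximal) with lower n le
    ... | G′ , free′ , dense = ≤-trans dense (*-monoʳ-≤ a (^-monoˡ-≤ 3 (maximal G′ free′))) , upper n G free
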